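{- (Subject reduction) Let $C$ be a nicely typed clause and let $Q$ be a nicely typed query. If $Q'$ is a resolvent of $C$ and $Q$ where the unification of the selected atom and the (renamed apart) clause head is solvable by moded unification, then $Q'$ is nicely typed.
   Context: **Types.** There is a finite set $\mathcal K$ of type constructors, each $K\in\mathcal K$ with an arity $m\ge 0$ (written $K/m$), and a denumerable set $\mathcal U$ of parameters. Types are the terms built from $\mathcal K$ and $\mathcal U$; $\mathcal T$ is the set of types. A flat type is a type $K(u_1,\dots,u_m)$ with $K\in\mathcal K$ and the $u_i$ distinct parameters. A type substitution is an idempotent mapping from parameters to types that is the identity almost everywhere, applied (in postfix notation) in the obvious way; $\mathrm{dom}$ denotes its domain. $\mathrm{pars}(o)$ is the set of parameters in a syntactic object $o$. We assume an order $\le$ on $\mathcal K$ such that $K/m\le K'/m'$ implies $m\ge m'$, and for each $K$ the set $\{K'\mid K\le K'\}$ has a maximum. With each pair $K/m\le K'/m'$ an injection $\iota_{K,K'}:\{1,\dots,m'\}\to\{1,\dots,m\}$ is associated such that $\iota_{K,K''}=\iota_{K,K'}\circ\iota_{K',K''}$ whenever $K\le K'\le K''$. The subtyping order $\le$ on types is the least relation such that $u\le u$ for each parameter $u$, and $K(\tau_1,\dots,\tau_m)\le K'(\tau'_1,\dots,\tau'_{m'})$ whenever $K\le K'$ and $\tau_{\iota(i)}\le\tau'_i$ for all $i\in\{1,\dots,m'\}$, where $\iota=\iota_{K,K'}$. **Typed language.** $\mathcal V$ is a denumerable set of variables; $\mathrm{vars}(o)$ is the set of variables in $o$. There are finite sets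 $\mathcal F$ of function symbols and $\mathcal P$ of predicate symbols, each symbol with an arity and a declared type. A function $f$ of arity $n$ has a declared type $(\tau_1,\dots,\tau_n,\tau)$ with $\tau_i\in\mathcal T$, $\tau$ flat, and $\mathrm{pars}(\tau_1,\dots,\tau_n)\subseteq\mathrm{pars}(\tau)$ (transparency); write $f_{\tau_1\dots\tau_n\to\tau}$. A predicate $p$ of arity $n$ has a declared type $(\tau_1,\dots,\tau_n)\in\mathcal T^n$; write $p_{\tau_1\dots\tau_n}$. The parameters in declared types are fresh for each occurrence of $f$ or $p$. There is a special predicate $=_{u,u}$ with $u\in\mathcal U$. A variable typing is a mapping from a finite subset of $\mathcal V$ to $\mathcal T$, written $\{x_1:\tau_1,\dots,x_n:\tau_n\}$. The typing rules, relative to a variable typing $U$, are: - (Var) $U\vdash x:\tau$ if $x:\tau\in U$. - (Func) if $U\vdash t_i:\sigma_i$ and $\sigma_i\le\tau_i\Theta$ for $i=1,\dots,n$, for some type substitution $\Theta$, then $U\vdash f_{\tau_1\dots\tau_n\to\tau}(t_1,\dots,t_n):\tau\Theta$. - (Atom) if $U\vdash t_i:\sigma_i$ and $\sigma_i\le\tau_i\Theta$ for $i=1,\dots,n$, for some type substitution $\Theta$, then $U\vdash p_{\tau_1\dots\tau_n}(t_1,\dots,t_n)\ \mathit{Atom}$; here $\tau_i\Theta$ is the instance of the declared type used. - (Headatom) if $U\vdash t_i:\sigma_i$ and $\sigma_i\le\tau_i$ for $i=1,\dots,n$, then $U\vdash p_{\tau_1\dots\tau_n}(t_1,\dots,t_n)\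 \mathit{Headatom}$. - (Query) if $U\vdash A_i\ \mathit{Atom}$ for all $i$, then $U\vdash A_1,\dots,A_n\ \mathit{Query}$. - (Clause) if $U\vdash Q\ \mathit{Query}$ and $U\vdash A\ \mathit{Headatom}$, then $U\vdash A\leftarrow Q\ \mathit{Clause}$. **Principal variable typings.** A term $t$ has subterm $t$ in position $\epsilon$; if $t=f(t_1,\dots,t_n)$ and $t_i$ has subterm $s$ in position $\zeta$, then $t$ has subterm $s$ in position $i.\zeta$. Let $\bar t=(t_1,\dots,t_k)$ be a vector of terms and $\bar\sigma=(\sigma_1,\dots,\sigma_k)$ a vector of types such that for some variable typing each $t_j$ has a type $\le\sigma_j$. Positions in $\bar t$ are written $j.\zeta$, with $\zeta$ a position in $t_j$. For each non-variable position $\xi$ of $\bar t$, let $f^{\xi}_{\tau^\xi_1,\dots,\tau^\xi_{n^\xi}\to\tau^\xi}$ be the function symbol there, with its declared type having fresh parameters (say, indexed by $\xi$). For each variable $x$ of $\bar t$, introduce a parameter $u^x$ (fresh, not in $\mathrm{pars}(\bar\sigma)$). The type inequality system $\mathcal I(\bar t,\bar\sigma)$ consists of the inequalities $\tau^{j}\le\sigma_j$ if $t_j$ is non-variable, $u^x\le\sigma_j$ if $t_j$ is the variable $x$, $\tau^{\xi.i}\le\tau^\xi_i$ for each non-variable position $\xi.i$ (with $\xi$ a position in some $t_j$), and $u^x\le\tau^\xi_i$ for each such position $\xi.i$ holding the variable $x$. A solution is a type substitution $\Theta$ with $\mathrm{dom}(\Theta)\cap\mathrm{pars}(\bar\sigma)=\emptyset$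 and $\tau\Theta\le\tau'\Theta$ for each inequality $\tau\le\tau'$ of the system. A solution $\Theta$ is principal if for every solution $\tilde\Theta$ there is a type substitution $\Theta'$ such that $\tau\tilde\Theta\le\tau\Theta\Theta'$ and $\tau'\tilde\Theta\le\tau'\Theta\Theta'$ for each inequality $\tau\le\tau'$ of the system. A variable typing $U$ is principal for $\bar t$ and $\bar\sigma$ if $U\supseteq\{x:u^x\Theta\mid x\in\mathrm{vars}(\bar t)\}$ for a principal solution $\Theta$ of $\mathcal I(\bar t,\bar\sigma)$. **Resolution and modes.** A query is a finite sequence of atoms; a clause $H\leftarrow\mathbf B$ has an atom $H$ as head and a query $\mathbf B$ as body. Clauses used in resolution are renamed apart (their variables are disjoint from those of the other objects in the context). $Q'$ is a resolvent of $Q=A_1,\dots,A_m$ and $H\leftarrow\mathbf B$ if $Q'=(A_1,\dots,A_{k-1},\mathbf B,A_{k+1},\dots,A_m)\theta$ for some $k$, where $H$ and the selected atom $A_k$ are unifiable with most general unifier $\theta$. With each predicate a fixed mode is associated, designating each argument position as input or output; writing an atom as $p(\bar s,\bar t)$ means $\bar s$ is the vector of terms in the input positions and $\bar t$ the vector in the output positions. For the selected atom $p(\bar s,\bar t)$ and the renamed apart clause head $p(\bar w,\bar v)$, the equation $p(\bar s,\bar t)=p(\bar w,\bar v)$ is solvable by moded unification if there are substitutions $\theta_1,\theta_2$ with $\bar w\theta_1=\bar s$, $\mathrm{vars}(\bar t\theta_1)\cap\mathrm{vars}(\bar v\theta_1)=\emptyset$ and $\bar t\theta_1\theta_2=\bar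 v\theta_1$. A vector of terms is linear if each variable occurs in it at most once. A query $p_1(\bar s_1,\bar t_1),\dots,p_n(\bar s_n,\bar t_n)$ is nicely moded if $\bar t_1,\dots,\bar t_n$ is a linear vector of terms and $\mathrm{vars}(\bar s_i)\cap\bigcup_{j=i}^n\mathrm{vars}(\bar t_j)=\emptyset$ for all $i\in\{1,\dots,n\}$. A clause $p(\bar t_0,\bar s_{n+1})\leftarrow Q$, with $Q$ as just written, is nicely moded if $Q$ is nicely moded and $\mathrm{vars}(\bar t_0)\cap\bigcup_{j=1}^n\mathrm{vars}(\bar t_j)=\emptyset$. **Nicely typed.** Let $C=p_{\bar\tau_0,\bar\sigma_{n+1}}(\bar t_0,\bar s_{n+1})\leftarrow p^1_{\bar\sigma_1,\bar\tau_1}(\bar s_1,\bar t_1),\dots,p^n_{\bar\sigma_n,\bar\tau_n}(\bar s_n,\bar t_n)$. $C$ is nicely typed if $C$ is nicely moded, its head is input-linear (i.e. $\bar t_0$ is linear), and there is a variable typing $U$ such that $U\vdash C\ \mathit{Clause}$ and for each $i\in\{0,\dots,n\}$, $U$ is principal for $\bar t_i$ and $\bar\tau'_i$, where $\bar\tau'_i$ is the instance of $\bar\tau_i$ used for deriving $U\vdash C\ \mathit{Clause}$ (so $\bar\tau_0'=\bar\tau_0$). A query $Q$ is nicely typed if the clause $\mathtt{Go}\leftarrow Q$ is nicely typed, where $\mathtt{Go}$ is a predicate of arity $0$.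
   Formalization: In moded unification, θ1 may bind only variables of the head's input terms; in "nicely typed", fresh parameters of different systems are distinct and new relative to what precedes in the clause, and principal solutions involve only parameters of their own system. -}

module Defs where

open import Data.Fin.Base using (Fin; toℕ)
open import Data.List.Base as List using (List; []; _∷_; [_]; _++_; length; take; drop)
open import Data.List.Membership.Propositional using (_∈_)
open import Data.List.Relation.Binary.Disjoint.Propositional using (Disjoint)
open import Data.List.Relation.Binary.Subset.Propositional using (_⊆_)
open import Data.List.Relation.Unary.All using (All)
open import Data.List.Relation.Unary.Unique.Propositional using (Unique)
open import Data.Maybe.Base using (Maybe; just; nothing)
open import Data.Nat.Base using (ℕ; suc; _≤_)
open import Data.Product.Base using (Σ; ∃-syntax; _×_; _,_)
open import Data.Vec.Base as Vec using (Vec; []; _∷_)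
open import Function.Base using (_∘_)
open import Function.Definitions using (Injective)
open import Relation.Binary.Core using (Rel)
open import Relation.Binary.PropositionalEquality using (_≡_; _≢_)
open import Relation.Binary.Structures using (IsDecPartialOrder)
open import Relation.Nullary.Negation using (¬_)
open import Level using (0ℓ)

Param : Set
Param = ℕ

Var : Set
Var = ℕ

record TypeConstructors : Set₁ where
  infix 4 _⊑_
  field
    size  : ℕ

  Con : Set
  Con = Fin size

  field
    arity : Con → ℕ
    _⊑_   : Rel Con 0ℓ
    ⊑-isDecPartialOrder : IsDecPartialOrder _≡_ _⊑_
    ⊑-arity   : ∀ {K K′} → K ⊑ K′ → arity K′ ≤ arity K
    ⊑-maximum : ∀ K → ∃[ M ] K ⊑ M × (∀ {K′} → K ⊑ K′ → K′ ⊑ M)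
    ι           : ∀ {K K′} → K ⊑ K′ → Fin (arity K′) → Fin (arity K)
    ι-injective : ∀ {K K′} (p : K ⊑ K′) → Injective _≡_ _≡_ (ι p)
    -- For arbitrary p, q and r, so that ι does not depend on the proof of K ⊑ K′.
    ι-∘         : ∀ {K K′ K″} (p : K ⊑ K′) (q : K′ ⊑ K″) (r : K ⊑ K″) i →
                  ι r i ≡ ι p (ι q i)

module Types (𝒦 : TypeConstructors) where
  open TypeConstructors 𝒦

  infix  4 _≼_ _∈dom_
  infixl 8 _⟪_⟫ _⟪_⟫ᵛ

  data Ty : Set where
    par : Param → Ty
    con : (K : Con) → Vec Ty (arity K) → Ty

  data _≼_ : Rel Ty 0ℓ where
    par : ∀ u → par u ≼ par u
    con : ∀ {K K′ τs τs′} (K⊑K′ : K ⊑ K′) →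
          (∀ i → Vec.lookup τs (ι K⊑K′ i) ≼ Vec.lookup τs′ i) →
          con K τs ≼ con K′ τs′

  pars  : Ty → List Param
  parsᵛ : ∀ {n} → Vec Ty n → List Param
  pars (par u)    = [ u ]
  pars (con K τs) = parsᵛ τs
  parsᵛ []        = []
  parsᵛ (τ ∷ τs)  = pars τ ++ parsᵛ τs

  _⟪_⟫  : Ty → (Param → Ty) → Ty
  _⟪_⟫ᵛ : ∀ {n} → Vec Ty n → (Param → Ty) → Vec Ty n
  par u    ⟪ θ ⟫   = θ u
  con K τs ⟪ θ ⟫   = con K (τs ⟪ θ ⟫ᵛ)
  []       ⟪ θ ⟫ᵛ  = []
  (τ ∷ τs) ⟪ θ ⟫ᵛ  = τ ⟪ θ ⟫ ∷ τs ⟪ θ ⟫ᵛ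

  record TySubst : Set where
    field
      map        : Param → Ty
      finite     : ∃[ n ] ∀ u → n ≤ u → map u ≡ par u
      idempotent : ∀ u → map u ⟪ map ⟫ ≡ map u

  open TySubst public using (map)

  _∈dom_ : Param → TySubst → Set
  u ∈dom Θ = map Θ u ≢ par u

  record FlatTy : Set where
    field
      top      : Con
      params   : Vec Param (arity top)
      distinct : Unique (Vec.toList params)

    ty : Ty
    ty = con top (Vec.map par params)

data Mode : Set where
  input output : Mode

countMode : ∀ {n} → Mode → Vec Mode n → ℕ
countMode m      []            = 0
countMode input  (input  ∷ ms) = suc (countMode input ms)
countMode input  (output ∷ ms) = countMode input ms
countMode output (input  ∷ ms) = countMode output ms
countMode output (output ∷ ms) = suc (countMode output ms)

pick : ∀ {A : Set} {n} (m : Mode) (ms : Vec Mode n) → Vec A n → Vec A (countMode m ms)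
pick m      []            []       = []
pick input  (input  ∷ ms) (a ∷ as) = a ∷ pick input ms as
pick input  (output ∷ ms) (a ∷ as) = pick input ms as
pick output (input  ∷ ms) (a ∷ as) = pick output ms as
pick output (output ∷ ms) (a ∷ as) = a ∷ pick output ms as

data PredSym (n : ℕ) : Set where
  eq go : PredSym n
  other : Fin n → PredSym n

extendArity : ∀ {n} → (Fin n → ℕ) → PredSym n → ℕ
extendArity a eq        = 2
extendArity a go        = 0
extendArity a (other p) = a p

record Signature : Set₁ where
  field
    typeConstructors : TypeConstructors

  open Types typeConstructors

  field
    #funs : ℕ

  Fun : Set
  Fun = Fin #funs

  field
    funArity    : Fun → ℕ
    funArgs     : (f : Fun) → Vec Ty (funArity f)
    funRes      : Fun → FlatTy
    transparent : ∀ f → parsᵛ (funArgs f) ⊆ pars (FlatTy.ty (funRes f))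

    #preds     : ℕ
    otherArity : Fin #preds → ℕ
    otherArgs  : (p : Fin #preds) → Vec Ty (otherArity p)

  Pred : Set
  Pred = PredSym #preds

  field
    mode : (p : Pred) → Vec Mode (extendArity otherArity p)

  predArity : Pred → ℕ
  predArity = extendArity otherArity

  predArgs : (p : Pred) → Vec Ty (predArity p)
  predArgs eq        = par 0 ∷ par 0 ∷ []
  predArgs go        = []
  predArgs (other p) = otherArgs p

module Language (𝒮 : Signature) where
  open Signature 𝒮
  open TypeConstructors typeConstructors
  open Types typeConstructors public

  infix  4 _⊢_∶_ _⊢_:Atom _⊢_:Headatom _⊢_:Query _⊢_:Clause
  infixl 8 _⟦_⟧ _⟦_⟧ᵛ _⟦_⟧ᵃ _⟦_⟧ꟴ
  infix  5 _⟵_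

  data Term : Set where
    var : Var → Term
    app : (f : Fun) → Vec Term (funArity f) → Term

  record Atom : Set where
    constructor atom
    field
      pred : Pred
      args : Vec Term (predArity pred)

    inputs : Vec Term (countMode input (mode pred))
    inputs = pick input (mode pred) args

    outputs : Vec Term (countMode output (mode pred))
    outputs = pick output (mode pred) args

  open Atom public

  Query : Set
  Query = List Atom

  record Clause : Set where
    constructor _⟵_
    field
      head : Atom
      body : Query

  open Clause public

  -- With repetitions: one entry per occurrence.
  vars  : Term → List Var
  varsᵛ : ∀ {n} → Vec Term n → List Var
  vars (var x)    = [ x ]
  vars (app f ts) = varsᵛ ts
  varsᵛ []        = []
  varsᵛ (t ∷ ts)  = vars t ++ varsᵛ ts

  varsᵃ : Atom → List Var
  varsᵃ A = varsᵛ (args A)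

  varsꟴ : Query → List Var
  varsꟴ = List.concatMap varsᵃ

  varsᶜ : Clause → List Var
  varsᶜ C = varsᵃ (head C) ++ varsꟴ (body C)

  record Subst : Set where
    field
      sub    : Var → Term
      finite : ∃[ n ] ∀ x → n ≤ x → sub x ≡ var x

  open Subst public using (sub)

  _⟦_⟧  : Term → (Var → Term) → Term
  _⟦_⟧ᵛ : ∀ {n} → Vec Term n → (Var → Term) → Vec Term n
  var x    ⟦ θ ⟧  = θ x
  app f ts ⟦ θ ⟧  = app f (ts ⟦ θ ⟧ᵛ)
  []       ⟦ θ ⟧ᵛ = []
  (t ∷ ts) ⟦ θ ⟧ᵛ = t ⟦ θ ⟧ ∷ ts ⟦ θ ⟧ᵛ

  _⟦_⟧ᵃ : Atom → (Var → Term) → Atom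
  atom p ts ⟦ θ ⟧ᵃ = atom p (ts ⟦ θ ⟧ᵛ)

  _⟦_⟧ꟴ : Query → (Var → Term) → Query
  Q ⟦ θ ⟧ꟴ = List.map (_⟦ θ ⟧ᵃ) Q

  record VarTyping : Set where
    field
      typeOf : Var → Maybe Ty
      finite : ∃[ n ] ∀ x → n ≤ x → typeOf x ≡ nothing

  open VarTyping public using (typeOf)

  -- Instances of declared types.  `rename` makes the declared parameters fresh
  -- for the occurrence; without it, idempotence of `Θ` would make the instances
  -- depend on the names chosen in the declaration.
  record Instantiation : Set where
    field
      rename           : Param → Param
      rename-injective : Injective _≡_ _≡_ rename
      Θ                : TySubst

    inst : Ty → Ty
    inst τ = τ ⟪ par ∘ rename ⟫ ⟪ map Θ ⟫

  open Instantiation public using (inst)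

  data _⊢_∶_ (U : VarTyping) : Term → Ty → Set where
    var  : ∀ {x τ} → typeOf U x ≡ just τ → U ⊢ var x ∶ τ
    func : ∀ f {ts} (σs : Vec Ty (funArity f)) (ϑ : Instantiation) →
           (∀ i → U ⊢ Vec.lookup ts i ∶ Vec.lookup σs i) →
           (∀ i → Vec.lookup σs i ≼ inst ϑ (Vec.lookup (funArgs f) i)) →
           U ⊢ app f ts ∶ inst ϑ (FlatTy.ty (funRes f))

  record _⊢_:Atom (U : VarTyping) (A : Atom) : Set where
    field
      σs    : Vec Ty (predArity (pred A))
      ϑ     : Instantiation
      typed : ∀ i → U ⊢ Vec.lookup (args A) i ∶ Vec.lookup σs i
      below : ∀ i → Vec.lookup σs i ≼ inst ϑ (Vec.lookup (predArgs (pred A)) i)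

    -- The instance of the declared type used in the derivation.
    instArgs : Vec Ty (predArity (pred A))
    instArgs = Vec.map (inst ϑ) (predArgs (pred A))

  open _⊢_:Atom public using (instArgs)

  record _⊢_:Headatom (U : VarTyping) (A : Atom) : Set where
    field
      σs    : Vec Ty (predArity (pred A))
      typed : ∀ i → U ⊢ Vec.lookup (args A) i ∶ Vec.lookup σs i
      below : ∀ i → Vec.lookup σs i ≼ Vec.lookup (predArgs (pred A)) i

  _⊢_:Query : VarTyping → Query → Set
  U ⊢ Q :Query = ∀ i → U ⊢ List.lookup Q i :Atom

  record _⊢_:Clause (U : VarTyping) (C : Clause) : Set where
    field
      query    : U ⊢ body C :Query
      headatom : U ⊢ head C :Headatom

  -- Positions are written from the root; the first entry tells apart the
  -- several vectors of terms of one clause.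
  Pos : Set
  Pos = List ℕ

  -- `at ξ u` is the copy of the declared parameter u for the occurrence of a
  -- function symbol at ξ, `of x` is the parameter of the variable x.
  data Fresh : Set where
    at : Pos → Param → Fresh
    of : Var → Fresh

  record Naming : Set where
    field
      name           : Fresh → Param
      name-injective : Injective _≡_ _≡_ name

    _atPos_ : Ty → Pos → Ty
    τ atPos ξ = τ ⟪ (λ u → par (name (at ξ u))) ⟫

    _atPosᵛ_ : ∀ {n} → Vec Ty n → Pos → Vec Ty n
    τs atPosᵛ ξ = τs ⟪ (λ u → par (name (at ξ u))) ⟫ᵛ

  module _ (ν : Naming) where
    open Naming ν

    System : Set
    System = List (Ty × Ty)

    -- ineqs ξ t σ: the inequalities for t at position ξ, bounded by σ;
    -- ineqsᵛ ξ j ts σs: the same for terms at the positions ξ.j, ξ.(j+1), …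
    ineqs  : Pos → Term → Ty → System
    ineqsᵛ : ∀ {n} → Pos → ℕ → Vec Term n → Vec Ty n → System
    ineqs ξ (var x)    σ = [ par (name (of x)) , σ ]
    ineqs ξ (app f ts) σ = (FlatTy.ty (funRes f) atPos ξ , σ)
                         ∷ ineqsᵛ ξ 0 ts (funArgs f atPosᵛ ξ)
    ineqsᵛ ξ j []       []       = []
    ineqsᵛ ξ j (t ∷ ts) (σ ∷ σs) = ineqs (ξ ++ [ j ]) t σ ++ ineqsᵛ ξ (suc j) ts σs

    𝓘 : ∀ {n} → ℕ → Vec Term n → Vec Ty n → System
    𝓘 i = ineqsᵛ [ i ] 0

    -- The fresh parameters introduced in 𝓘 i ts σs.  (Those of argument types
    -- are among those of result types, by transparency.)
    new  : Pos → Term → List Param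
    newᵛ : ∀ {n} → Pos → ℕ → Vec Term n → List Param
    new ξ (var x)    = [ name (of x) ]
    new ξ (app f ts) = pars (FlatTy.ty (funRes f) atPos ξ) ++ newᵛ ξ 0 ts
    newᵛ ξ j []       = []
    newᵛ ξ j (t ∷ ts) = new (ξ ++ [ j ]) t ++ newᵛ ξ (suc j) ts

    introduced : ∀ {n} → ℕ → Vec Term n → List Param
    introduced i = newᵛ [ i ] 0

    parsˢ : System → List Param
    parsˢ = List.concatMap λ (τ , τ′) → pars τ ++ pars τ′

    module _ {n} (i : ℕ) (ts : Vec Term n) (σs : Vec Ty n) where

      record IsSolution (Θ : TySubst) : Set where
        field
          rigid : ∀ {u} → u ∈ parsᵛ σs → ¬ (u ∈dom Θ)
          solve : All (λ (τ , τ′) → τ ⟪ map Θ ⟫ ≼ τ′ ⟪ map Θ ⟫) (𝓘 i ts σs)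

      record IsPrincipal (Θ : TySubst) : Set where
        field
          isSolution  : IsSolution Θ
          mostGeneral : ∀ Θ̃ → IsSolution Θ̃ → ∃[ Θ′ ]
            All (λ (τ , τ′) → (τ  ⟪ map Θ̃ ⟫ ≼ τ  ⟪ map Θ ⟫ ⟪ map Θ′ ⟫)
                            × (τ′ ⟪ map Θ̃ ⟫ ≼ τ′ ⟪ map Θ ⟫ ⟪ map Θ′ ⟫))
                (𝓘 i ts σs)

      -- As usual for most general solutions, Θ is taken to be relevant: on the
      -- parameters of the system it involves no parameters from outside.
      -- Otherwise independent systems could share their generic parameters.
      IsRelevant : TySubst → Set
      IsRelevant Θ = ∀ {u} → u ∈ parsˢ (𝓘 i ts σs) →
                     pars (map Θ u) ⊆ parsˢ (𝓘 i ts σs)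

      record PrincipalFor (U : VarTyping) : Set where
        field
          fresh     : Disjoint (introduced i ts) (parsᵛ σs)
          Θ         : TySubst
          principal : IsPrincipal Θ
          relevant  : IsRelevant Θ
          typing    : ∀ {x} → x ∈ varsᵛ ts → typeOf U x ≡ just (map Θ (name (of x)))

  IsUnifier : Atom → Atom → Subst → Set
  IsUnifier A B θ = A ⟦ sub θ ⟧ᵃ ≡ B ⟦ sub θ ⟧ᵃ

  record IsMGU (A B : Atom) (θ : Subst) : Set where
    field
      unifies     : IsUnifier A B θ
      mostGeneral : ∀ η → IsUnifier A B η →
                    Σ Subst λ δ → ∀ x → sub η x ≡ sub θ x ⟦ sub δ ⟧

  renameᶜ : (Var → Var) → Clause → Clause
  renameᶜ ρ (H ⟵ B) = H ⟦ var ∘ ρ ⟧ᵃ ⟵ B ⟦ var ∘ ρ ⟧ꟴ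

  IsVariant : Clause → Clause → Set
  IsVariant C C′ = Σ (Var → Var) λ ρ → Injective _≡_ _≡_ ρ × C′ ≡ renameᶜ ρ C

  record RenamedApart (C C′ : Clause) (Q : Query) : Set where
    field
      variant : IsVariant C C′
      apart   : Disjoint (varsᶜ C′) (varsꟴ Q)

  IsResolventAt : (Q : Query) → Fin (length Q) → Clause → Query → Set
  IsResolventAt Q k C Q′ =
    Σ Subst λ θ → IsMGU (head C) (List.lookup Q k) θ ×
      Q′ ≡ (take (toℕ k) Q ++ body C ++ drop (suc (toℕ k)) Q) ⟦ sub θ ⟧ꟴ

  -- θ₁ is a matching substitution: it only binds variables of the input
  -- arguments of the clause head.
  record ModedUnification (p : Pred) (as hs : Vec Term (predArity p)) : Set where
    private
      s = inputs  (atom p as)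
      t = outputs (atom p as)
      w = inputs  (atom p hs)
      v = outputs (atom p hs)
    field
      θ₁ θ₂  : Subst
      dom-θ₁ : ∀ {x} → sub θ₁ x ≢ var x → x ∈ varsᵛ w
      match₁ : w ⟦ sub θ₁ ⟧ᵛ ≡ s
      apart  : Disjoint (varsᵛ (t ⟦ sub θ₁ ⟧ᵛ)) (varsᵛ (v ⟦ sub θ₁ ⟧ᵛ))
      match₂ : t ⟦ sub θ₁ ⟧ᵛ ⟦ sub θ₂ ⟧ᵛ ≡ v ⟦ sub θ₁ ⟧ᵛ

  data SolvableByModedUnification : (selected clauseHead : Atom) → Set where
    solvable : ∀ {p as hs} → ModedUnification p as hs →
               SolvableByModedUnification (atom p as) (atom p hs)

  Linear : ∀ {n} → Vec Term n → Set
  Linear ts = Unique (varsᵛ ts)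

  outputVars : Query → List Var
  outputVars = List.concatMap (varsᵛ ∘ outputs)

  record NicelyModedQuery (Q : Query) : Set where
    field
      outputs-linear : Unique (outputVars Q)
      producer-first : ∀ i j → toℕ i ≤ toℕ j →
        Disjoint (varsᵛ (inputs (List.lookup Q i))) (varsᵛ (outputs (List.lookup Q j)))

  record NicelyModedClause (C : Clause) : Set where
    field
      body-nicelyModed : NicelyModedQuery (body C)
      head-disjoint    : Disjoint (varsᵛ (inputs (head C))) (outputVars (body C))

  record NicelyTypedClause (C : Clause) : Set where
    private
      H = head C

      A : Fin (length (body C)) → Atom
      A = List.lookup (body C)

    field
      nicelyModed  : NicelyModedClause C
      input-linear : Linear (inputs H)
      U            : VarTyping
      derivation   : U ⊢ C :Clause
      ν            : Naming

    -- System 0 belongs to the head and system i+1 to the body atom with index i.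
    -- The parameters introduced for different systems are distinct because ν is
    -- injective.  Reading the clause from left to right, "fresh" means moreover
    -- that the parameters introduced for a system do not occur in what precedes:
    -- the declared type of the head and, up to the current atom, the instances
    -- used in the derivation and the types of the input variables.
    private
      new₀ : List Param
      new₀ = introduced ν 0 (inputs H)

      newₛ : Fin (length (body C)) → List Param
      newₛ i = introduced ν (suc (toℕ i)) (outputs (A i))

      instance′ : ∀ i → Vec Ty (predArity (pred (A i)))
      instance′ i = instArgs (_⊢_:Clause.query derivation i)

    field
      fresh-head₀ : Disjoint new₀ (parsᵛ (predArgs (pred H)))
      fresh-head  : ∀ i → Disjoint (newₛ i) (parsᵛ (predArgs (pred H)))
      fresh-inst  : ∀ i j → toℕ j ≤ toℕ i → Disjoint (newₛ i) (parsᵛ (instance′ j))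
      fresh-vars  : ∀ i j → toℕ j ≤ toℕ i → ∀ {x τ} → x ∈ varsᵛ (inputs (A j)) →
                    typeOf U x ≡ just τ → Disjoint (newₛ i) (pars τ)
      principal₀  : PrincipalFor ν 0 (inputs H)
                      (pick input (mode (pred H)) (predArgs (pred H))) U
      principal   : ∀ i → PrincipalFor ν (suc (toℕ i)) (outputs (A i))
                      (pick output (mode (pred (A i))) (instance′ i)) U

  NicelyTypedQuery : Query → Set
  NicelyTypedQuery Q = NicelyTypedClause (atom go [] ⟵ Q)

{-# OPTIONS --safe #-}
module Submission where

-- The inputs of the clause head receive those of the selected atom, so a typing
-- of the latter is a solution of the system of the former, with the declared
-- types instantiated; by principality it is, up to subtyping, an instance Φ₁ of
-- the principal one.  Under Φ₁ the outputs of the head have the output types of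
-- the selected atom, and in the same way principality of the latter's output
-- system gives an instance Φ₂.  Extended by injective renamings, Φ₁ and Φ₂ type
-- the clause body and the remaining query.
--
-- Principality survives such an instantiation although the rigid parameters of
-- the bounds σ̄ get instantiated: as the terms are linear, the system can be solved
-- top-down, and in any solution of the instantiated system the value of a
-- parameter constrained by a bound can be raised to the corresponding component
-- of the uninstantiated bound, while the values of the unconstrained parameters
-- are kept as fresh copies.  The result solves the original system.
--
-- All new outputs are renamed old outputs, so each system of the resolvent is an
-- instance of an old one; its fresh parameters are disjoint copies of the old
-- ones.

open import Defs
open import Data.Bool.Base using (if_then_else_)
open import Data.Empty using (⊥-elim)
open import Data.Fin.Base using (Fin; zero; suc; toℕ)
open import Data.Fin.Properties using (any?; toℕ-injective; toℕ<n)
open import Data.List.Base as List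
  using (List; []; _∷_; [_]; _++_; concatMap; drop; filter; length; lookup; take)
open import Data.List.Membership.DecPropositional using () renaming (_∈?_ to mem)
open import Data.List.Membership.Propositional using (_∈_; _∉_)
open import Data.List.Membership.Propositional.Properties
  using (∈-++⁺ˡ; ∈-++⁺ʳ; ∈-++⁻; ∈-filter⁺; ∈-filter⁻; ∈-map⁺; ∈-map⁻)
open import Data.List.Properties
  using (++-assoc; ++-cancelˡ; ++-identityʳ; ∷-injectiveˡ; concatMap-++; length-map; map-++; map-cong; map-∘)
open import Data.List.Relation.Binary.Disjoint.Propositional using (Disjoint)
open import Data.List.Relation.Binary.Subset.Propositional using (_⊆_)
open import Data.List.Relation.Unary.All as All using (All; []; _∷_)
open import Data.List.Relation.Unary.All.Properties using (++⁺; ++⁻ˡ; ++⁻ʳ; map⁺; map⁻)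
open import Data.List.Relation.Unary.AllPairs using ([]; _∷_)
open import Data.List.Relation.Unary.Any using (here; there)
open import Data.List.Relation.Unary.Unique.Propositional using (Unique)
open import Data.Maybe.Base using (Maybe; fromMaybe; just; maybe; nothing)
open import Data.Nat.Base using (ℕ; zero; suc; _+_; _∸_; _⊔_; _≤_; _<_; z≤n; s≤s)
open import Data.Nat.Properties
open import Data.Product.Base using (Σ; ∃-syntax; _×_; _,_; proj₁; proj₂)
open import Data.Sum.Base using (_⊎_; inj₁; inj₂; [_,_]′)
open import Data.Unit.Base using (⊤; tt)
open import Data.Vec.Base as Vec using (Vec; []; _∷_)
open import Function.Base using (_∘_; id)
open import Function.Definitions using (Injective)
open import Relation.Binary.PropositionalEquality hiding ([_])
open import Relation.Binary.Structures using (IsDecPartialOrder)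
open import Relation.Nullary using (¬_; Dec; yes; no; does)
open import Relation.Nullary.Decidable using (¬?; _×-dec_; _⊎-dec_; decidable-stable)

-- Idempotence of type substitutions is lost under composition. Typings and solutions are therefore
-- handled with arbitrary functions `Param → Ty`, and an idempotent substitution is formed only
-- where the definitions demand one, on the finitely many parameters that matter. The mgu is
-- arbitrary, whereas moded unification supplies one particular unifier. Since that unifier is an
-- instance of the mgu and fixes all variables outside the selected outputs and the head inputs, the
-- mgu can only rename those variables. `Φ₂` depends on `Φ₁` but not conversely: the inputs of the
-- selected atom do not mention the parameters that `Φ₂` moves. So `Φ₁` is computed while the final
-- substitution for the query is still unknown, and `Φ₂` afterwards from the head outputs typed
-- under `Φ₁`. Freshness follows the order of the atoms in the resolvent. Principality yields `Φ₁`
-- and `Φ₂` without any control over their ranges, so parameters that are introduced only later have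
-- to be removed from their values.

infix 4 _∈?_
_∈?_ : (p : ℕ) (L : List ℕ) → Dec (p ∈ L)
_∈?_ = mem _≟_

-- Functions modified on a finite list, bounds, partial inverses, duplicate-free lists.

module _ {A : Set} where

  override : List ℕ → (ℕ → A) → (ℕ → A) → ℕ → A
  override L f g p = if does (p ∈? L) then f p else g p

  override-∈ : ∀ L f g {p} → p ∈ L → override L f g p ≡ f p
  override-∈ L f g {p} p∈L with p ∈? L
  ... | yes _  = refl
  ... | no p∉L = ⊥-elim (p∉L p∈L)

  override-∉ : ∀ L f g {p} → p ∉ L → override L f g p ≡ g p
  override-∉ L f g {p} p∉L with p ∈? L
  ... | yes p∈L = ⊥-elim (p∉L p∈L)
  ... | no _    = refl

  override-elim : ∀ L f g {p} (P : A → Set) → (p ∈ L → P (f p)) → (p ∉ L → P (g p)) →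
                  P (override L f g p)
  override-elim L f g {p} P on-L off-L with p ∈? L
  ... | yes p∈L = on-L p∈L
  ... | no p∉L  = off-L p∉L

strictBound : List ℕ → ℕ
strictBound []      = 0
strictBound (x ∷ L) = suc x ⊔ strictBound L

<strictBound : ∀ {x L} → x ∈ L → x < strictBound L
<strictBound {L = _ ∷ L} (here refl) = m≤m⊔n _ (strictBound L)
<strictBound {L = y ∷ _} (there x∈L) = ≤-trans (<strictBound x∈L) (m≤n⊔m (suc y) _)

strictBound≤⇒∉ : ∀ {x L} → strictBound L ≤ x → x ∉ L
strictBound≤⇒∉ b≤x x∈L = <-irrefl refl (<-≤-trans (<strictBound x∈L) b≤x)

-- A partial inverse of `h` on `L`. Parameters are recovered from their names and variables from
-- their renamed images with it.
find : (ℕ → ℕ) → List ℕ → ℕ → Maybe ℕ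
find h []      y = nothing
find h (x ∷ L) y with h x ≟ y
... | yes _ = just x
... | no _  = find h L y

find-sound : ∀ h L {x y} → find h L y ≡ just x → h x ≡ y
find-sound h (x ∷ L) {y = y} e with h x ≟ y
find-sound h (x ∷ L) refl | yes hx≡y = hx≡y
find-sound h (x ∷ L) e   | no _     = find-sound h L e

find-complete : ∀ h {L x} → x ∈ L → (∀ {z} → z ∈ L → h z ≡ h x → z ≡ x) →
                find h L (h x) ≡ just x
find-complete h {z ∷ L} {x} x∈L inj with h z ≟ h x
... | yes hz≡hx = cong just (inj (here refl) hz≡hx)
find-complete h {z ∷ L} {x} (here refl) inj | no hz≢hx = ⊥-elim (hz≢hx refl)
find-complete h {z ∷ L} {x} (there x∈L) inj | no hz≢hx = find-complete h x∈L (inj ∘ there)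

find-nothing : ∀ h L {y} → (∀ {z} → z ∈ L → h z ≢ y) → find h L y ≡ nothing
find-nothing h []      no-z = refl
find-nothing h (z ∷ L) {y} no-z with h z ≟ y
... | yes hz≡y = ⊥-elim (no-z (here refl) hz≡y)
... | no _     = find-nothing h L (no-z ∘ there)

lookup∈toList : ∀ {n} (ps : Vec ℕ n) i → Vec.lookup ps i ∈ Vec.toList ps
lookup∈toList (p ∷ ps) zero    = here refl
lookup∈toList (p ∷ ps) (suc i) = there (lookup∈toList ps i)

lookup-injective : ∀ {n} {ps : Vec ℕ n} → Unique (Vec.toList ps) → ∀ i j →
                   Vec.lookup ps i ≡ Vec.lookup ps j → i ≡ j
lookup-injective {ps = p ∷ ps} (p≢ ∷ u) zero    zero    e = refl
lookup-injective {ps = p ∷ ps} (p≢ ∷ u) zero    (suc j) e =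
  ⊥-elim (All.lookup p≢ (lookup∈toList ps j) e)
lookup-injective {ps = p ∷ ps} (p≢ ∷ u) (suc i) zero    e =
  ⊥-elim (All.lookup p≢ (lookup∈toList ps i) (sym e))
lookup-injective {ps = p ∷ ps} (p≢ ∷ u) (suc i) (suc j) e = cong suc (lookup-injective u i j e)

module _ {A : Set} where

  unique-++ˡ : ∀ {xs ys : List A} → Unique (xs ++ ys) → Unique xs
  unique-++ˡ {[]}     u        = []
  unique-++ˡ {x ∷ xs} (x≢ ∷ u) = All.tabulate (λ y∈ → All.lookup x≢ (∈-++⁺ˡ y∈)) ∷ unique-++ˡ u

  unique-++ʳ : ∀ (xs : List A) {ys} → Unique (xs ++ ys) → Unique ys
  unique-++ʳ []       u       = u
  unique-++ʳ (x ∷ xs) (_ ∷ u) = unique-++ʳ xs u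

  unique-++-disjoint : ∀ (xs : List A) {ys} → Unique (xs ++ ys) → Disjoint xs ys
  unique-++-disjoint (x ∷ xs) (x≢ ∷ u) (here refl , y∈)  = All.lookup x≢ (∈-++⁺ʳ xs y∈) refl
  unique-++-disjoint (x ∷ xs) (x≢ ∷ u) (there x∈ , y∈) = unique-++-disjoint xs u (x∈ , y∈)

  unique-++ : ∀ {xs ys : List A} → Unique xs → Unique ys → Disjoint xs ys → Unique (xs ++ ys)
  unique-++ {[]}     ux        uy dis = uy
  unique-++ {x ∷ xs} (x≢ ∷ ux) uy dis =
    All.tabulate (λ {y} y∈ x≡y → [ (λ y∈xs → All.lookup x≢ y∈xs x≡y)
                                 , (λ y∈ys → dis (here (sym x≡y) , y∈ys)) ]′ (∈-++⁻ xs y∈))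
    ∷ unique-++ ux uy (λ (x∈ , y∈) → dis (there x∈ , y∈))

  unique-map : ∀ (f : A → A) {xs} → (∀ {x y} → x ∈ xs → y ∈ xs → f x ≡ f y → x ≡ y) →
               Unique xs → Unique (List.map f xs)
  unique-map f {[]}     inj []       = []
  unique-map f {x ∷ xs} inj (x≢ ∷ u) =
    All.tabulate (λ fy∈ fx≡ → let y , y∈ , e = ∈-map⁻ f fy∈ in
                   All.lookup x≢ y∈ (inj (here refl) (there y∈) (trans fx≡ e)))
    ∷ unique-map f (λ x∈ y∈ → inj (there x∈) (there y∈)) u

module _ {A : Set} where

  pick-injective : ∀ {n} (ms : Vec Mode n) {as bs : Vec A n} →
                   pick input ms as ≡ pick input ms bs → pick output ms as ≡ pick output ms bs →
                   as ≡ bs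
  pick-injective []            {[]}    {[]}    ei eo = refl
  pick-injective (input  ∷ ms) {_ ∷ _} {_ ∷ _} ei eo =
    cong₂ _∷_ (cong Vec.head ei) (pick-injective ms (cong Vec.tail ei) eo)
  pick-injective (output ∷ ms) {_ ∷ _} {_ ∷ _} ei eo =
    cong₂ _∷_ (cong Vec.head eo) (pick-injective ms ei (cong Vec.tail eo))

-- Type substitutions and the subtyping order.

module TypeProperties (𝒦 : TypeConstructors) where
  open TypeConstructors 𝒦
  open Types 𝒦
  open IsDecPartialOrder ⊑-isDecPartialOrder using () renaming (refl to ⊑-refl; trans to ⊑-trans)

  -- `ι-∘` leaves the proof of the composite relation arbitrary, so both sides equal
  -- `ι p (ι ⊑-refl i)`.
  ι-irrelevant : ∀ {K K′} (p q : K ⊑ K′) i → ι p i ≡ ι q i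
  ι-irrelevant p q i = trans (ι-∘ p ⊑-refl p i) (sym (ι-∘ p ⊑-refl q i))

  -- With all three proofs equal to `p`, `ι-∘` makes `ι p` idempotent, and an injective idempotent
  -- map is the identity.
  ι-id : ∀ {K} (p : K ⊑ K) i → ι p i ≡ i
  ι-id p i = sym (ι-injective p (ι-∘ p p p i))

  ⟪⟫-∘ : ∀ τ {a b} → τ ⟪ a ⟫ ⟪ b ⟫ ≡ τ ⟪ (λ u → a u ⟪ b ⟫) ⟫
  ⟪⟫ᵛ-∘ : ∀ {n} (τs : Vec Ty n) {a b} → τs ⟪ a ⟫ᵛ ⟪ b ⟫ᵛ ≡ τs ⟪ (λ u → a u ⟪ b ⟫) ⟫ᵛ
  ⟪⟫-∘ (par u)    = refl
  ⟪⟫-∘ (con K τs) = cong (con K) (⟪⟫ᵛ-∘ τs)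
  ⟪⟫ᵛ-∘ []       = refl
  ⟪⟫ᵛ-∘ (τ ∷ τs) = cong₂ _∷_ (⟪⟫-∘ τ) (⟪⟫ᵛ-∘ τs)

  ⟪⟫-cong : ∀ τ {a b} → (∀ {u} → u ∈ pars τ → a u ≡ b u) → τ ⟪ a ⟫ ≡ τ ⟪ b ⟫
  ⟪⟫ᵛ-cong : ∀ {n} (τs : Vec Ty n) {a b} → (∀ {u} → u ∈ parsᵛ τs → a u ≡ b u) →
             τs ⟪ a ⟫ᵛ ≡ τs ⟪ b ⟫ᵛ
  ⟪⟫-cong (par u)    a≡b = a≡b (here refl)
  ⟪⟫-cong (con K τs) a≡b = cong (con K) (⟪⟫ᵛ-cong τs a≡b)
  ⟪⟫ᵛ-cong []       a≡b = refl
  ⟪⟫ᵛ-cong (τ ∷ τs) a≡b =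
    cong₂ _∷_ (⟪⟫-cong τ (a≡b ∘ ∈-++⁺ˡ)) (⟪⟫ᵛ-cong τs (a≡b ∘ ∈-++⁺ʳ (pars τ)))

  ⟪par⟫ : ∀ τ → τ ⟪ par ⟫ ≡ τ
  ⟪par⟫ᵛ : ∀ {n} (τs : Vec Ty n) → τs ⟪ par ⟫ᵛ ≡ τs
  ⟪par⟫ (par u)    = refl
  ⟪par⟫ (con K τs) = cong (con K) (⟪par⟫ᵛ τs)
  ⟪par⟫ᵛ []       = refl
  ⟪par⟫ᵛ (τ ∷ τs) = cong₂ _∷_ (⟪par⟫ τ) (⟪par⟫ᵛ τs)

  ⟪⟫-id : ∀ τ {a} → (∀ {u} → u ∈ pars τ → a u ≡ par u) → τ ⟪ a ⟫ ≡ τ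
  ⟪⟫-id τ a≡par = trans (⟪⟫-cong τ a≡par) (⟪par⟫ τ)

  ⟪⟫ᵛ-id : ∀ {n} (τs : Vec Ty n) {a} → (∀ {u} → u ∈ parsᵛ τs → a u ≡ par u) → τs ⟪ a ⟫ᵛ ≡ τs
  ⟪⟫ᵛ-id τs a≡par = trans (⟪⟫ᵛ-cong τs a≡par) (⟪par⟫ᵛ τs)

  pars-⟪⟫⁻ : ∀ τ {a q} → q ∈ pars (τ ⟪ a ⟫) → ∃[ p ] p ∈ pars τ × q ∈ pars (a p)
  parsᵛ-⟪⟫⁻ : ∀ {n} (τs : Vec Ty n) {a q} → q ∈ parsᵛ (τs ⟪ a ⟫ᵛ) →
              ∃[ p ] p ∈ parsᵛ τs × q ∈ pars (a p)
  pars-⟪⟫⁻ (par u)    q∈ = u , here refl , q∈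
  pars-⟪⟫⁻ (con K τs) q∈ = parsᵛ-⟪⟫⁻ τs q∈
  parsᵛ-⟪⟫⁻ (τ ∷ τs) {a} q∈ with ∈-++⁻ (pars (τ ⟪ a ⟫)) q∈
  ... | inj₁ q∈τ  with p , p∈ , q∈p ← pars-⟪⟫⁻ τ q∈τ = p , ∈-++⁺ˡ p∈ , q∈p
  ... | inj₂ q∈τs with p , p∈ , q∈p ← parsᵛ-⟪⟫⁻ τs q∈τs = p , ∈-++⁺ʳ (pars τ) p∈ , q∈p

  pars-⟪⟫⁺ : ∀ τ {a p q} → p ∈ pars τ → q ∈ pars (a p) → q ∈ pars (τ ⟪ a ⟫)
  parsᵛ-⟪⟫⁺ : ∀ {n} (τs : Vec Ty n) {a p q} → p ∈ parsᵛ τs → q ∈ pars (a p) →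
              q ∈ parsᵛ (τs ⟪ a ⟫ᵛ)
  pars-⟪⟫⁺ (par u)    (here refl) q∈ = q∈
  pars-⟪⟫⁺ (con K τs) p∈          q∈ = parsᵛ-⟪⟫⁺ τs p∈ q∈
  parsᵛ-⟪⟫⁺ (τ ∷ τs) {a} p∈ q∈ with ∈-++⁻ (pars τ) p∈
  ... | inj₁ p∈τ  = ∈-++⁺ˡ (pars-⟪⟫⁺ τ p∈τ q∈)
  ... | inj₂ p∈τs = ∈-++⁺ʳ (pars (τ ⟪ a ⟫)) (parsᵛ-⟪⟫⁺ τs p∈τs q∈)

  pars-rename : ∀ τ h → pars (τ ⟪ par ∘ h ⟫) ≡ List.map h (pars τ)
  parsᵛ-rename : ∀ {n} (τs : Vec Ty n) h → parsᵛ (τs ⟪ par ∘ h ⟫ᵛ) ≡ List.map h (parsᵛ τs)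
  pars-rename (par u)    h = refl
  pars-rename (con K τs) h = parsᵛ-rename τs h
  parsᵛ-rename []       h = refl
  parsᵛ-rename (τ ∷ τs) h =
    trans (cong₂ _++_ (pars-rename τ h) (parsᵛ-rename τs h)) (sym (map-++ h (pars τ) (parsᵛ τs)))

  lookup-⟪⟫ : ∀ {n} (τs : Vec Ty n) a i → Vec.lookup (τs ⟪ a ⟫ᵛ) i ≡ Vec.lookup τs i ⟪ a ⟫
  lookup-⟪⟫ (τ ∷ τs) a zero    = refl
  lookup-⟪⟫ (τ ∷ τs) a (suc i) = lookup-⟪⟫ τs a i

  -- The hypothesis is confined to types over the parameters of `τs` because an `Instantiation` can
  -- be made to agree with a given function only on a prescribed finite list.
  map-⟪⟫ : ∀ {n} (τs : Vec Ty n) {f a} → (∀ {τ} → pars τ ⊆ parsᵛ τs → f τ ≡ τ ⟪ a ⟫) →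
           Vec.map f τs ≡ τs ⟪ a ⟫ᵛ
  map-⟪⟫ []       f≡ = refl
  map-⟪⟫ (τ ∷ τs) f≡ = cong₂ _∷_ (f≡ ∈-++⁺ˡ) (map-⟪⟫ τs λ ⊆τs → f≡ (∈-++⁺ʳ (pars τ) ∘ ⊆τs))

  lookup-map-par : ∀ {n} (ps : Vec Param n) a i →
                   Vec.lookup (Vec.map par ps ⟪ a ⟫ᵛ) i ≡ a (Vec.lookup ps i)
  lookup-map-par (p ∷ ps) a zero    = refl
  lookup-map-par (p ∷ ps) a (suc i) = lookup-map-par ps a i

  pars-lookup : ∀ {n} (τs : Vec Ty n) i → pars (Vec.lookup τs i) ⊆ parsᵛ τs
  pars-lookup (τ ∷ τs) zero    = ∈-++⁺ˡ
  pars-lookup (τ ∷ τs) (suc i) = ∈-++⁺ʳ (pars τ) ∘ pars-lookup τs i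

  parsᵛ-lookup : ∀ {n} (τs : Vec Ty n) {p} → p ∈ parsᵛ τs → ∃[ i ] p ∈ pars (Vec.lookup τs i)
  parsᵛ-lookup (τ ∷ τs) p∈ with ∈-++⁻ (pars τ) p∈
  ... | inj₁ p∈τ  = zero , p∈τ
  ... | inj₂ p∈τs with i , p∈i ← parsᵛ-lookup τs p∈τs = suc i , p∈i

  parsᵛ-pick : ∀ m {n} (ms : Vec Mode n) (τs : Vec Ty n) → parsᵛ (pick m ms τs) ⊆ parsᵛ τs
  parsᵛ-pick input  []            []       ()
  parsᵛ-pick output []            []       ()
  parsᵛ-pick input  (input  ∷ ms) (τ ∷ τs) p∈ with ∈-++⁻ (pars τ) p∈
  ... | inj₁ p∈τ  = ∈-++⁺ˡ p∈τ
  ... | inj₂ p∈τs = ∈-++⁺ʳ (pars τ) (parsᵛ-pick input ms τs p∈τs)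
  parsᵛ-pick input  (output ∷ ms) (τ ∷ τs) p∈ = ∈-++⁺ʳ (pars τ) (parsᵛ-pick input ms τs p∈)
  parsᵛ-pick output (input  ∷ ms) (τ ∷ τs) p∈ = ∈-++⁺ʳ (pars τ) (parsᵛ-pick output ms τs p∈)
  parsᵛ-pick output (output ∷ ms) (τ ∷ τs) p∈ with ∈-++⁻ (pars τ) p∈
  ... | inj₁ p∈τ  = ∈-++⁺ˡ p∈τ
  ... | inj₂ p∈τs = ∈-++⁺ʳ (pars τ) (parsᵛ-pick output ms τs p∈τs)

  pick-⟪⟫ : ∀ m {n} (ms : Vec Mode n) (τs : Vec Ty n) a →
            pick m ms (τs ⟪ a ⟫ᵛ) ≡ pick m ms τs ⟪ a ⟫ᵛ
  pick-⟪⟫ m      []            []       a = refl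
  pick-⟪⟫ input  (input  ∷ ms) (τ ∷ τs) a = cong (_ ∷_) (pick-⟪⟫ input ms τs a)
  pick-⟪⟫ input  (output ∷ ms) (τ ∷ τs) a = pick-⟪⟫ input ms τs a
  pick-⟪⟫ output (input  ∷ ms) (τ ∷ τs) a = pick-⟪⟫ output ms τs a
  pick-⟪⟫ output (output ∷ ms) (τ ∷ τs) a = cong (_ ∷_) (pick-⟪⟫ output ms τs a)

  ≼-trans : ∀ {ρ σ τ} → ρ ≼ σ → σ ≼ τ → ρ ≼ τ
  ≼-trans (par u)              (par .u)  = par u
  ≼-trans (con {τs = τs} p h) (con {τs′ = τs″} q g) =
    con (⊑-trans p q) λ i → subst (λ j → Vec.lookup τs j ≼ Vec.lookup τs″ i)
      (sym (ι-∘ p q (⊑-trans p q) i)) (≼-trans (h (ι q i)) (g i))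

  ≼-mono : ∀ τ {a b} → (∀ {u} → u ∈ pars τ → a u ≼ b u) → τ ⟪ a ⟫ ≼ τ ⟪ b ⟫
  ≼-monoᵛ : ∀ {n} (τs : Vec Ty n) {a b} → (∀ {u} → u ∈ parsᵛ τs → a u ≼ b u) →
            ∀ i → Vec.lookup (τs ⟪ a ⟫ᵛ) i ≼ Vec.lookup (τs ⟪ b ⟫ᵛ) i
  ≼-mono (par u)        a≼b = a≼b (here refl)
  ≼-mono (con K τs) {a} {b} a≼b =
    con ⊑-refl λ i → subst (λ j → Vec.lookup (τs ⟪ a ⟫ᵛ) j ≼ Vec.lookup (τs ⟪ b ⟫ᵛ) i)
      (sym (ι-id ⊑-refl i)) (≼-monoᵛ τs a≼b i)
  ≼-monoᵛ (τ ∷ τs) a≼b zero    = ≼-mono τ (a≼b ∘ ∈-++⁺ˡ)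
  ≼-monoᵛ (τ ∷ τs) a≼b (suc i) = ≼-monoᵛ τs (a≼b ∘ ∈-++⁺ʳ (pars τ)) i

  ≼-refl : ∀ {τ} → τ ≼ τ
  ≼-refl {τ} = subst₂ _≼_ (⟪par⟫ τ) (⟪par⟫ τ) (≼-mono τ λ {u} _ → par u)

  ≼-reflexive : ∀ {σ τ} → σ ≡ τ → σ ≼ τ
  ≼-reflexive refl = ≼-refl

  ≼-⟪⟫ : ∀ {σ τ} → σ ≼ τ → ∀ a → σ ⟪ a ⟫ ≼ τ ⟪ a ⟫
  ≼-⟪⟫ (par u) a = ≼-refl
  ≼-⟪⟫ (con {τs = τs} {τs′} p h) a = con p λ i →
    subst₂ _≼_ (sym (lookup-⟪⟫ τs a (ι p i))) (sym (lookup-⟪⟫ τs′ a i)) (≼-⟪⟫ (h i) a)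

  -- Both sides have the shape of `τ`, so the injection at each constructor is the identity and the
  -- comparison descends to every occurrence of `p`.
  ≼-mono⁻ : ∀ τ {a b p} → τ ⟪ a ⟫ ≼ τ ⟪ b ⟫ → p ∈ pars τ → a p ≼ b p
  ≼-mono⁻ᵛ : ∀ {n} (τs : Vec Ty n) {a b p} →
             (∀ i → Vec.lookup (τs ⟪ a ⟫ᵛ) i ≼ Vec.lookup (τs ⟪ b ⟫ᵛ) i) →
             p ∈ parsᵛ τs → a p ≼ b p
  ≼-mono⁻ (par u)    τa≼τb (here refl) = τa≼τb
  ≼-mono⁻ (con K τs) {a} {b} (con q h) p∈ = ≼-mono⁻ᵛ τs
    (λ i → subst (λ j → Vec.lookup (τs ⟪ a ⟫ᵛ) j ≼ Vec.lookup (τs ⟪ b ⟫ᵛ) i) (ι-id q i) (h i)) p∈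
  ≼-mono⁻ᵛ (τ ∷ τs) h p∈ with ∈-++⁻ (pars τ) p∈
  ... | inj₁ p∈τ  = ≼-mono⁻ τ (h zero) p∈τ
  ... | inj₂ p∈τs = ≼-mono⁻ᵛ τs (h ∘ suc) p∈τs

  -- Each argument of the larger type lies above some argument of the smaller one, so going up can
  -- only drop parameters.
  ≼-pars : ∀ {σ τ} → σ ≼ τ → pars τ ⊆ pars σ
  ≼-pars (par u) p∈ = p∈
  ≼-pars (con {τs = τs} {τs′} p h) p∈ with i , p∈i ← parsᵛ-lookup τs′ p∈ =
    pars-lookup τs (ι p i) (≼-pars (h i) p∈i)

  par≼ : ∀ {u τ} → par u ≼ τ → τ ≡ par u
  par≼ (par u) = refl

  isPar? : ∀ (τ : Ty) u → Dec (τ ≡ par u)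
  isPar? (par v)    u with v ≟ u
  ... | yes refl = yes refl
  ... | no v≢u   = no λ { refl → v≢u refl }
  isPar? (con K τs) u = no λ ()

  -- This is how idempotence gets used: with `τ` a value of a substitution, every parameter
  -- occurring in that value is fixed.
  ⟪⟫-id⁻ : ∀ τ {a p} → τ ⟪ a ⟫ ≡ τ → p ∈ pars τ → a p ≡ par p
  ⟪⟫-id⁻ τ τa≡τ p∈ = par≼ (≼-mono⁻ τ (≼-reflexive (trans (⟪par⟫ τ) (sym τa≡τ))) p∈)

  -- Outside `L` the result is the identity, so idempotence concerns only those parameters of a
  -- value `f u` that lie in `L` again.
  restrict : (L : List Param) (f : Param → Ty) →
             (∀ {u q} → u ∈ L → q ∈ pars (f u) → q ∈ L → f q ≡ par q) → TySubst
  restrict L f fixed = record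
    { map        = g
    ; finite     = strictBound L , λ u b≤u → override-∉ L f par (strictBound≤⇒∉ {L = L} b≤u)
    ; idempotent = idem
    }
    where
    g = override L f par
    idem : ∀ u → g u ⟪ g ⟫ ≡ g u
    idem u with u ∈? L
    ... | no u∉L  = override-∉ L f par u∉L
    ... | yes u∈L = ⟪⟫-id (f u) fixes
      where
      fixes : ∀ {q} → q ∈ pars (f u) → g q ≡ par q
      fixes {q} q∈ with q ∈? L
      ... | yes q∈L = fixed u∈L q∈ q∈L
      ... | no _    = refl

-- Typability up to subtyping and its equivalence with the typing rules.

module Typing (𝒮 : Signature) where
  open Signature 𝒮
  open TypeConstructors typeConstructors
  open Language 𝒮
  open TypeProperties typeConstructors

  ⟦⟧-∘ : ∀ t {θ η} → t ⟦ θ ⟧ ⟦ η ⟧ ≡ t ⟦ (λ x → θ x ⟦ η ⟧) ⟧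
  ⟦⟧ᵛ-∘ : ∀ {n} (ts : Vec Term n) {θ η} → ts ⟦ θ ⟧ᵛ ⟦ η ⟧ᵛ ≡ ts ⟦ (λ x → θ x ⟦ η ⟧) ⟧ᵛ
  ⟦⟧-∘ (var x)    = refl
  ⟦⟧-∘ (app f ts) = cong (app f) (⟦⟧ᵛ-∘ ts)
  ⟦⟧ᵛ-∘ []       = refl
  ⟦⟧ᵛ-∘ (t ∷ ts) = cong₂ _∷_ (⟦⟧-∘ t) (⟦⟧ᵛ-∘ ts)

  ⟦⟧-cong : ∀ t {θ η} → (∀ {x} → x ∈ vars t → θ x ≡ η x) → t ⟦ θ ⟧ ≡ t ⟦ η ⟧
  ⟦⟧ᵛ-cong : ∀ {n} (ts : Vec Term n) {θ η} → (∀ {x} → x ∈ varsᵛ ts → θ x ≡ η x) →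
             ts ⟦ θ ⟧ᵛ ≡ ts ⟦ η ⟧ᵛ
  ⟦⟧-cong (var x)    θ≡η = θ≡η (here refl)
  ⟦⟧-cong (app f ts) θ≡η = cong (app f) (⟦⟧ᵛ-cong ts θ≡η)
  ⟦⟧ᵛ-cong []       θ≡η = refl
  ⟦⟧ᵛ-cong (t ∷ ts) θ≡η =
    cong₂ _∷_ (⟦⟧-cong t (θ≡η ∘ ∈-++⁺ˡ)) (⟦⟧ᵛ-cong ts (θ≡η ∘ ∈-++⁺ʳ (vars t)))

  ⟦var⟧ : ∀ t → t ⟦ var ⟧ ≡ t
  ⟦var⟧ᵛ : ∀ {n} (ts : Vec Term n) → ts ⟦ var ⟧ᵛ ≡ ts
  ⟦var⟧ (var x)    = refl
  ⟦var⟧ (app f ts) = cong (app f) (⟦var⟧ᵛ ts)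
  ⟦var⟧ᵛ []       = refl
  ⟦var⟧ᵛ (t ∷ ts) = cong₂ _∷_ (⟦var⟧ t) (⟦var⟧ᵛ ts)

  varsᵛ-⟦⟧⁻ : ∀ {n} (ts : Vec Term n) {θ y} → y ∈ varsᵛ (ts ⟦ θ ⟧ᵛ) →
              ∃[ x ] x ∈ varsᵛ ts × y ∈ vars (θ x)
  vars-⟦⟧⁻ : ∀ t {θ y} → y ∈ vars (t ⟦ θ ⟧) → ∃[ x ] x ∈ vars t × y ∈ vars (θ x)
  vars-⟦⟧⁻ (var x)    y∈ = x , here refl , y∈
  vars-⟦⟧⁻ (app f ts) y∈ = varsᵛ-⟦⟧⁻ ts y∈
  varsᵛ-⟦⟧⁻ (t ∷ ts) {θ} y∈ with ∈-++⁻ (vars (t ⟦ θ ⟧)) y∈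
  ... | inj₁ y∈t  with x , x∈ , y∈x ← vars-⟦⟧⁻ t y∈t    = x , ∈-++⁺ˡ x∈ , y∈x
  ... | inj₂ y∈ts with x , x∈ , y∈x ← varsᵛ-⟦⟧⁻ ts y∈ts = x , ∈-++⁺ʳ (vars t) x∈ , y∈x

  vars-⟦⟧⁺ : ∀ t {θ x y} → x ∈ vars t → y ∈ vars (θ x) → y ∈ vars (t ⟦ θ ⟧)
  varsᵛ-⟦⟧⁺ : ∀ {n} (ts : Vec Term n) {θ x y} → x ∈ varsᵛ ts → y ∈ vars (θ x) →
              y ∈ varsᵛ (ts ⟦ θ ⟧ᵛ)
  vars-⟦⟧⁺ (var x)    (here refl) y∈ = y∈
  vars-⟦⟧⁺ (app f ts) x∈          y∈ = varsᵛ-⟦⟧⁺ ts x∈ y∈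
  varsᵛ-⟦⟧⁺ (t ∷ ts) {θ} x∈ y∈ with ∈-++⁻ (vars t) x∈
  ... | inj₁ x∈t  = ∈-++⁺ˡ (vars-⟦⟧⁺ t x∈t y∈)
  ... | inj₂ x∈ts = ∈-++⁺ʳ (vars (t ⟦ θ ⟧)) (varsᵛ-⟦⟧⁺ ts x∈ts y∈)

  vars-rename : ∀ t r → vars (t ⟦ var ∘ r ⟧) ≡ List.map r (vars t)
  varsᵛ-rename : ∀ {n} (ts : Vec Term n) r → varsᵛ (ts ⟦ var ∘ r ⟧ᵛ) ≡ List.map r (varsᵛ ts)
  vars-rename (var x)    r = refl
  vars-rename (app f ts) r = varsᵛ-rename ts r
  varsᵛ-rename []       r = refl
  varsᵛ-rename (t ∷ ts) r =
    trans (cong₂ _++_ (vars-rename t r) (varsᵛ-rename ts r)) (sym (map-++ r (vars t) (varsᵛ ts)))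

  pick-⟦⟧ : ∀ m {n} (ms : Vec Mode n) (ts : Vec Term n) θ →
            pick m ms (ts ⟦ θ ⟧ᵛ) ≡ pick m ms ts ⟦ θ ⟧ᵛ
  pick-⟦⟧ m      []            []       θ = refl
  pick-⟦⟧ input  (input  ∷ ms) (t ∷ ts) θ = cong (_ ∷_) (pick-⟦⟧ input ms ts θ)
  pick-⟦⟧ input  (output ∷ ms) (t ∷ ts) θ = pick-⟦⟧ input ms ts θ
  pick-⟦⟧ output (input  ∷ ms) (t ∷ ts) θ = pick-⟦⟧ output ms ts θ
  pick-⟦⟧ output (output ∷ ms) (t ∷ ts) θ = cong (_ ∷_) (pick-⟦⟧ output ms ts θ)

  varsᵛ-pick : ∀ m {n} (ms : Vec Mode n) (ts : Vec Term n) → varsᵛ (pick m ms ts) ⊆ varsᵛ ts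
  varsᵛ-pick input  []            []       ()
  varsᵛ-pick output []            []       ()
  varsᵛ-pick input  (input  ∷ ms) (t ∷ ts) x∈ with ∈-++⁻ (vars t) x∈
  ... | inj₁ x∈t  = ∈-++⁺ˡ x∈t
  ... | inj₂ x∈ts = ∈-++⁺ʳ (vars t) (varsᵛ-pick input ms ts x∈ts)
  varsᵛ-pick input  (output ∷ ms) (t ∷ ts) x∈ = ∈-++⁺ʳ (vars t) (varsᵛ-pick input ms ts x∈)
  varsᵛ-pick output (input  ∷ ms) (t ∷ ts) x∈ = ∈-++⁺ʳ (vars t) (varsᵛ-pick output ms ts x∈)
  varsᵛ-pick output (output ∷ ms) (t ∷ ts) x∈ with ∈-++⁻ (vars t) x∈
  ... | inj₁ x∈t  = ∈-++⁺ˡ x∈t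
  ... | inj₂ x∈ts = ∈-++⁺ʳ (vars t) (varsᵛ-pick output ms ts x∈ts)

  -- Typability with a type below B.  Unlike in _⊢_∶_, the instances are given by
  -- arbitrary functions: on the finitely many parameters that matter, each one
  -- is an Instantiation.
  Has  : (Var → Ty) → Term → Ty → Set
  Hasᵛ : ∀ {n} → (Var → Ty) → Vec Term n → Vec Ty n → Set
  Has u (var x)    B = u x ≼ B
  Has u (app f ts) B = ∃[ ρ ] FlatTy.ty (funRes f) ⟪ ρ ⟫ ≼ B × Hasᵛ u ts (funArgs f ⟪ ρ ⟫ᵛ)
  Hasᵛ u []       []       = ⊤
  Hasᵛ u (t ∷ ts) (B ∷ Bs) = Has u t B × Hasᵛ u ts Bs

  Has-≼ : ∀ {u} t {A B} → Has u t A → A ≼ B → Has u t B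
  Has-≼ (var x)    ux≼A          A≼B = ≼-trans ux≼A A≼B
  Has-≼ (app f ts) (ρ , ≼A , hs) A≼B = ρ , ≼-trans ≼A A≼B , hs

  Hasᵛ-tabulate : ∀ {n u} (ts : Vec Term n) (Bs : Vec Ty n) →
                  (∀ i → Has u (Vec.lookup ts i) (Vec.lookup Bs i)) → Hasᵛ u ts Bs
  Hasᵛ-tabulate []       []       h = tt
  Hasᵛ-tabulate (t ∷ ts) (B ∷ Bs) h = h zero , Hasᵛ-tabulate ts Bs (h ∘ suc)

  Hasᵛ-pick : ∀ m {n u} (ms : Vec Mode n) {ts : Vec Term n} {Bs : Vec Ty n} → Hasᵛ u ts Bs →
              Hasᵛ u (pick m ms ts) (pick m ms Bs)
  Hasᵛ-pick input  []            {[]}     {[]}     h = tt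
  Hasᵛ-pick output []            {[]}     {[]}     h = tt
  Hasᵛ-pick input  (input  ∷ ms) {_ ∷ ts} {_ ∷ Bs} h = proj₁ h , Hasᵛ-pick input ms (proj₂ h)
  Hasᵛ-pick input  (output ∷ ms) {_ ∷ ts} {_ ∷ Bs} h = Hasᵛ-pick input ms (proj₂ h)
  Hasᵛ-pick output (input  ∷ ms) {_ ∷ ts} {_ ∷ Bs} h = Hasᵛ-pick output ms (proj₂ h)
  Hasᵛ-pick output (output ∷ ms) {_ ∷ ts} {_ ∷ Bs} h = proj₁ h , Hasᵛ-pick output ms (proj₂ h)

  -- A term substitution and a type substitution act at once: the instances at the function symbols
  -- of `t` are composed with `a`, and each variable leaf is replaced by the typing of `θ x`.
  Has-subst : ∀ {u u′ θ a} t {B} → Has u t B →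
              (∀ {x} → x ∈ vars t → Has u′ (θ x) (u x ⟪ a ⟫)) → Has u′ (t ⟦ θ ⟧) (B ⟪ a ⟫)
  Hasᵛ-subst : ∀ {n u u′ θ a} (ts : Vec Term n) {Bs} → Hasᵛ u ts Bs →
               (∀ {x} → x ∈ varsᵛ ts → Has u′ (θ x) (u x ⟪ a ⟫)) →
               Hasᵛ u′ (ts ⟦ θ ⟧ᵛ) (Bs ⟪ a ⟫ᵛ)
  Has-subst {θ = θ} {a} (var x) ux≼B hθ = Has-≼ (θ x) (hθ (here refl)) (≼-⟪⟫ ux≼B a)
  Has-subst {a = a} (app f ts) {B} (ρ , ≼B , hs) hθ =
    (λ q → ρ q ⟪ a ⟫) ,
    subst (_≼ B ⟪ a ⟫) (⟪⟫-∘ (FlatTy.ty (funRes f))) (≼-⟪⟫ ≼B a) ,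
    subst (Hasᵛ _ _) (⟪⟫ᵛ-∘ (funArgs f)) (Hasᵛ-subst ts hs hθ)
  Hasᵛ-subst []       {[]}     h        hθ = tt
  Hasᵛ-subst (t ∷ ts) {B ∷ Bs} (h , hs) hθ =
    Has-subst t h (hθ ∘ ∈-++⁺ˡ) , Hasᵛ-subst ts hs (hθ ∘ ∈-++⁺ʳ (vars t))

  Has-⟪⟫ : ∀ {u u′} a t {B} → Has u t B → (∀ {x} → x ∈ vars t → u′ x ≡ u x ⟪ a ⟫) →
           Has u′ t (B ⟪ a ⟫)
  Has-⟪⟫ a t h u′≡ = subst (λ s → Has _ s _) (⟦var⟧ t) (Has-subst t h (≼-reflexive ∘ u′≡))

  -- The default `par 0` is never met at a variable of a typed term, by `⊢⇒typeOf`.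
  typ : VarTyping → Var → Ty
  typ U x = fromMaybe (par 0) (typeOf U x)

  rho : Instantiation → Param → Ty
  rho ϑ = map (Instantiation.Θ ϑ) ∘ Instantiation.rename ϑ

  inst-rho : ∀ ϑ τ → inst ϑ τ ≡ τ ⟪ rho ϑ ⟫
  inst-rho ϑ τ = ⟪⟫-∘ τ

  Vec-map-inst : ∀ {n} ϑ (τs : Vec Ty n) → Vec.map (inst ϑ) τs ≡ τs ⟪ rho ϑ ⟫ᵛ
  Vec-map-inst ϑ τs = map-⟪⟫ τs λ {τ} _ → inst-rho ϑ τ

  below-inst : ∀ {n} ϑ (τs : Vec Ty n) {σ} i → σ ≼ inst ϑ (Vec.lookup τs i) →
               σ ≼ Vec.lookup (τs ⟪ rho ϑ ⟫ᵛ) i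
  below-inst ϑ τs i = subst (_ ≼_) (trans (inst-rho ϑ (Vec.lookup τs i)) (sym (lookup-⟪⟫ τs (rho ϑ) i)))

  ⊢⇒Has : ∀ {U t τ} → U ⊢ t ∶ τ → Has (typ U) t τ
  ⊢⇒Has (var x:τ) = ≼-reflexive (cong (fromMaybe (par 0)) x:τ)
  ⊢⇒Has (func f {ts} σs ϑ ⊢ts ≼τs) =
    rho ϑ , ≼-reflexive (sym (inst-rho ϑ (FlatTy.ty (funRes f)))) ,
    Hasᵛ-tabulate ts _ λ i →
      Has-≼ (Vec.lookup ts i) (⊢⇒Has (⊢ts i)) (below-inst ϑ (funArgs f) i (≼τs i))

  varsᵛ-lookup : ∀ {n} (ts : Vec Term n) {x} → x ∈ varsᵛ ts → ∃[ i ] x ∈ vars (Vec.lookup ts i)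
  varsᵛ-lookup (t ∷ ts) x∈ with ∈-++⁻ (vars t) x∈
  ... | inj₁ x∈t  = zero , x∈t
  ... | inj₂ x∈ts with i , x∈i ← varsᵛ-lookup ts x∈ts = suc i , x∈i

  ⊢⇒typeOf : ∀ {U t τ} → U ⊢ t ∶ τ → ∀ {x} → x ∈ vars t → typeOf U x ≡ just (typ U x)
  ⊢⇒typeOf (var x:τ) (here refl) rewrite x:τ = refl
  ⊢⇒typeOf (func f {ts} σs ϑ ⊢ts ≼τs) x∈ with i , x∈i ← varsᵛ-lookup ts x∈ = ⊢⇒typeOf (⊢ts i) x∈i

  module _ (L : List Param) (ρ : Param → Ty) where
    private
      range : List Param → List Param
      range = List.concatMap (pars ∘ ρ)

      range-∈ : ∀ {L p} → p ∈ L → pars (ρ p) ⊆ range L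
      range-∈             (here refl) = ∈-++⁺ˡ
      range-∈ {L = q ∷ _} (there p∈)  = ∈-++⁺ʳ (pars (ρ q)) ∘ range-∈ p∈

      N : ℕ
      N = strictBound (range L)

    -- Shifting by `N` moves the declared parameters past everything in the range of `ρ` on `L`. The
    -- substitution then never meets its own range, which makes it idempotent.
    instantiate : Instantiation
    instantiate = record
      { rename           = N +_
      ; rename-injective = λ {p} {q} → +-cancelˡ-≡ N p q
      ; Θ                = restrict (List.map (N +_) L) (λ q → ρ (q ∸ N)) apart
      }
      where
      apart : ∀ {u q} → u ∈ List.map (N +_) L → q ∈ pars (ρ (u ∸ N)) →
              q ∈ List.map (N +_) L → ρ (q ∸ N) ≡ par q
      apart {q = q} u∈ q∈ q∈L with ∈-map⁻ (N +_) u∈ | ∈-map⁻ (N +_) q∈L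
      ... | p , p∈ , refl | p′ , _ , refl =
        ⊥-elim (strictBound≤⇒∉ (m≤m+n N p′)
          (range-∈ p∈ (subst (λ z → q ∈ pars (ρ z)) (m+n∸m≡n N p) q∈)))

    inst-instantiate : ∀ {τ} → pars τ ⊆ L → inst instantiate τ ≡ τ ⟪ ρ ⟫
    inst-instantiate {τ} ⊆L = trans (inst-rho instantiate τ) (⟪⟫-cong τ λ {u} u∈ →
      trans (override-∈ (List.map (N +_) L) (λ q → ρ (q ∸ N)) par (∈-map⁺ (N +_) (⊆L u∈)))
            (cong ρ (m+n∸m≡n N u)))

  instantiate-args : ∀ {n} (τs : Vec Ty n) L ρ → parsᵛ τs ⊆ L → ∀ {σ} i →
                     σ ≼ Vec.lookup (τs ⟪ ρ ⟫ᵛ) i → σ ≼ inst (instantiate L ρ) (Vec.lookup τs i)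
  instantiate-args τs L ρ ⊆L i = subst (_ ≼_) (trans (lookup-⟪⟫ τs ρ i)
    (sym (inst-instantiate L ρ {Vec.lookup τs i} (⊆L ∘ pars-lookup τs i))))

  -- By transparency it suffices that the instance at a function symbol is right on the parameters
  -- of the result type.
  Has⇒⊢ : ∀ {U u} t {B} → (∀ {x} → x ∈ vars t → typeOf U x ≡ just (u x)) → Has u t B →
          ∃[ τ ] U ⊢ t ∶ τ × τ ≼ B
  Hasᵛ⇒⊢ : ∀ {n U u} (ts : Vec Term n) {Bs} → (∀ {x} → x ∈ varsᵛ ts → typeOf U x ≡ just (u x)) →
           Hasᵛ u ts Bs → ∃[ σs ] (∀ i → U ⊢ Vec.lookup ts i ∶ Vec.lookup σs i) ×
                                  (∀ i → Vec.lookup σs i ≼ Vec.lookup Bs i)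
  Has⇒⊢ (var x)    U≡u ux≼B = _ , var (U≡u (here refl)) , ux≼B
  Has⇒⊢ (app f ts) {B} U≡u (ρ , ≼B , hs) with Hasᵛ⇒⊢ ts U≡u hs
  ... | σs , ⊢ts , ≼Bs = _ , func f σs ϑ ⊢ts (λ i → instantiate-args (funArgs f) L ρ (transparent f) i (≼Bs i))
                           , subst (_≼ B) (sym (inst-instantiate L ρ {FlatTy.ty (funRes f)} id)) ≼B
    where
    L = pars (FlatTy.ty (funRes f))
    ϑ = instantiate L ρ
  Hasᵛ⇒⊢ []       {[]}     U≡u h = [] , (λ ()) , (λ ())
  Hasᵛ⇒⊢ (t ∷ ts) {B ∷ Bs} U≡u (h , hs)
    with Has⇒⊢ t (U≡u ∘ ∈-++⁺ˡ) h | Hasᵛ⇒⊢ ts (U≡u ∘ ∈-++⁺ʳ (vars t)) hs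
  ... | σ , ⊢t , σ≼ | σs , ⊢ts , σs≼ =
    σ ∷ σs , (λ { zero → ⊢t ; (suc i) → ⊢ts i }) , (λ { zero → σ≼ ; (suc i) → σs≼ i })

-- Solutions of type inequality systems.

module Systems (𝒮 : Signature) where
  open Signature 𝒮
  open TypeConstructors typeConstructors
  open Language 𝒮
  open TypeProperties typeConstructors
  open Typing 𝒮

  flat : Fun → Ty
  flat f = FlatTy.ty (funRes f)

  Sat : (Param → Ty) → Ty × Ty → Set
  Sat γ (τ , τ′) = τ ⟪ γ ⟫ ≼ τ′ ⟪ γ ⟫

  module Solutions (ν : Naming) where
    open Naming ν

    at-injective : ∀ {ξ ξ′ p p′} → name (at ξ p) ≡ name (at ξ′ p′) → ξ ≡ ξ′ × p ≡ p′
    at-injective e with refl ← name-injective e = refl , refl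

    of-injective : ∀ {x y} → name (of x) ≡ name (of y) → x ≡ y
    of-injective e with refl ← name-injective e = refl

    at≢of : ∀ {ξ p x} → name (at ξ p) ≢ name (of x)
    at≢of e with () ← name-injective e

    -- γ solves the system of t at ξ whose bound has become B under γ.
    Sol  : (Param → Ty) → Pos → Term → Ty → Set
    Solᵛ : ∀ {n} → (Param → Ty) → Pos → ℕ → Vec Term n → Vec Ty n → Set
    Sol γ ξ (var x)    B = γ (name (of x)) ≼ B
    Sol γ ξ (app f ts) B = flat f ⟪ γ ∘ name ∘ at ξ ⟫ ≼ B ×
                           Solᵛ γ ξ 0 ts (funArgs f ⟪ γ ∘ name ∘ at ξ ⟫ᵛ)
    Solᵛ γ ξ j []       []       = ⊤
    Solᵛ γ ξ j (t ∷ ts) (B ∷ Bs) = Sol γ (ξ ++ [ j ]) t B × Solᵛ γ ξ (suc j) ts Bs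

    Sol⇒Sat : ∀ {γ} ξ t σ → Sol γ ξ t (σ ⟪ γ ⟫) → All (Sat γ) (ineqs ν ξ t σ)
    Solᵛ⇒Sat : ∀ {n γ} ξ j (ts : Vec Term n) σs → Solᵛ γ ξ j ts (σs ⟪ γ ⟫ᵛ) →
               All (Sat γ) (ineqsᵛ ν ξ j ts σs)
    Sol⇒Sat ξ (var x)    σ s        = s ∷ []
    Sol⇒Sat {γ} ξ (app f ts) σ (s , ss) =
      subst (_≼ σ ⟪ γ ⟫) (sym (⟪⟫-∘ (flat f))) s ∷
      Solᵛ⇒Sat ξ 0 ts _ (subst (Solᵛ _ ξ 0 ts) (sym (⟪⟫ᵛ-∘ (funArgs f))) ss)
    Solᵛ⇒Sat ξ j []       []       s        = []
    Solᵛ⇒Sat ξ j (t ∷ ts) (σ ∷ σs) (s , ss) =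
      ++⁺ (Sol⇒Sat (ξ ++ [ j ]) t σ s) (Solᵛ⇒Sat ξ (suc j) ts σs ss)

    Sat⇒Sol : ∀ {γ} ξ t σ → All (Sat γ) (ineqs ν ξ t σ) → Sol γ ξ t (σ ⟪ γ ⟫)
    Sat⇒Solᵛ : ∀ {n γ} ξ j (ts : Vec Term n) σs → All (Sat γ) (ineqsᵛ ν ξ j ts σs) →
               Solᵛ γ ξ j ts (σs ⟪ γ ⟫ᵛ)
    Sat⇒Sol ξ (var x)    σ (s ∷ [])   = s
    Sat⇒Sol {γ} ξ (app f ts) σ (s ∷ ss) =
      subst (_≼ σ ⟪ γ ⟫) (⟪⟫-∘ (flat f)) s ,
      subst (Solᵛ _ ξ 0 ts) (⟪⟫ᵛ-∘ (funArgs f)) (Sat⇒Solᵛ ξ 0 ts _ ss)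
    Sat⇒Solᵛ ξ j []       []       s = tt
    Sat⇒Solᵛ ξ j (t ∷ ts) (σ ∷ σs) s =
      Sat⇒Sol (ξ ++ [ j ]) t σ (++⁻ˡ (ineqs ν (ξ ++ [ j ]) t σ) s) ,
      Sat⇒Solᵛ ξ (suc j) ts σs (++⁻ʳ (ineqs ν (ξ ++ [ j ]) t σ) s)

    name-flat : ∀ f ξ {p} → p ∈ pars (flat f) → name (at ξ p) ∈ pars (flat f atPos ξ)
    name-flat f ξ p∈ = pars-⟪⟫⁺ (flat f) p∈ (here refl)

    name-flat⁻ : ∀ f ξ {q} → q ∈ pars (flat f atPos ξ) →
                 ∃[ p ] p ∈ pars (flat f) × q ≡ name (at ξ p)
    name-flat⁻ f ξ q∈ with pars-⟪⟫⁻ (flat f) q∈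
    ... | p , p∈ , here refl = p , p∈ , refl

    -- The bound `B` is already evaluated, so `γ` is consulted only at introduced parameters;
    -- transparency covers those of the argument types.
    Sol-cong : ∀ {γ γ′} ξ t {B} → (∀ {p} → p ∈ new ν ξ t → γ p ≡ γ′ p) → Sol γ ξ t B → Sol γ′ ξ t B
    Solᵛ-cong : ∀ {n γ γ′} ξ j (ts : Vec Term n) {Bs} →
                (∀ {p} → p ∈ newᵛ ν ξ j ts → γ p ≡ γ′ p) → Solᵛ γ ξ j ts Bs → Solᵛ γ′ ξ j ts Bs
    Sol-cong ξ (var x)    γ≡ s = subst (_≼ _) (γ≡ (here refl)) s
    Sol-cong {γ} {γ′} ξ (app f ts) {B} γ≡ (s , ss) =
      subst (_≼ B) (⟪⟫-cong (flat f) on-flat) s ,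
      subst (Solᵛ _ ξ 0 ts) (⟪⟫ᵛ-cong (funArgs f) (on-flat ∘ transparent f))
        (Solᵛ-cong ξ 0 ts (γ≡ ∘ ∈-++⁺ʳ (pars (flat f atPos ξ))) ss)
      where
      on-flat : ∀ {p} → p ∈ pars (flat f) → γ (name (at ξ p)) ≡ γ′ (name (at ξ p))
      on-flat p∈ = γ≡ (∈-++⁺ˡ (name-flat f ξ p∈))
    Solᵛ-cong ξ j []       {[]}     γ≡ s        = tt
    Solᵛ-cong ξ j (t ∷ ts) {B ∷ Bs} γ≡ (s , ss) =
      Sol-cong (ξ ++ [ j ]) t (γ≡ ∘ ∈-++⁺ˡ) s ,
      Solᵛ-cong ξ (suc j) ts (γ≡ ∘ ∈-++⁺ʳ (new ν (ξ ++ [ j ]) t)) ss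

    -- Names reveal the position or the variable they belong to, which is how the parameters of
    -- different subterms and systems are told apart.
    new-form : ∀ ξ t {p} → p ∈ new ν ξ t →
               (∃[ ζ ] ∃[ q ] p ≡ name (at (ξ ++ ζ) q)) ⊎ (∃[ x ] x ∈ vars t × p ≡ name (of x))
    newᵛ-form : ∀ {n} ξ j (ts : Vec Term n) {p} → p ∈ newᵛ ν ξ j ts →
                (∃[ m ] ∃[ ζ ] ∃[ q ] j ≤ m × p ≡ name (at (ξ ++ m ∷ ζ) q)) ⊎
                (∃[ x ] x ∈ varsᵛ ts × p ≡ name (of x))
    new-form ξ (var x)    (here refl) = inj₂ (x , here refl , refl)
    new-form ξ (app f ts) p∈ with ∈-++⁻ (pars (flat f atPos ξ)) p∈
    ... | inj₁ p∈f with q , _ , e ← name-flat⁻ f ξ p∈f =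
      inj₁ ([] , q , trans e (cong (λ ζ → name (at ζ q)) (sym (++-identityʳ ξ))))
    ... | inj₂ p∈ts with newᵛ-form ξ 0 ts p∈ts
    ...   | inj₁ (m , ζ , q , _ , e) = inj₁ (m ∷ ζ , q , e)
    ...   | inj₂ x = inj₂ x
    newᵛ-form ξ j (t ∷ ts) p∈ with ∈-++⁻ (new ν (ξ ++ [ j ]) t) p∈
    ... | inj₁ p∈t with new-form (ξ ++ [ j ]) t p∈t
    ...   | inj₁ (ζ , q , e) =
      inj₁ (j , ζ , q , ≤-refl , trans e (cong (λ ζ → name (at ζ q)) (++-assoc ξ [ j ] ζ)))
    ...   | inj₂ (x , x∈ , e) = inj₂ (x , ∈-++⁺ˡ x∈ , e)
    newᵛ-form ξ j (t ∷ ts) p∈ | inj₂ p∈ts with newᵛ-form ξ (suc j) ts p∈ts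
    ...   | inj₁ (m , ζ , q , j<m , e) = inj₁ (m , ζ , q , <⇒≤ j<m , e)
    ...   | inj₂ (x , x∈ , e) = inj₂ (x , ∈-++⁺ʳ (vars t) x∈ , e)

    flat-apart : ∀ {n} f ξ j (ts : Vec Term n) → Disjoint (pars (flat f atPos ξ)) (newᵛ ν ξ j ts)
    flat-apart f ξ j ts (p∈f , p∈ts) with name-flat⁻ f ξ p∈f | newᵛ-form ξ j ts p∈ts
    ... | q , _ , refl | inj₁ (m , ζ , _ , _ , e)
      with () ← ++-cancelˡ ξ [] (m ∷ ζ) (trans (++-identityʳ ξ) (proj₁ (at-injective e)))
    ... | q , _ , refl | inj₂ (x , _ , e) = at≢of e

    -- Positions in different arguments differ right after `ξ`. What could still be shared are the
    -- parameters of common variables, which linearity excludes.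
    new-apart : ∀ {n} ξ j t (ts : Vec Term n) → Disjoint (vars t) (varsᵛ ts) →
                Disjoint (new ν (ξ ++ [ j ]) t) (newᵛ ν ξ (suc j) ts)
    new-apart ξ j t ts dis (p∈t , p∈ts) with new-form (ξ ++ [ j ]) t p∈t | newᵛ-form ξ (suc j) ts p∈ts
    ... | inj₁ (ζ , _ , refl) | inj₁ (m , ζ′ , _ , j<m , e) =
      <-irrefl (∷-injectiveˡ (++-cancelˡ ξ (j ∷ ζ) (m ∷ ζ′)
        (trans (sym (++-assoc ξ [ j ] ζ)) (proj₁ (at-injective e))))) j<m
    ... | inj₁ (ζ , _ , refl) | inj₂ (x , _ , e) = at≢of e
    ... | inj₂ (x , _ , refl) | inj₁ (m , ζ , _ , _ , e) = at≢of (sym e)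
    ... | inj₂ (x , x∈ , refl) | inj₂ (y , y∈ , e) with refl ← of-injective e = dis (x∈ , y∈)

    -- Solutions for a linear term are assembled from independent solutions for its subterms. `Good`
    -- is an invariant kept at each parameter: in one use it records the types of substituted
    -- variables, in the other the comparison with a given solution.
    module Glue (Good : Param → Ty → Set) where

      Solution : Pos → Term → Ty → Set
      Solution ξ t B = ∃[ γ ] Sol γ ξ t B × (∀ {p} → p ∈ new ν ξ t → Good p (γ p))

      Solutionᵛ : ∀ {n} → Pos → ℕ → Vec Term n → Vec Ty n → Set
      Solutionᵛ ξ j ts Bs = ∃[ γ ] Solᵛ γ ξ j ts Bs × (∀ {p} → p ∈ newᵛ ν ξ j ts → Good p (γ p))

      solution-[] : ∀ ξ j → Solutionᵛ ξ j [] []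
      solution-[] ξ j = par , tt , λ ()

      solution-∷ : ∀ {n} ξ j t (ts : Vec Term n) {B Bs} → Disjoint (vars t) (varsᵛ ts) →
                   Solution (ξ ++ [ j ]) t B → Solutionᵛ ξ (suc j) ts Bs →
                   Solutionᵛ ξ j (t ∷ ts) (B ∷ Bs)
      solution-∷ ξ j t ts dis (γ₁ , s₁ , good₁) (γ₂ , s₂ , good₂) =
        γ , (Sol-cong (ξ ++ [ j ]) t (sym ∘ on-t) s₁ , Solᵛ-cong ξ (suc j) ts (sym ∘ on-ts) s₂) , good
        where
        L = new ν (ξ ++ [ j ]) t
        γ = override L γ₁ γ₂
        on-t : ∀ {p} → p ∈ L → γ p ≡ γ₁ p
        on-t = override-∈ L γ₁ γ₂
        on-ts : ∀ {p} → p ∈ newᵛ ν ξ (suc j) ts → γ p ≡ γ₂ p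
        on-ts p∈ = override-∉ L γ₁ γ₂ λ p∈L → new-apart ξ j t ts dis (p∈L , p∈)
        good : ∀ {p} → p ∈ newᵛ ν ξ j (t ∷ ts) → Good p (γ p)
        good p∈ with ∈-++⁻ L p∈
        ... | inj₁ p∈t  = subst (Good _) (sym (on-t p∈t)) (good₁ p∈t)
        ... | inj₂ p∈ts = subst (Good _) (sym (on-ts p∈ts)) (good₂ p∈ts)

      solution-var : ∀ ξ x {B} → Good (name (of x)) B → Solution ξ (var x) B
      solution-var ξ x {B} g = (λ _ → B) , ≼-refl , λ { (here refl) → g }

      solution-app : ∀ f {ts} ξ {B} (g : Param → Ty) → flat f ⟪ g ⟫ ≼ B →
                     (∀ {p} → p ∈ pars (flat f) → Good (name (at ξ p)) (g p)) →
                     Solutionᵛ ξ 0 ts (funArgs f ⟪ g ⟫ᵛ) → Solution ξ (app f ts) B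
      solution-app f {ts} ξ {B} g ≼B good-g (γ₁ , s₁ , good₁) =
        γ , (subst (_≼ B) (⟪⟫-cong (flat f) (sym ∘ on-flat)) ≼B ,
             subst (Solᵛ γ ξ 0 ts) (⟪⟫ᵛ-cong (funArgs f) (sym ∘ on-flat ∘ transparent f))
               (Solᵛ-cong ξ 0 ts (sym ∘ on-ts) s₁)) , good
        where
        L = pars (flat f atPos ξ)
        -- `find` inverts the naming on the parameters of the result type, which carries `g` over to
        -- their copies at `ξ`; the default is not reached on `L`.
        γ₀ : Param → Ty
        γ₀ p = maybe g (par p) (find (name ∘ at ξ) (pars (flat f)) p)
        γ = override L γ₀ γ₁
        on-flat : ∀ {p} → p ∈ pars (flat f) → γ (name (at ξ p)) ≡ g p
        on-flat {p} p∈ = trans (override-∈ L γ₀ γ₁ (name-flat f ξ p∈))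
          (cong (maybe g (par (name (at ξ p))))
            (find-complete (name ∘ at ξ) p∈ λ _ → proj₂ ∘ at-injective))
        on-ts : ∀ {p} → p ∈ newᵛ ν ξ 0 ts → γ p ≡ γ₁ p
        on-ts p∈ = override-∉ L γ₀ γ₁ λ p∈L → flat-apart f ξ 0 ts (p∈L , p∈)
        good : ∀ {p} → p ∈ new ν ξ (app f ts) → Good p (γ p)
        good p∈ with ∈-++⁻ L p∈
        ... | inj₂ p∈ts = subst (Good _) (sym (on-ts p∈ts)) (good₁ p∈ts)
        ... | inj₁ p∈f with q , q∈ , refl ← name-flat⁻ f ξ p∈f =
          subst (Good _) (sym (on-flat q∈)) (good-g q∈)

    module _ {u : Var → Ty} {θ : Var → Term} where
      open Glue (λ p τ → ∀ {x} → p ≡ name (of x) → Has u (θ x) τ)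

      -- The derivation for `t ⟦ θ ⟧` is followed along `t` only. The instance at each function
      -- symbol of `t` solves the inequality there, and the bound reached at a variable `x` becomes
      -- the value of its parameter, hence bounds the type of `θ x`.
      match-solution : ∀ ξ t {B} → Unique (vars t) → Has u (t ⟦ θ ⟧) B → Solution ξ t B
      match-solutionᵛ : ∀ {n} ξ j (ts : Vec Term n) {Bs} → Unique (varsᵛ ts) →
                        Hasᵛ u (ts ⟦ θ ⟧ᵛ) Bs → Solutionᵛ ξ j ts Bs
      match-solution ξ (var x)    lin h = solution-var ξ x λ e →
        subst (λ y → Has u (θ y) _) (of-injective e) h
      match-solution ξ (app f ts) lin (ρ , ≼B , hs) =
        solution-app f ξ ρ ≼B (λ _ e → ⊥-elim (at≢of e)) (match-solutionᵛ ξ 0 ts lin hs)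
      match-solutionᵛ ξ j []       {[]}     lin h = solution-[] ξ j
      match-solutionᵛ ξ j (t ∷ ts) {B ∷ Bs} lin (h , hs) =
        solution-∷ ξ j t ts (unique-++-disjoint (vars t) lin)
          (match-solution (ξ ++ [ j ]) t (unique-++ˡ lin) h)
          (match-solutionᵛ ξ (suc j) ts (unique-++ʳ (vars t) lin) hs)

    parsˢ-++ : ∀ S S′ → parsˢ ν (S ++ S′) ≡ parsˢ ν S ++ parsˢ ν S′
    parsˢ-++ = concatMap-++ (λ (τ , τ′) → pars τ ++ pars τ′)

    -- Inner bounds are argument types, whose parameters occur in the result type at the same
    -- position by transparency. Only the outer bound contributes further ones.
    parsˢ-ineqs⁻ : ∀ ξ t σ {p} → p ∈ parsˢ ν (ineqs ν ξ t σ) → p ∈ new ν ξ t ⊎ p ∈ pars σ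
    parsˢ-ineqsᵛ⁻ : ∀ {n} ξ j (ts : Vec Term n) σs {p} → p ∈ parsˢ ν (ineqsᵛ ν ξ j ts σs) →
                    p ∈ newᵛ ν ξ j ts ⊎ p ∈ parsᵛ σs
    parsˢ-ineqs⁻ ξ (var x) σ (here refl) = inj₁ (here refl)
    parsˢ-ineqs⁻ ξ (var x) σ (there p∈) with ∈-++⁻ (pars σ) p∈
    ... | inj₁ p∈σ = inj₂ p∈σ
    parsˢ-ineqs⁻ ξ (app f ts) σ p∈ with ∈-++⁻ (pars (flat f atPos ξ) ++ pars σ) p∈
    ... | inj₁ p∈₁ with ∈-++⁻ (pars (flat f atPos ξ)) p∈₁
    ...   | inj₁ p∈f = inj₁ (∈-++⁺ˡ p∈f)
    ...   | inj₂ p∈σ = inj₂ p∈σ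
    parsˢ-ineqs⁻ ξ (app f ts) σ p∈ | inj₂ p∈₂ with parsˢ-ineqsᵛ⁻ ξ 0 ts (funArgs f atPosᵛ ξ) p∈₂
    ...   | inj₁ p∈ts = inj₁ (∈-++⁺ʳ (pars (flat f atPos ξ)) p∈ts)
    ...   | inj₂ p∈args with parsᵛ-⟪⟫⁻ (funArgs f) p∈args
    ...     | q , q∈ , here refl = inj₁ (∈-++⁺ˡ (name-flat f ξ (transparent f q∈)))
    parsˢ-ineqsᵛ⁻ ξ j []       []       ()
    parsˢ-ineqsᵛ⁻ ξ j (t ∷ ts) (σ ∷ σs) {p} p∈
      with ∈-++⁻ (parsˢ ν (ineqs ν (ξ ++ [ j ]) t σ))
             (subst (p ∈_) (parsˢ-++ (ineqs ν (ξ ++ [ j ]) t σ) _) p∈)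
    ... | inj₁ p∈₁ with parsˢ-ineqs⁻ (ξ ++ [ j ]) t σ p∈₁
    ...   | inj₁ p∈t = inj₁ (∈-++⁺ˡ p∈t)
    ...   | inj₂ p∈σ = inj₂ (∈-++⁺ˡ p∈σ)
    parsˢ-ineqsᵛ⁻ ξ j (t ∷ ts) (σ ∷ σs) {p} p∈ | inj₂ p∈₂ with parsˢ-ineqsᵛ⁻ ξ (suc j) ts σs p∈₂
    ...   | inj₁ p∈ts = inj₁ (∈-++⁺ʳ (new ν (ξ ++ [ j ]) t) p∈ts)
    ...   | inj₂ p∈σs = inj₂ (∈-++⁺ʳ (pars σ) p∈σs)

    bound⊆parsˢ : ∀ ξ t σ → pars σ ⊆ parsˢ ν (ineqs ν ξ t σ)
    bound⊆parsˢ ξ (var x)    σ p∈ = there (∈-++⁺ˡ p∈)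
    bound⊆parsˢ ξ (app f ts) σ p∈ = ∈-++⁺ˡ (∈-++⁺ʳ (pars (flat f atPos ξ)) p∈)

    module _ {n : ℕ} (ξ : Pos) (j : ℕ) (t : Term) (ts : Vec Term n) (σ : Ty) (σs : Vec Ty n)
             {p : Param} where
      private
        S  = ineqs ν (ξ ++ [ j ]) t σ
        Ss = ineqsᵛ ν ξ (suc j) ts σs

      parsˢ-∷ˡ : p ∈ parsˢ ν S → p ∈ parsˢ ν (ineqsᵛ ν ξ j (t ∷ ts) (σ ∷ σs))
      parsˢ-∷ˡ p∈ = subst (p ∈_) (sym (parsˢ-++ S Ss)) (∈-++⁺ˡ p∈)

      parsˢ-∷ʳ : p ∈ parsˢ ν Ss → p ∈ parsˢ ν (ineqsᵛ ν ξ j (t ∷ ts) (σ ∷ σs))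
      parsˢ-∷ʳ p∈ = subst (p ∈_) (sym (parsˢ-++ S Ss)) (∈-++⁺ʳ (parsˢ ν S) p∈)

    bound⊆parsˢᵛ : ∀ {n} ξ j (ts : Vec Term n) σs → parsᵛ σs ⊆ parsˢ ν (ineqsᵛ ν ξ j ts σs)
    bound⊆parsˢᵛ ξ j (t ∷ ts) (σ ∷ σs) p∈ with ∈-++⁻ (pars σ) p∈
    ... | inj₁ p∈σ  = parsˢ-∷ˡ ξ j t ts σ σs (bound⊆parsˢ (ξ ++ [ j ]) t σ p∈σ)
    ... | inj₂ p∈σs = parsˢ-∷ʳ ξ j t ts σ σs (bound⊆parsˢᵛ ξ (suc j) ts σs p∈σs)

    new⊆parsˢ : ∀ ξ t σ → new ν ξ t ⊆ parsˢ ν (ineqs ν ξ t σ)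
    newᵛ⊆parsˢ : ∀ {n} ξ j (ts : Vec Term n) σs → newᵛ ν ξ j ts ⊆ parsˢ ν (ineqsᵛ ν ξ j ts σs)
    new⊆parsˢ ξ (var x)    σ (here refl) = here refl
    new⊆parsˢ ξ (app f ts) σ p∈ with ∈-++⁻ (pars (flat f atPos ξ)) p∈
    ... | inj₁ p∈f  = ∈-++⁺ˡ (∈-++⁺ˡ p∈f)
    ... | inj₂ p∈ts = ∈-++⁺ʳ (pars (flat f atPos ξ) ++ pars σ) (newᵛ⊆parsˢ ξ 0 ts _ p∈ts)
    newᵛ⊆parsˢ ξ j (t ∷ ts) (σ ∷ σs) p∈ with ∈-++⁻ (new ν (ξ ++ [ j ]) t) p∈
    ... | inj₁ p∈t  = parsˢ-∷ˡ ξ j t ts σ σs (new⊆parsˢ (ξ ++ [ j ]) t σ p∈t)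
    ... | inj₂ p∈ts = parsˢ-∷ʳ ξ j t ts σ σs (newᵛ⊆parsˢ ξ (suc j) ts σs p∈ts)

    of∈new : ∀ ξ t {x} → x ∈ vars t → name (of x) ∈ new ν ξ t
    of∈newᵛ : ∀ {n} ξ j (ts : Vec Term n) {x} → x ∈ varsᵛ ts → name (of x) ∈ newᵛ ν ξ j ts
    of∈new ξ (var x)    (here refl) = here refl
    of∈new ξ (app f ts) x∈          = ∈-++⁺ʳ (pars (flat f atPos ξ)) (of∈newᵛ ξ 0 ts x∈)
    of∈newᵛ ξ j (t ∷ ts) x∈ with ∈-++⁻ (vars t) x∈
    ... | inj₁ x∈t  = ∈-++⁺ˡ (of∈new (ξ ++ [ j ]) t x∈t)
    ... | inj₂ x∈ts = ∈-++⁺ʳ (new ν (ξ ++ [ j ]) t) (of∈newᵛ ξ (suc j) ts x∈ts)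

    -- Principality speaks of both sides of every inequality. With `above-pars` it becomes a
    -- comparison of values at single parameters, which is easier to carry along a renaming.
    below-pars : ∀ S {a b} →
                 All (λ (τ , τ′) → (τ ⟪ a ⟫ ≼ τ ⟪ b ⟫) × (τ′ ⟪ a ⟫ ≼ τ′ ⟪ b ⟫)) S →
                 ∀ {p} → p ∈ parsˢ ν S → a p ≼ b p
    below-pars ((τ , τ′) ∷ S) ((h , h′) ∷ hs) p∈ with ∈-++⁻ (pars τ ++ pars τ′) p∈
    ... | inj₂ p∈S = below-pars S hs p∈S
    ... | inj₁ p∈₁ with ∈-++⁻ (pars τ) p∈₁
    ...   | inj₁ p∈τ  = ≼-mono⁻ τ h p∈τ
    ...   | inj₂ p∈τ′ = ≼-mono⁻ τ′ h′ p∈τ′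

    above-pars : ∀ S {a b} → (∀ {p} → p ∈ parsˢ ν S → a p ≼ b p) →
                 All (λ (τ , τ′) → (τ ⟪ a ⟫ ≼ τ ⟪ b ⟫) × (τ′ ⟪ a ⟫ ≼ τ′ ⟪ b ⟫)) S
    above-pars []             h = []
    above-pars ((τ , τ′) ∷ S) h =
      (≼-mono τ (h ∘ ∈-++⁺ˡ ∘ ∈-++⁺ˡ) , ≼-mono τ′ (h ∘ ∈-++⁺ˡ ∘ ∈-++⁺ʳ (pars τ))) ∷
      above-pars S (h ∘ ∈-++⁺ʳ (pars τ ++ pars τ′))

-- Principal solutions when the bounds are instantiated.

module Principality (𝒮 : Signature) where
  open Signature 𝒮
  open TypeConstructors typeConstructors
  open Language 𝒮
  open TypeProperties typeConstructors
  open Typing 𝒮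
  open Systems 𝒮
  open IsDecPartialOrder ⊑-isDecPartialOrder using () renaming (refl to ⊑-refl; trans to ⊑-trans)

  con⋠par : ∀ {K τs u} → ¬ (con K τs ≼ par u)
  con⋠par ()

  module Loose (N : ℕ) where
    infix 4 _⊴_

    -- Parameters from N on are copies, and a type with no other parameters is
    -- above everything: only the rigid part of a bound matters.
    data _⊴_ : Ty → Ty → Set where
      free : ∀ {σ τ} → (∀ {q} → q ∈ pars τ → N ≤ q) → σ ⊴ τ
      par  : ∀ u → par u ⊴ par u
      con  : ∀ {K K′ σs τs} (p : K ⊑ K′) →
             (∀ i → Vec.lookup σs (ι p i) ⊴ Vec.lookup τs i) → con K σs ⊴ con K′ τs

    ⊴-mono : ∀ τ {a b} → (∀ {p} → p ∈ pars τ → a p ⊴ b p) → τ ⟪ a ⟫ ⊴ τ ⟪ b ⟫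
    ⊴-monoᵛ : ∀ {n} (τs : Vec Ty n) {a b} → (∀ {p} → p ∈ parsᵛ τs → a p ⊴ b p) →
              ∀ i → Vec.lookup (τs ⟪ a ⟫ᵛ) i ⊴ Vec.lookup (τs ⟪ b ⟫ᵛ) i
    ⊴-mono (par u)            a⊴b = a⊴b (here refl)
    ⊴-mono (con K τs) {a} {b} a⊴b =
      con ⊑-refl λ i → subst (λ j → Vec.lookup (τs ⟪ a ⟫ᵛ) j ⊴ Vec.lookup (τs ⟪ b ⟫ᵛ) i)
        (sym (ι-id ⊑-refl i)) (⊴-monoᵛ τs a⊴b i)
    ⊴-monoᵛ (τ ∷ τs) a⊴b zero    = ⊴-mono τ (a⊴b ∘ ∈-++⁺ˡ)
    ⊴-monoᵛ (τ ∷ τs) a⊴b (suc i) = ⊴-monoᵛ τs (a⊴b ∘ ∈-++⁺ʳ (pars τ)) i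

    ≼-⊴-trans : ∀ {ρ σ τ} → ρ ≼ σ → σ ⊴ τ → ρ ⊴ τ
    ≼-⊴-trans ρ≼σ                 (free f)  = free f
    ≼-⊴-trans (par u)             (par .u)  = par u
    ≼-⊴-trans (con {τs = τs} p h) (con {τs = τs″} q g) =
      con (⊑-trans p q) λ i → subst (λ j → Vec.lookup τs j ⊴ Vec.lookup τs″ i)
        (sym (ι-∘ p q (⊑-trans p q) i)) (≼-⊴-trans (h (ι q i)) (g i))

  -- `Θ` is a solution that fixes the bounds, `β` one that may move them, and `R` holds the
  -- parameters of the bounds. `N` is going to exceed all introduced and rigid parameters, so that
  -- copies cannot be confused with them.
  module Lift (ν : Naming) (Θ β : Param → Ty) (R : List Param) (N : ℕ) where
    open Naming ν
    open Solutions ν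
    open Loose N

    copy : Ty → Ty
    copy τ = τ ⟪ (λ p → par (N + p)) ⟫

    -- Reads a lifted type in terms of `β`: rigid parameters become their instances, copies the
    -- parameters they stand for.
    back : Param → Ty
    back p with p <? N
    ... | yes _ = β p
    ... | no  _ = par (p ∸ N)

    back-< : ∀ {p} → p < N → back p ≡ β p
    back-< {p} p<N with p <? N
    ... | yes _   = refl
    ... | no  p≮N = ⊥-elim (p≮N p<N)

    back-≥ : ∀ {p} → N ≤ p → back p ≡ par (p ∸ N)
    back-≥ {p} N≤p with p <? N
    ... | yes p<N = ⊥-elim (<-irrefl refl (<-≤-trans p<N N≤p))
    ... | no  _   = refl

    copy-back : ∀ τ → copy τ ⟪ back ⟫ ≡ τ
    copy-back τ = trans (⟪⟫-∘ τ) (⟪⟫-id τ λ {p} _ →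
      trans (back-≥ (m≤m+n N p)) (cong par (m+n∸m≡n N p)))

    copy-free : ∀ τ {q} → q ∈ pars (copy τ) → N ≤ q
    copy-free τ q∈ with pars-⟪⟫⁻ τ q∈
    ... | p , _ , here refl = m≤m+n N p

    Allowed : Ty → Set
    Allowed τ = ∀ {q} → q ∈ pars τ → q ∈ R ⊎ N ≤ q

    open Glue (λ p τ → β p ≼ τ ⟪ back ⟫ × Allowed τ)

    module Node (f : Fun) (ξ : Pos) {K′ : Con} (B̂s : Vec Ty (arity K′))
                (p : FlatTy.top (funRes f) ⊑ K′) where
      open FlatTy (funRes f)

      image? : (q : Param) → Dec (∃[ i ] Vec.lookup params (ι p i) ≡ q)
      image? q = any? λ i → Vec.lookup params (ι p i) ≟ q

      -- Parameters of the result type that the bound constrains get the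
      -- component of the bound, the others a copy of their value under β.
      g : Param → Ty
      g q with image? q
      ... | yes (i , _) = Vec.lookup B̂s i
      ... | no  _       = copy (β (name (at ξ q)))

      -- No parameter is constrained twice, because `ι p` is injective and the parameters of a flat
      -- type are distinct.
      g-image : ∀ i → g (Vec.lookup params (ι p i)) ≡ Vec.lookup B̂s i
      g-image i with image? (Vec.lookup params (ι p i))
      ... | yes (j , e) = cong (Vec.lookup B̂s) (ι-injective p (lookup-injective distinct _ _ e))
      ... | no  ¬image  = ⊥-elim (¬image (i , refl))

      g-elim : (P : Param → Ty → Set) →
               (∀ i → P (Vec.lookup params (ι p i)) (Vec.lookup B̂s i)) →
               (∀ q → P q (copy (β (name (at ξ q))))) → ∀ q → P q (g q)
      g-elim P image copied q with image? q
      ... | yes (i , refl) = image i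
      ... | no  _          = copied q

      flat-g : flat f ⟪ g ⟫ ≼ con K′ B̂s
      flat-g = con p λ i → ≼-reflexive (trans (lookup-map-par params g (ι p i)) (g-image i))

    -- The comparison of `B̃` with `B̂ ⟪ back ⟫` keeps `β` recoverable, but it does not stop a
    -- function symbol from meeting a bound that is a rigid parameter, since `β` may replace that
    -- parameter by a constructed type. `Θ` excludes this case: it solves the same system without
    -- moving rigid parameters, and `⊴` carries this information down the term.
    lift : ∀ ξ t {BΘ B̃ B̂} → Unique (vars t) → Sol Θ ξ t BΘ → Sol β ξ t B̃ →
           BΘ ⊴ B̂ → B̃ ≼ B̂ ⟪ back ⟫ → Allowed B̂ → Solution ξ t B̂
    liftᵛ : ∀ {n} ξ j (ts : Vec Term n) {BΘs B̃s B̂s} → Unique (varsᵛ ts) →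
            Solᵛ Θ ξ j ts BΘs → Solᵛ β ξ j ts B̃s →
            (∀ i → Vec.lookup BΘs i ⊴ Vec.lookup B̂s i) →
            (∀ i → Vec.lookup B̃s i ≼ Vec.lookup (B̂s ⟪ back ⟫ᵛ) i) →
            (∀ {q} → q ∈ parsᵛ B̂s → q ∈ R ⊎ N ≤ q) → Solutionᵛ ξ j ts B̂s
    lift ξ (var x) lin s s̃ ⊴B̂ ≼B̂ ok = solution-var ξ x (≼-trans s̃ ≼B̂ , ok)
    -- A copy as bound is read back as a parameter, and no constructed type lies below a parameter.
    lift ξ (app f ts) {B̂ = par u} lin (s , _) (s̃ , _) (free N≤) ≼B̂ ok =
      ⊥-elim (con⋠par (≼-trans s̃ (subst (_ ≼_) (back-≥ (N≤ (here refl))) ≼B̂)))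
    lift ξ (app f ts) {B̂ = par u} lin (s , _) (s̃ , _) (par .u) ≼B̂ ok = ⊥-elim (con⋠par s)
    lift ξ (app f ts) {B̂ = con K′ B̂s} lin (s , ss) (s̃ , s̃s) ⊴B̂ ≼B̂ ok with ≼-trans s̃ ≼B̂
    -- The relation `p` between the constructors comes from `β`; reading back leaves the constructor
    -- of `B̂` unchanged.
    ... | con p h = solution-app f ξ g flat-g good
                      (liftᵛ ξ 0 ts lin ss s̃s
                        (⊴-monoᵛ (funArgs f) λ q∈ → Θ⊴g (transparent f q∈))
                        (λ i → subst (λ τs → _ ≼ Vec.lookup τs i) (sym (⟪⟫ᵛ-∘ (funArgs f)))
                          (≼-monoᵛ (funArgs f) (λ q∈ → proj₁ (good (transparent f q∈))) i))
                        (λ q∈ → let q′ , q′∈ , q∈g = parsᵛ-⟪⟫⁻ (funArgs f) q∈ in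
                          proj₂ (good (transparent f q′∈)) q∈g))
      where
      open Node f ξ B̂s p
      open FlatTy (funRes f)
      nm = name ∘ at ξ
      good : ∀ {q} → q ∈ pars (flat f) → β (nm q) ≼ g q ⟪ back ⟫ × Allowed (g q)
      good {q} _ = g-elim (λ q τ → β (nm q) ≼ τ ⟪ back ⟫ × Allowed τ)
        (λ i → subst₂ _≼_ (lookup-map-par params (β ∘ nm) (ι p i)) (lookup-⟪⟫ B̂s back i) (h i) ,
               (ok ∘ pars-lookup B̂s i))
        (λ q → ≼-reflexive (sym (copy-back (β (nm q)))) , (inj₂ ∘ copy-free (β (nm q))))
        q
      Θ⊴g : ∀ {q} → q ∈ pars (flat f) → Θ (nm q) ⊴ g q
      Θ⊴g {q} _ = g-elim (λ q τ → Θ (nm q) ⊴ τ) image (λ q → free (copy-free (β (nm q)))) q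
        where
        image : ∀ i → Θ (nm (Vec.lookup params (ι p i))) ⊴ Vec.lookup B̂s i
        image i with ≼-⊴-trans s ⊴B̂
        ... | free f′ = free (f′ ∘ pars-lookup B̂s i)
        -- `Θ` provides its own proof of the constructor relation, with the same injection.
        ... | con p′ h′ = subst (_⊴ Vec.lookup B̂s i)
          (trans (cong (Vec.lookup (Vec.map par params ⟪ Θ ∘ nm ⟫ᵛ)) (ι-irrelevant p′ p i))
                 (lookup-map-par params (Θ ∘ nm) (ι p i)))
          (h′ i)
    liftᵛ ξ j []       {[]}     {[]}     {[]}     lin s s̃ ⊴B̂ ≼B̂ ok = solution-[] ξ j
    liftᵛ ξ j (t ∷ ts) {_ ∷ _} {_ ∷ _} {B̂ ∷ B̂s} lin (s , ss) (s̃ , s̃s) ⊴B̂ ≼B̂ ok =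
      solution-∷ ξ j t ts (unique-++-disjoint (vars t) lin)
        (lift (ξ ++ [ j ]) t (unique-++ˡ lin) s s̃ (⊴B̂ zero) (≼B̂ zero) (ok ∘ ∈-++⁺ˡ))
        (liftᵛ ξ (suc j) ts (unique-++ʳ (vars t) lin) ss s̃s (⊴B̂ ∘ suc) (≼B̂ ∘ suc)
          (ok ∘ ∈-++⁺ʳ (pars B̂)))

  module _ (ν : Naming) {n : ℕ} (i : ℕ) (ts : Vec Term n) (σs : Vec Ty n) where
    open Naming ν
    open Solutions ν

    private
      L = introduced ν i ts
      R = parsᵛ σs

    rigid⇒id : ∀ {Θ} → IsSolution ν i ts σs Θ → ∀ {p} → p ∈ R → map Θ p ≡ par p
    rigid⇒id {Θ} sol {p} p∈ = decidable-stable (isPar? (map Θ p) p) (IsSolution.rigid sol p∈)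

    -- The solution β may move the parameters of the bounds.  It is replaced by
    -- one that does not, from which β is recovered by a substitution.
    principal-extends : ∀ {Θ} → IsPrincipal ν i ts σs Θ → Disjoint L R → Linear ts →
      ∀ β → All (Sat β) (𝓘 ν i ts σs) →
      ∃[ Φ ] (∀ {p} → p ∈ R → Φ p ≡ β p) × (∀ {p} → p ∈ L → β p ≼ map Θ p ⟪ Φ ⟫)
    principal-extends {Θ} principal L#R lin β sat =
      -- `Φ₀` is what principality yields for the lifted solution; `back` then undoes the lifting.
      (λ p → map Φ₀ p ⟪ back ⟫) ,
      (λ {p} p∈ → trans (cong (_⟪ back ⟫) (Φ₀-rigid p∈)) (back-< (R<N p∈))) ,
      (λ {p} p∈ → ≼-trans (proj₁ (good p∈)) (subst (γ p ⟪ back ⟫ ≼_) (⟪⟫-∘ (map Θ p))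
        (≼-⟪⟫ (subst (_≼ map Θ p ⟪ map Φ₀ ⟫) (override-∈ L γ par p∈)
          (Θ̂≼ (newᵛ⊆parsˢ [ i ] 0 ts σs p∈))) back)))
      where
      N = strictBound (L ++ R)
      R<N : ∀ {p} → p ∈ R → p < N
      R<N p∈ = <strictBound {L = L ++ R} (∈-++⁺ʳ L p∈)
      open Lift ν (map Θ) β R N
      open Loose N
      solves = IsPrincipal.isSolution principal
      -- The lifting starts from the bounds `σs` themselves: `Θ` fixes them, and `back` sends them
      -- to their `β`-instances, as their parameters are below `N`.
      lifted = liftᵛ [ i ] 0 ts {B̂s = σs} lin
        (subst (Solᵛ (map Θ) [ i ] 0 ts) (⟪⟫ᵛ-id σs (rigid⇒id solves))
          (Sat⇒Solᵛ [ i ] 0 ts σs (IsSolution.solve solves)))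
        (Sat⇒Solᵛ [ i ] 0 ts σs sat)
        (subst (λ τs → ∀ i → Vec.lookup τs i ⊴ Vec.lookup τs i) (⟪par⟫ᵛ σs)
          (⊴-monoᵛ σs λ {p} _ → par p))
        (λ i → ≼-reflexive (cong (λ τs → Vec.lookup τs i)
          (⟪⟫ᵛ-cong σs λ p∈ → sym (back-< (R<N p∈)))))
        inj₁
      γ    = proj₁ lifted
      good = proj₂ (proj₂ lifted)
      -- Lifted values contain only rigid parameters and copies, neither of which belong to `L`.
      Θ̂ = restrict L γ λ u∈ q∈ q∈L → ⊥-elim ([ (λ q∈R → L#R (q∈L , q∈R))
        , (λ N≤q → strictBound≤⇒∉ N≤q (∈-++⁺ˡ q∈L)) ]′ (proj₂ (good u∈) q∈))
      Θ̂-rigid : ∀ {p} → p ∈ R → map Θ̂ p ≡ par p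
      Θ̂-rigid p∈ = override-∉ L γ par λ p∈L → L#R (p∈L , p∈)
      Θ̂-solves : IsSolution ν i ts σs Θ̂
      Θ̂-solves = record
        { rigid = λ p∈ p∈dom → p∈dom (Θ̂-rigid p∈)
        ; solve = Solᵛ⇒Sat [ i ] 0 ts σs
            (subst (Solᵛ (map Θ̂) [ i ] 0 ts) (sym (⟪⟫ᵛ-id σs Θ̂-rigid))
              (Solᵛ-cong [ i ] 0 ts (sym ∘ override-∈ L γ par) (proj₁ (proj₂ lifted))))
        }
      general = IsPrincipal.mostGeneral principal Θ̂ Θ̂-solves
      Φ₀ = proj₁ general
      Θ̂≼ : ∀ {p} → p ∈ parsˢ ν (𝓘 ν i ts σs) → map Θ̂ p ≼ map Θ p ⟪ map Φ₀ ⟫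
      Θ̂≼ = below-pars (𝓘 ν i ts σs) (All.map
        (λ {(τ , τ′)} (h , h′) → subst (τ ⟪ map Θ̂ ⟫ ≼_) (⟪⟫-∘ τ) h ,
                               subst (τ′ ⟪ map Θ̂ ⟫ ≼_) (⟪⟫-∘ τ′) h′)
        (proj₂ general))
      Φ₀-rigid : ∀ {p} → p ∈ R → map Φ₀ p ≡ par p
      -- Both solutions fix `p`, so principality places `map Φ₀ p` above `par p`, and only `par p`
      -- itself lies there.
      Φ₀-rigid {p} p∈ = par≼ (subst₂ _≼_ (Θ̂-rigid p∈)
        (cong (_⟪ map Φ₀ ⟫) (rigid⇒id solves p∈)) (Θ̂≼ (bound⊆parsˢᵛ [ i ] 0 ts σs p∈)))

    typing-typ : ∀ {U} (P : PrincipalFor ν i ts σs U) → ∀ {x} → x ∈ varsᵛ ts →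
                 typ U x ≡ map (PrincipalFor.Θ P) (name (of x))
    typing-typ P x∈ = cong (fromMaybe (par 0)) (PrincipalFor.typing P x∈)

    -- Relevance keeps the principal types inside the system, so a substitution acts on them through
    -- its values on `L` and `R` alone.
    typ-pars : ∀ {U} → PrincipalFor ν i ts σs U → ∀ {x} → x ∈ varsᵛ ts →
               ∀ {p} → p ∈ pars (typ U x) → p ∈ L ⊎ p ∈ R
    typ-pars P x∈ p∈ = parsˢ-ineqsᵛ⁻ [ i ] 0 ts σs
      (PrincipalFor.relevant P (newᵛ⊆parsˢ [ i ] 0 ts σs (of∈newᵛ [ i ] 0 ts x∈))
        (subst (λ τ → _ ∈ pars τ) (typing-typ P x∈) p∈))

    -- Matching turns the typing of `ts ⟦ θ ⟧ᵛ` into a solution with bounds instantiated by `Ψ`, and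
    -- `principal-extends` turns that into an instance of the principal typing. It serves for the
    -- head inputs as well as for the selected outputs.
    principal-match : ∀ {U u θ Ψ} → PrincipalFor ν i ts σs U → Linear ts →
      Hasᵛ u (ts ⟦ θ ⟧ᵛ) (σs ⟪ Ψ ⟫ᵛ) →
      ∃[ Φ ] (∀ {p} → p ∈ R → Φ p ≡ Ψ p) ×
             (∀ {x} → x ∈ varsᵛ ts → Has u (θ x) (typ U x ⟪ Φ ⟫))
    principal-match {U} {u} {θ} {Ψ} P lin h = Φ , (λ p∈ → trans (Φ≡β p∈) (β-rigid p∈)) ,
      λ {x} x∈ → let p∈ = of∈newᵛ [ i ] 0 ts x∈ in
        Has-≼ (θ x) (subst (Has u (θ x)) (sym (override-∈ L γ Ψ p∈)) (good p∈ refl))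
          (subst (λ τ → β (name (of x)) ≼ τ ⟪ Φ ⟫) (sym (typing-typ P x∈)) (β≼ p∈))
      where
      matched = match-solutionᵛ {u} {θ} [ i ] 0 ts lin h
      γ    = proj₁ matched
      good = proj₂ (proj₂ matched)
      β    = override L γ Ψ
      β-rigid : ∀ {p} → p ∈ R → β p ≡ Ψ p
      β-rigid p∈ = override-∉ L γ Ψ λ p∈L → PrincipalFor.fresh P (p∈L , p∈)
      extended = principal-extends (PrincipalFor.principal P) (PrincipalFor.fresh P) lin β
        (Solᵛ⇒Sat [ i ] 0 ts σs (subst (Solᵛ β [ i ] 0 ts) (sym (⟪⟫ᵛ-cong σs β-rigid))
          (Solᵛ-cong [ i ] 0 ts (sym ∘ override-∈ L γ Ψ) (proj₁ (proj₂ matched)))))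
      Φ   = proj₁ extended
      Φ≡β = proj₁ (proj₂ extended)
      β≼  = proj₂ (proj₂ extended)

-- Transfer of principal solutions along a renaming.

module Transfer (𝒮 : Signature) where
  open Signature 𝒮
  open TypeConstructors typeConstructors
  open Language 𝒮
  open TypeProperties typeConstructors
  open Typing 𝒮
  open Systems 𝒮
  open Principality 𝒮

  applyˢ : (Param → Ty) → Ty × Ty → Ty × Ty
  applyˢ Ψ (τ , τ′) = τ ⟪ Ψ ⟫ , τ′ ⟪ Ψ ⟫

  sat-∘ : ∀ {a b} → ∀ S → All (Sat b) (List.map (applyˢ a) S) → All (Sat (λ p → a p ⟪ b ⟫)) S
  sat-∘ S sat = All.map (λ {(τ , τ′)} → subst₂ _≼_ (⟪⟫-∘ τ) (⟪⟫-∘ τ′)) (map⁻ sat)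

  sat-∘⁻ : ∀ {a b} → ∀ S → All (Sat (λ p → a p ⟪ b ⟫)) S → All (Sat b) (List.map (applyˢ a) S)
  sat-∘⁻ S sat = map⁺ (All.map (λ {(τ , τ′)} → subst₂ _≼_ (sym (⟪⟫-∘ τ)) (sym (⟪⟫-∘ τ′))) sat)

  sat-⟪⟫ : ∀ {a} b S → All (Sat a) S → All (Sat (λ p → a p ⟪ b ⟫)) S
  sat-⟪⟫ b S = All.map λ {(τ , τ′)} h → subst₂ _≼_ (⟪⟫-∘ τ) (⟪⟫-∘ τ′) (≼-⟪⟫ h b)

  sat-cong : ∀ ν {a b} S → (∀ {p} → p ∈ parsˢ ν S → a p ≡ b p) → All (Sat a) S → All (Sat b) S
  sat-cong ν []             a≡b []        = []
  sat-cong ν ((τ , τ′) ∷ S) a≡b (h ∷ sat) =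
    subst₂ _≼_ (⟪⟫-cong τ (a≡b ∘ ∈-++⁺ˡ ∘ ∈-++⁺ˡ)) (⟪⟫-cong τ′ (a≡b ∘ ∈-++⁺ˡ ∘ ∈-++⁺ʳ (pars τ))) h ∷
    sat-cong ν S (a≡b ∘ ∈-++⁺ʳ (pars τ ++ pars τ′)) sat

  module Renaming (ν ν′ : Naming) (i i′ : ℕ) (e : Param → Param) (r : Var → Var) where
    open Naming ν
    open Naming ν′ using () renaming (name to name′; _atPos_ to _atPos′_; _atPosᵛ_ to _atPosᵛ′_)
    open Solutions ν

    module _ (name-at : ∀ ζ p → name′ (at (i′ ∷ ζ) p) ≡ e (name (at (i ∷ ζ) p))) where

      new-rename : ∀ ζ t → (∀ {x} → x ∈ vars t → name′ (of (r x)) ≡ e (name (of x))) →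
                   new ν′ (i′ ∷ ζ) (t ⟦ var ∘ r ⟧) ≡ List.map e (new ν (i ∷ ζ) t)
      newᵛ-rename : ∀ {n} ζ j (ts : Vec Term n) →
                    (∀ {x} → x ∈ varsᵛ ts → name′ (of (r x)) ≡ e (name (of x))) →
                    newᵛ ν′ (i′ ∷ ζ) j (ts ⟦ var ∘ r ⟧ᵛ) ≡ List.map e (newᵛ ν (i ∷ ζ) j ts)
      new-rename ζ (var x)    name-of = cong [_] (name-of (here refl))
      new-rename ζ (app f ts) name-of = trans
        (cong₂ _++_ on-flat (newᵛ-rename ζ 0 ts name-of))
        (sym (map-++ e (pars (flat f atPos (i ∷ ζ))) (newᵛ ν (i ∷ ζ) 0 ts)))
        where
        on-flat : pars (flat f atPos′ (i′ ∷ ζ)) ≡ List.map e (pars (flat f atPos (i ∷ ζ)))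
        on-flat = begin
          pars (flat f atPos′ (i′ ∷ ζ))
            ≡⟨ pars-rename (flat f) (name′ ∘ at (i′ ∷ ζ)) ⟩
          List.map (name′ ∘ at (i′ ∷ ζ)) (pars (flat f))
            ≡⟨ map-cong (name-at ζ) (pars (flat f)) ⟩
          List.map (e ∘ name ∘ at (i ∷ ζ)) (pars (flat f))
            ≡⟨ map-∘ (pars (flat f)) ⟩
          List.map e (List.map (name ∘ at (i ∷ ζ)) (pars (flat f)))
            ≡⟨ cong (List.map e) (pars-rename (flat f) (name ∘ at (i ∷ ζ))) ⟨
          List.map e (pars (flat f atPos (i ∷ ζ))) ∎
          where open ≡-Reasoning
      newᵛ-rename ζ j []       name-of = refl
      newᵛ-rename ζ j (t ∷ ts) name-of = trans
        (cong₂ _++_ (new-rename (ζ ++ [ j ]) t (name-of ∘ ∈-++⁺ˡ))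
                    (newᵛ-rename ζ (suc j) ts (name-of ∘ ∈-++⁺ʳ (vars t))))
        (sym (map-++ e (new ν (i ∷ ζ ++ [ j ]) t) (newᵛ ν (i ∷ ζ) (suc j) ts)))

      module _ (Ψ : Param → Ty) where

        -- On introduced parameters `Ψ` acts as the renaming `e`, so instantiating the bounds by `Ψ`
        -- amounts to applying `Ψ` to the whole system.
        ineqs-rename : ∀ ζ t σ → (∀ {x} → x ∈ vars t → name′ (of (r x)) ≡ e (name (of x))) →
          (∀ {p} → p ∈ new ν (i ∷ ζ) t → Ψ p ≡ par (e p)) →
          ineqs ν′ (i′ ∷ ζ) (t ⟦ var ∘ r ⟧) (σ ⟪ Ψ ⟫) ≡ List.map (applyˢ Ψ) (ineqs ν (i ∷ ζ) t σ)
        ineqsᵛ-rename : ∀ {n} ζ j (ts : Vec Term n) σs →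
          (∀ {x} → x ∈ varsᵛ ts → name′ (of (r x)) ≡ e (name (of x))) →
          (∀ {p} → p ∈ newᵛ ν (i ∷ ζ) j ts → Ψ p ≡ par (e p)) →
          ineqsᵛ ν′ (i′ ∷ ζ) j (ts ⟦ var ∘ r ⟧ᵛ) (σs ⟪ Ψ ⟫ᵛ) ≡
          List.map (applyˢ Ψ) (ineqsᵛ ν (i ∷ ζ) j ts σs)
        ineqs-rename ζ (var x) σ name-of Ψ≡e = cong (λ τ → [ τ , σ ⟪ Ψ ⟫ ])
          (trans (cong par (name-of (here refl))) (sym (Ψ≡e (here refl))))
        ineqs-rename ζ (app f ts) σ name-of Ψ≡e = cong₂ _∷_
          (cong (_, σ ⟪ Ψ ⟫) (trans (⟪⟫-cong (flat f) on-flat) (sym (⟪⟫-∘ (flat f)))))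
          (trans
            (cong (ineqsᵛ ν′ (i′ ∷ ζ) 0 (ts ⟦ var ∘ r ⟧ᵛ))
              (trans (⟪⟫ᵛ-cong (funArgs f) (on-flat ∘ transparent f)) (sym (⟪⟫ᵛ-∘ (funArgs f)))))
            (ineqsᵛ-rename ζ 0 ts (funArgs f atPosᵛ (i ∷ ζ)) name-of
              (Ψ≡e ∘ ∈-++⁺ʳ (pars (flat f atPos (i ∷ ζ))))))
          where
          on-flat : ∀ {p} → p ∈ pars (flat f) →
                    par (name′ (at (i′ ∷ ζ) p)) ≡ Ψ (name (at (i ∷ ζ) p))
          on-flat {p} p∈ = trans (cong par (name-at ζ p)) (sym (Ψ≡e (∈-++⁺ˡ (name-flat f (i ∷ ζ) p∈))))
        ineqsᵛ-rename ζ j []       []       name-of Ψ≡e = refl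
        ineqsᵛ-rename ζ j (t ∷ ts) (σ ∷ σs) name-of Ψ≡e = trans
          (cong₂ _++_
            (ineqs-rename (ζ ++ [ j ]) t σ (name-of ∘ ∈-++⁺ˡ) (Ψ≡e ∘ ∈-++⁺ˡ))
            (ineqsᵛ-rename ζ (suc j) ts σs (name-of ∘ ∈-++⁺ʳ (vars t))
              (Ψ≡e ∘ ∈-++⁺ʳ (new ν (i ∷ ζ ++ [ j ]) t))))
          (sym (map-++ (applyˢ Ψ) (ineqs ν (i ∷ ζ ++ [ j ]) t σ) (ineqsᵛ ν (i ∷ ζ) (suc j) ts σs)))

  module _ (ν ν′ : Naming) (i i′ : ℕ) {e d : Param → Param} (d∘e : ∀ p → d (e p) ≡ p)
           {r : Var → Var} {Ψ : Param → Ty} {n : ℕ} (ts : Vec Term n) (σs : Vec Ty n) where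
    open Naming ν
    open Naming ν′ using () renaming (name to name′)
    private
      module S  = Solutions ν
      module S′ = Solutions ν′
      L   = introduced ν i ts
      L′  = List.map e L
      R   = parsᵛ σs
      ts′ = ts ⟦ var ∘ r ⟧ᵛ
      σs′ = σs ⟪ Ψ ⟫ᵛ
      R′  = parsᵛ σs′

    -- `Θ′` is `Θ` conjugated by the renaming, chosen so that `Θ` followed by `Ψ` equals `Ψ`
    -- followed by `Θ′` on the system (`commute`). A solution of the new system, preceded by `Ψ`,
    -- solves the old one but moves its bounds, which is the situation of `principal-extends`.
    principal-transfer : ∀ {U U′} → PrincipalFor ν i ts σs U → Linear ts →
      (∀ ζ p → name′ (at (i′ ∷ ζ) p) ≡ e (name (at (i ∷ ζ) p))) →
      (∀ {x} → x ∈ varsᵛ ts → name′ (of (r x)) ≡ e (name (of x))) →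
      (∀ {p} → p ∈ L → Ψ p ≡ par (e p)) →
      Disjoint L′ R′ →
      (∀ {x} → x ∈ varsᵛ ts → typeOf U′ (r x) ≡ just (typ U x ⟪ Ψ ⟫)) →
      PrincipalFor ν′ i′ ts′ σs′ U′
    principal-transfer {U} {U′} P lin name-at name-of Ψ≡e L′#R′ U′≡ = record
      { fresh     = λ (p∈ , p∈R′) → L′#R′ (subst (_ ∈_) new≡ p∈ , p∈R′)
      ; Θ         = Θ′
      ; principal = record { isSolution = solution′ ; mostGeneral = general′ }
      ; relevant  = relevant′
      ; typing    = typing′
      }
      where
      open PrincipalFor P
      open Renaming ν ν′ i i′ e r
      S  = 𝓘 ν i ts σs
      S″ = 𝓘 ν′ i′ ts′ σs′

      new≡ : introduced ν′ i′ ts′ ≡ L′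
      new≡ = newᵛ-rename name-at [] 0 ts name-of

      S≡ : S″ ≡ List.map (applyˢ Ψ) S
      S≡ = ineqsᵛ-rename name-at Ψ [] 0 ts σs name-of Ψ≡e

      L⊎R : ∀ {p} → p ∈ parsˢ ν S → p ∈ L ⊎ p ∈ R
      L⊎R = S.parsˢ-ineqsᵛ⁻ [ i ] 0 ts σs

      L′⊎R′ : ∀ {p} → p ∈ parsˢ ν′ S″ → p ∈ L′ ⊎ p ∈ R′
      L′⊎R′ p∈ with S′.parsˢ-ineqsᵛ⁻ [ i′ ] 0 ts′ σs′ p∈
      ... | inj₁ p∈L = inj₁ (subst (_ ∈_) new≡ p∈L)
      ... | inj₂ p∈R = inj₂ p∈R

      L′⊆S : L′ ⊆ parsˢ ν′ S″
      L′⊆S p∈ = S′.newᵛ⊆parsˢ [ i′ ] 0 ts′ σs′ (subst (_ ∈_) (sym new≡) p∈)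

      R′⊆S : R′ ⊆ parsˢ ν′ S″
      R′⊆S = S′.bound⊆parsˢᵛ [ i′ ] 0 ts′ σs′

      Ψ-R : ∀ {p q} → p ∈ R → q ∈ pars (Ψ p) → q ∈ R′
      Ψ-R = parsᵛ-⟪⟫⁺ σs

      range : ∀ {p q} → p ∈ L → q ∈ pars (map Θ p) → q ∈ L ⊎ q ∈ R
      range p∈ q∈ = L⊎R (relevant (S.newᵛ⊆parsˢ [ i ] 0 ts σs p∈) q∈)

      range-fixed : ∀ (Θ : TySubst) {p q} → q ∈ pars (map Θ p) → map Θ q ≡ par q
      range-fixed Θ {p} = ⟪⟫-id⁻ (map Θ p) (TySubst.idempotent Θ p)

      Θ-rigid : ∀ {p} → p ∈ R → map Θ p ≡ par p
      Θ-rigid = rigid⇒id ν i ts σs (IsPrincipal.isSolution principal)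

      f : Param → Ty
      f q = map Θ (d q) ⟪ Ψ ⟫

      f∘e : ∀ p → f (e p) ≡ map Θ p ⟪ Ψ ⟫
      f∘e p = cong (λ q → map Θ q ⟪ Ψ ⟫) (d∘e p)

      f-fixed : ∀ {u q} → u ∈ L′ → q ∈ pars (f u) → q ∈ L′ → f q ≡ par q
      -- A parameter of `L′` in a value of `f` cannot stem from an instantiated bound. So it is
      -- `e s` with `s` in a value of `Θ`, and `Θ` fixes `s` by idempotence.
      f-fixed u∈ q∈ q∈L′ with p , p∈ , refl ← ∈-map⁻ e u∈
        with s , s∈ , q∈s ← pars-⟪⟫⁻ (map Θ p) (subst (λ τ → _ ∈ pars τ) (f∘e p) q∈)
        with range p∈ s∈
      ... | inj₂ s∈R = ⊥-elim (L′#R′ (q∈L′ , Ψ-R s∈R q∈s))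
      ... | inj₁ s∈L with here refl ← subst (λ τ → _ ∈ pars τ) (Ψ≡e s∈L) q∈s =
        trans (f∘e s) (trans (cong (_⟪ Ψ ⟫) (range-fixed Θ s∈)) (Ψ≡e s∈L))

      Θ′ : TySubst
      Θ′ = restrict L′ f f-fixed

      Θ′-new : ∀ {p} → p ∈ L → map Θ′ (e p) ≡ map Θ p ⟪ Ψ ⟫
      Θ′-new {p} p∈ = trans (override-∈ L′ f par (∈-map⁺ e p∈)) (f∘e p)

      Θ′-rigid : ∀ {p} → p ∈ R′ → map Θ′ p ≡ par p
      Θ′-rigid p∈ = override-∉ L′ f par λ p∈L′ → L′#R′ (p∈L′ , p∈)

      commute : ∀ {p} → p ∈ parsˢ ν S → map Θ p ⟪ Ψ ⟫ ≡ Ψ p ⟪ map Θ′ ⟫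
      commute {p} p∈ with L⊎R p∈
      ... | inj₁ p∈L = trans (sym (Θ′-new p∈L)) (cong (_⟪ map Θ′ ⟫) (sym (Ψ≡e p∈L)))
      ... | inj₂ p∈R = trans (cong (_⟪ Ψ ⟫) (Θ-rigid p∈R))
                             (sym (⟪⟫-id (Ψ p) (Θ′-rigid ∘ Ψ-R p∈R)))

      solution′ : IsSolution ν′ i′ ts′ σs′ Θ′
      solution′ = record
        { rigid = λ p∈ p∈dom → p∈dom (Θ′-rigid p∈)
        ; solve = subst (All (Sat (map Θ′))) (sym S≡) (sat-∘⁻ S (sat-cong ν S commute
                    (sat-⟪⟫ Ψ S (IsSolution.solve (IsPrincipal.isSolution principal)))))
        }

      relevant′ : IsRelevant ν′ i′ ts′ σs′ Θ′
      relevant′ u∈ q∈ with L′⊎R′ u∈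
      relevant′ u∈ q∈ | inj₂ u∈R′ with here refl ← subst (λ τ → _ ∈ pars τ) (Θ′-rigid u∈R′) q∈ = u∈
      relevant′ u∈ q∈ | inj₁ u∈L′ with p , p∈ , refl ← ∈-map⁻ e u∈L′
        with s , s∈ , q∈s ← pars-⟪⟫⁻ (map Θ p) (subst (λ τ → _ ∈ pars τ) (Θ′-new p∈) q∈)
        with range p∈ s∈
      ... | inj₂ s∈R = R′⊆S (Ψ-R s∈R q∈s)
      ... | inj₁ s∈L with here refl ← subst (λ τ → _ ∈ pars τ) (Ψ≡e s∈L) q∈s = L′⊆S (∈-map⁺ e s∈L)

      typing′ : ∀ {y} → y ∈ varsᵛ ts′ → typeOf U′ y ≡ just (map Θ′ (name′ (of y)))
      typing′ {y} y∈ with x , x∈ , refl ← ∈-map⁻ r (subst (y ∈_) (varsᵛ-rename ts r) y∈) =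
        trans (U′≡ x∈) (cong just (trans (cong (_⟪ Ψ ⟫) (typing-typ ν i ts σs P x∈))
          (trans (sym (Θ′-new (S.of∈newᵛ [ i ] 0 ts x∈))) (cong (map Θ′) (sym (name-of x∈))))))

      module General (Θ̃ : TySubst) (sol : IsSolution ν′ i′ ts′ σs′ Θ̃) where
        β : Param → Ty
        β p = Ψ p ⟪ map Θ̃ ⟫

        extended = principal-extends ν i ts σs principal fresh lin β
          (sat-∘ S (subst (All (Sat (map Θ̃))) S≡ (IsSolution.solve sol)))
        Φ   = proj₁ extended
        Φ≡β = proj₁ (proj₂ extended)

        Θ̃-rigid : ∀ {p} → p ∈ R′ → map Θ̃ p ≡ par p
        Θ̃-rigid = rigid⇒id ν′ i′ ts′ σs′ sol

        Θ̃≼ : ∀ {p} → p ∈ L → map Θ̃ (e p) ≼ map Θ p ⟪ Φ ⟫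
        Θ̃≼ {p} p∈ = subst (λ τ → τ ⟪ map Θ̃ ⟫ ≼ map Θ p ⟪ Φ ⟫) (Ψ≡e p∈) (proj₂ (proj₂ extended) p∈)

        Θ̃≼-generic : ∀ {p} → p ∈ L → map Θ p ≡ par p → map Θ̃ (e p) ≼ Φ p
        Θ̃≼-generic {p} p∈ generic = subst (λ τ → map Θ̃ (e p) ≼ τ ⟪ Φ ⟫) generic (Θ̃≼ p∈)

        -- Φ moved to the new parameters, on the generic ones only: they are all
        -- that Θ′ refers to, and elsewhere Φ may break idempotence.
        h₀ : Param → Ty
        h₀ p with isPar? (map Θ p) p
        ... | yes _ = Φ p
        ... | no _  = par (e p)

        h : Param → Ty
        h = h₀ ∘ d

        h₀-cases : ∀ p → (map Θ p ≡ par p × h₀ p ≡ Φ p) ⊎ (map Θ p ≢ par p × h₀ p ≡ par (e p))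
        h₀-cases p with isPar? (map Θ p) p
        ... | yes generic = inj₁ (generic , refl)
        ... | no ¬generic = inj₂ (¬generic , refl)

        h-generic : ∀ {p} → map Θ p ≡ par p → h (e p) ≡ Φ p
        h-generic {p} generic with h₀-cases p
        ... | inj₁ (_ , h₀≡)       = trans (cong h₀ (d∘e p)) h₀≡
        ... | inj₂ (¬generic , _) = ⊥-elim (¬generic generic)

        h-fixed : ∀ {u q} → u ∈ L′ → q ∈ pars (h u) → q ∈ L′ → h q ≡ par q
        h-fixed u∈ q∈ q∈L′ with p , p∈ , refl ← ∈-map⁻ e u∈ | p′ , p′∈ , refl ← ∈-map⁻ e q∈L′
          with h₀-cases p | h₀-cases p′ | subst (λ z → e p′ ∈ pars (h₀ z)) (d∘e p) q∈
        ... | _ | inj₂ (_ , h₀≡) | _ = trans (cong h₀ (d∘e p′)) h₀≡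
        -- As `e p′` occurs in `Φ p`, it occurs in the smaller type `map Θ̃ (e p)` and is fixed by
        -- the idempotent `Θ̃`. Hence `par (e p′)` lies below `Φ p′`, which must equal it.
        ... | inj₁ (generic , h₀≡) | inj₁ (generic′ , h₀≡′) | q∈h =
          trans (cong h₀ (d∘e p′)) (trans h₀≡′ (par≼ (subst (_≼ Φ p′)
            (range-fixed Θ̃ {e p} (≼-pars (Θ̃≼-generic p∈ generic) (subst (λ τ → e p′ ∈ pars τ) h₀≡ q∈h)))
            (Θ̃≼-generic p′∈ generic′))))
        ... | inj₂ (¬generic , h₀≡) | inj₁ (generic′ , _) | q∈h
          with subst (λ τ → e p′ ∈ pars τ) h₀≡ q∈h
        ... | here ep′≡ep = ⊥-elim (¬generic
          (subst (λ z → map Θ z ≡ par z) (trans (sym (d∘e p′)) (trans (cong d ep′≡ep) (d∘e p))) generic′))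

        Θ″ : TySubst
        Θ″ = restrict L′ h h-fixed

        Θ″-rigid : ∀ {p} → p ∈ R′ → map Θ″ p ≡ par p
        Θ″-rigid p∈ = override-∉ L′ h par λ p∈L′ → L′#R′ (p∈L′ , p∈)

        -- Values of `Θ` involve only generic parameters and parameters of the bounds, so the
        -- restriction of `h` to generic ones loses nothing.
        factor : ∀ {p q} → p ∈ L → q ∈ pars (map Θ p) → Φ q ≡ Ψ q ⟪ map Θ″ ⟫
        factor {q = q} p∈ q∈ with range p∈ q∈
        ... | inj₂ q∈R = trans (Φ≡β q∈R)
          (trans (⟪⟫-id (Ψ q) (Θ̃-rigid ∘ Ψ-R q∈R)) (sym (⟪⟫-id (Ψ q) (Θ″-rigid ∘ Ψ-R q∈R))))
        ... | inj₁ q∈L = trans (sym (h-generic (range-fixed Θ q∈)))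
          (trans (sym (override-∈ L′ h par (∈-map⁺ e q∈L))) (cong (_⟪ map Θ″ ⟫) (sym (Ψ≡e q∈L))))

        below : ∀ {p} → p ∈ parsˢ ν′ S″ → map Θ̃ p ≼ map Θ′ p ⟪ map Θ″ ⟫
        below {p} p∈ with L′⊎R′ p∈
        ... | inj₂ p∈R′ = ≼-reflexive (trans (Θ̃-rigid p∈R′)
          (trans (sym (Θ″-rigid p∈R′)) (cong (_⟪ map Θ″ ⟫) (sym (Θ′-rigid p∈R′)))))
        ... | inj₁ p∈L′ with q , q∈ , refl ← ∈-map⁻ e p∈L′ =
          subst (map Θ̃ (e q) ≼_)
            (trans (⟪⟫-cong (map Θ q) (factor q∈))
              (trans (sym (⟪⟫-∘ (map Θ q))) (cong (_⟪ map Θ″ ⟫) (sym (Θ′-new q∈)))))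
            (Θ̃≼ q∈)

      general′ : ∀ Θ̃ → IsSolution ν′ i′ ts′ σs′ Θ̃ → ∃[ Θ″ ]
        All (λ (τ , τ′) → (τ  ⟪ map Θ̃ ⟫ ≼ τ  ⟪ map Θ′ ⟫ ⟪ map Θ″ ⟫)
                        × (τ′ ⟪ map Θ̃ ⟫ ≼ τ′ ⟪ map Θ′ ⟫ ⟪ map Θ″ ⟫)) S″
      general′ Θ̃ sol = Θ″ , All.map
        (λ {(τ , τ′)} (h , h′) → subst (τ ⟪ map Θ̃ ⟫ ≼_) (sym (⟪⟫-∘ τ)) h ,
                                 subst (τ′ ⟪ map Θ̃ ⟫ ≼_) (sym (⟪⟫-∘ τ′)) h′)
        (S′.above-pars S″ below)
        where open General Θ̃ sol

-- Lists of lists and the replacement of a list entry.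

module _ {A B : Set} (f : A → List B) where

  ∈-concatMap-lookup : ∀ xs i {y} → y ∈ f (List.lookup xs i) → y ∈ concatMap f xs
  ∈-concatMap-lookup (x ∷ xs) zero    y∈ = ∈-++⁺ˡ y∈
  ∈-concatMap-lookup (x ∷ xs) (suc i) y∈ = ∈-++⁺ʳ (f x) (∈-concatMap-lookup xs i y∈)

  ∈-concatMap-lookup⁻ : ∀ xs {y} → y ∈ concatMap f xs → ∃[ i ] y ∈ f (List.lookup xs i)
  ∈-concatMap-lookup⁻ (x ∷ xs) y∈ with ∈-++⁻ (f x) y∈
  ... | inj₁ y∈x  = zero , y∈x
  ... | inj₂ y∈xs with i , y∈i ← ∈-concatMap-lookup⁻ xs y∈xs = suc i , y∈i

  unique-concatMap⁻ : ∀ xs → Unique (concatMap f xs) → ∀ i → Unique (f (List.lookup xs i))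
  unique-concatMap⁻ (x ∷ xs) u zero    = unique-++ˡ u
  unique-concatMap⁻ (x ∷ xs) u (suc i) = unique-concatMap⁻ xs (unique-++ʳ (f x) u) i

  concatMap-disjoint : ∀ xs → Unique (concatMap f xs) → ∀ i j → i ≢ j →
                       Disjoint (f (List.lookup xs i)) (f (List.lookup xs j))
  concatMap-disjoint (x ∷ xs) u zero    zero    i≢j = ⊥-elim (i≢j refl)
  concatMap-disjoint (x ∷ xs) u zero    (suc j) i≢j (y∈i , y∈j) =
    unique-++-disjoint (f x) u (y∈i , ∈-concatMap-lookup xs j y∈j)
  concatMap-disjoint (x ∷ xs) u (suc i) zero    i≢j (y∈i , y∈j) =
    unique-++-disjoint (f x) u (y∈j , ∈-concatMap-lookup xs i y∈i)
  concatMap-disjoint (x ∷ xs) u (suc i) (suc j) i≢j =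
    concatMap-disjoint xs (unique-++ʳ (f x) u) i j (i≢j ∘ cong suc)

  unique-concatMap : ∀ xs → (∀ i → Unique (f (List.lookup xs i))) →
                     (∀ i j → i ≢ j → Disjoint (f (List.lookup xs i)) (f (List.lookup xs j))) →
                     Unique (concatMap f xs)
  unique-concatMap []       u dis = []
  unique-concatMap (x ∷ xs) u dis =
    unique-++ (u zero) (unique-concatMap xs (u ∘ suc) (λ i j i≢j → dis (suc i) (suc j) λ { refl → i≢j refl }))
      λ (y∈x , y∈xs) → let i , y∈i = ∈-concatMap-lookup⁻ xs y∈xs in dis zero (suc i) (λ ()) (y∈x , y∈i)

module _ {A : Set} where

  lookup-map⁻ : ∀ {B : Set} (f : A → B) xs (i : Fin (length (List.map f xs))) →
                ∃[ j ] toℕ i ≡ toℕ j × List.lookup (List.map f xs) i ≡ f (List.lookup xs j)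
  lookup-map⁻ f (x ∷ xs) zero    = zero , refl , refl
  lookup-map⁻ f (x ∷ xs) (suc i) with j , e , e′ ← lookup-map⁻ f xs i = suc j , cong suc e , e′

  lookup-++⁻ : ∀ (xs ys : List A) (i : Fin (length (xs ++ ys))) →
    (∃[ j ] toℕ i ≡ toℕ j × List.lookup (xs ++ ys) i ≡ List.lookup xs j) ⊎
    (∃[ j ] toℕ i ≡ length xs + toℕ j × List.lookup (xs ++ ys) i ≡ List.lookup ys j)
  lookup-++⁻ []       ys i       = inj₂ (i , refl , refl)
  lookup-++⁻ (x ∷ xs) ys zero    = inj₁ (zero , refl , refl)
  lookup-++⁻ (x ∷ xs) ys (suc i) with lookup-++⁻ xs ys i
  ... | inj₁ (j , e , e′) = inj₁ (suc j , cong suc e , e′)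
  ... | inj₂ (j , e , e′) = inj₂ (j , cong suc e , e′)

  replace : (xs : List A) → Fin (length xs) → List A → List A
  replace xs k ys = take (toℕ k) xs ++ ys ++ drop (suc (toℕ k)) xs

  -- In the last case `suc` accounts for the removed entry `k`.
  lookup-replace⁻ : ∀ xs k ys (i : Fin (length (replace xs k ys))) →
    (∃[ j ] toℕ j < toℕ k × toℕ i ≡ toℕ j × List.lookup (replace xs k ys) i ≡ List.lookup xs j) ⊎
    (∃[ j ] toℕ i ≡ toℕ k + toℕ j × List.lookup (replace xs k ys) i ≡ List.lookup ys j) ⊎
    (∃[ j ] toℕ k < toℕ j × suc (toℕ i) ≡ length ys + toℕ j ×
            List.lookup (replace xs k ys) i ≡ List.lookup xs j)
  lookup-replace⁻ (x ∷ xs) zero ys i with lookup-++⁻ ys xs i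
  ... | inj₁ (j , e , e′) = inj₂ (inj₁ (j , e , e′))
  ... | inj₂ (j , e , e′) =
    inj₂ (inj₂ (suc j , s≤s z≤n , trans (cong suc e) (sym (+-suc (length ys) (toℕ j))) , e′))
  lookup-replace⁻ (x ∷ xs) (suc k) ys zero = inj₁ (zero , s≤s z≤n , refl , refl)
  lookup-replace⁻ (x ∷ xs) (suc k) ys (suc i) with lookup-replace⁻ xs k ys i
  ... | inj₁ (j , j<k , e , e′) = inj₁ (suc j , s≤s j<k , cong suc e , e′)
  ... | inj₂ (inj₁ (j , e , e′)) = inj₂ (inj₁ (j , cong suc e , e′))
  ... | inj₂ (inj₂ (j , k<j , e , e′)) =
    inj₂ (inj₂ (suc j , s≤s k<j , trans (cong suc e) (sym (+-suc (length ys) (toℕ j))) , e′))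

-- Disjoint copies of the parameters.

data Origin : Set where
  fromQuery fromClause unused : Origin

residue : Origin → ℕ
residue fromQuery  = 0
residue fromClause = 1
residue unused     = 2

-- 3p + residue o: disjoint copies of the parameters, one for each origin.
encode : Origin → ℕ → ℕ
encode o zero    = residue o
encode o (suc p) = suc (suc (suc (encode o p)))

decode : ℕ → ℕ
decode (suc (suc (suc q))) = suc (decode q)
decode _                   = 0

decodeOrigin : ℕ → Origin
decodeOrigin (suc (suc (suc q))) = decodeOrigin q
decodeOrigin 0                   = fromQuery
decodeOrigin 1                   = fromClause
decodeOrigin 2                   = unused

decode-encode : ∀ o p → decode (encode o p) ≡ p
decode-encode fromQuery  zero    = refl
decode-encode fromClause zero    = refl
decode-encode unused     zero    = refl
decode-encode o          (suc p) = cong suc (decode-encode o p)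

decodeOrigin-encode : ∀ o p → decodeOrigin (encode o p) ≡ o
decodeOrigin-encode fromQuery  zero    = refl
decodeOrigin-encode fromClause zero    = refl
decodeOrigin-encode unused     zero    = refl
decodeOrigin-encode o          (suc p) = decodeOrigin-encode o p

encode-injective : ∀ {o o′ p p′} → encode o p ≡ encode o′ p′ → o ≡ o′ × p ≡ p′
encode-injective {o} {o′} {p} {p′} e =
  trans (sym (decodeOrigin-encode o p)) (trans (cong decodeOrigin e) (decodeOrigin-encode o′ p′)) ,
  trans (sym (decode-encode o p)) (trans (cong decode e) (decode-encode o′ p′))

∈-map-encode⁻ : ∀ {o o′ p L} → encode o p ∈ List.map (encode o′) L → o ≡ o′ × p ∈ L
∈-map-encode⁻ {o} {o′} {p} p∈ with q , q∈ , e ← ∈-map⁻ (encode o′) p∈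
  with refl , refl ← encode-injective {o} {o′} {p} {q} e = refl , q∈

-- Consequences of being nicely typed.

module NicelyTyped (𝒮 : Signature) where
  open Signature 𝒮
  open TypeConstructors typeConstructors
  open Language 𝒮
  open TypeProperties typeConstructors
  open Typing 𝒮
  open Systems 𝒮
  open Principality 𝒮
  open Transfer 𝒮

  isVar? : ∀ (t : Term) x → Dec (t ≡ var x)
  isVar? (var y) x with y ≟ x
  ... | yes refl = yes refl
  ... | no y≢x   = no λ { refl → y≢x refl }
  isVar? (app f ts) x = no λ ()

  -- The exact instance is returned as well, because freshness and principality speak of the
  -- instance used in the derivation.
  atom-derivation : ∀ {U u} A ρ → (∀ {x} → x ∈ varsᵃ A → typeOf U x ≡ just (u x)) →
                    Hasᵛ u (args A) (predArgs (pred A) ⟪ ρ ⟫ᵛ) →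
                    Σ (U ⊢ A :Atom) λ d → instArgs d ≡ predArgs (pred A) ⟪ ρ ⟫ᵛ
  atom-derivation A ρ U≡u h with σs , ⊢ts , ≼Bs ← Hasᵛ⇒⊢ (args A) U≡u h = record
    { σs    = σs
    ; ϑ     = instantiate L ρ
    ; typed = ⊢ts
    ; below = λ i → instantiate-args (predArgs (pred A)) L ρ id i (≼Bs i)
    } , map-⟪⟫ (predArgs (pred A)) (λ {τ} → inst-instantiate L ρ {τ})
    where L = parsᵛ (predArgs (pred A))

  module Interface {C : Clause} (N : NicelyTypedClause C) where
    open NicelyTypedClause N public
    open Naming ν public using (name; name-injective)
    open NicelyModedClause nicelyModed public
    open NicelyModedQuery body-nicelyModed public

    A : Fin (length (body C)) → Atom
    A = List.lookup (body C)

    private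
      D : ∀ b → U ⊢ A b :Atom
      D = _⊢_:Clause.query derivation

      E : U ⊢ head C :Headatom
      E = _⊢_:Clause.headatom derivation

    u : Var → Ty
    u = typ U

    ρ : Fin (length (body C)) → Param → Ty
    ρ b = rho (_⊢_:Atom.ϑ (D b))

    insts : ∀ b → Vec Ty (predArity (pred (A b)))
    insts b = predArgs (pred (A b)) ⟪ ρ b ⟫ᵛ

    insts≡ : ∀ b → instArgs (D b) ≡ insts b
    insts≡ b = Vec-map-inst (_⊢_:Atom.ϑ (D b)) (predArgs (pred (A b)))

    news : Fin (length (body C)) → List Param
    news b = introduced ν (suc (toℕ b)) (outputs (A b))

    news₀ : List Param
    news₀ = introduced ν 0 (inputs (head C))

    body-typed : ∀ b → Hasᵛ u (args (A b)) (insts b)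
    body-typed b = Hasᵛ-tabulate (args (A b)) (insts b) λ i →
      Has-≼ (Vec.lookup (args (A b)) i) (⊢⇒Has (_⊢_:Atom.typed (D b) i))
        (below-inst (_⊢_:Atom.ϑ (D b)) (predArgs (pred (A b))) i (_⊢_:Atom.below (D b) i))

    head-typed : Hasᵛ u (args (head C)) (predArgs (pred (head C)))
    head-typed = Hasᵛ-tabulate (args (head C)) _ λ i →
      Has-≼ (Vec.lookup (args (head C)) i) (⊢⇒Has (_⊢_:Headatom.typed E i)) (_⊢_:Headatom.below E i)

    body-principal : ∀ b → PrincipalFor ν (suc (toℕ b)) (outputs (A b))
                             (pick output (mode (pred (A b))) (insts b)) U
    body-principal b = subst
      (λ τs → PrincipalFor ν (suc (toℕ b)) (outputs (A b)) (pick output (mode (pred (A b))) τs) U)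
      (insts≡ b) (principal b)

    news-insts : ∀ i j → toℕ j ≤ toℕ i → Disjoint (news i) (parsᵛ (insts j))
    news-insts i j j≤i = subst (λ τs → Disjoint (news i) (parsᵛ τs)) (insts≡ j) (fresh-inst i j j≤i)

    news-inputs : ∀ i j → toℕ j ≤ toℕ i → ∀ {x} → x ∈ varsᵛ (inputs (A j)) →
                  Disjoint (news i) (pars (u x))
    news-inputs i j j≤i {x} x∈
      with m , x∈m ← varsᵛ-lookup (args (A j)) (varsᵛ-pick input (mode (pred (A j))) (args (A j)) x∈) =
      fresh-vars i j j≤i x∈ (⊢⇒typeOf (_⊢_:Atom.typed (D j) m) x∈m)

    outputs-unique : ∀ b → Linear (outputs (A b))
    outputs-unique = unique-concatMap⁻ (varsᵛ ∘ outputs) (body C) outputs-linear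

    outputs-disjoint : ∀ i j → toℕ i ≢ toℕ j → Disjoint (varsᵛ (outputs (A i))) (varsᵛ (outputs (A j)))
    outputs-disjoint i j i≢j =
      concatMap-disjoint (varsᵛ ∘ outputs) (body C) outputs-linear i j (i≢j ∘ cong toℕ)

    -- The first entry of a position is the number of its system, and parameters of variables differ
    -- when the variables do.
    systems-disjoint : ∀ {m n} i j (ts : Vec Term m) (ts′ : Vec Term n) → i ≢ j →
                       Disjoint (varsᵛ ts) (varsᵛ ts′) →
                       Disjoint (introduced ν i ts) (introduced ν j ts′)
    systems-disjoint i j ts ts′ i≢j dis (p∈ , p∈′)
      with Solutions.newᵛ-form ν [ i ] 0 ts p∈ | Solutions.newᵛ-form ν [ j ] 0 ts′ p∈′
    ... | inj₁ (_ , _ , _ , _ , refl) | inj₁ (_ , _ , _ , _ , e) =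
      i≢j (∷-injectiveˡ (proj₁ (Solutions.at-injective ν e)))
    ... | inj₁ (_ , _ , _ , _ , refl) | inj₂ (_ , _ , e) = Solutions.at≢of ν e
    ... | inj₂ (_ , _ , refl) | inj₁ (_ , _ , _ , _ , e) = Solutions.at≢of ν (sym e)
    ... | inj₂ (_ , x∈ , refl) | inj₂ (_ , y∈ , e) with refl ← Solutions.of-injective ν e =
      dis (x∈ , y∈)

    news-disjoint : ∀ i j → toℕ i ≢ toℕ j → Disjoint (news i) (news j)
    news-disjoint i j i≢j = systems-disjoint (suc (toℕ i)) (suc (toℕ j)) (outputs (A i)) (outputs (A j))
      (i≢j ∘ suc-injective) (outputs-disjoint i j i≢j)

    news₀-disjoint : ∀ b → Disjoint news₀ (news b)
    news₀-disjoint b = systems-disjoint 0 (suc (toℕ b)) (inputs (head C)) (outputs (A b)) (λ ())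
      λ (x∈ , x∈b) → head-disjoint (x∈ , ∈-concatMap-lookup (varsᵛ ∘ outputs) (body C) b x∈b)

    body-vars : ∀ b → varsᵃ (A b) ⊆ varsꟴ (body C)
    body-vars b = ∈-concatMap-lookup varsᵃ (body C) b

    input-vars : ∀ b → varsᵛ (inputs (A b)) ⊆ varsꟴ (body C)
    input-vars b = body-vars b ∘ varsᵛ-pick input (mode (pred (A b))) (args (A b))

    output-vars : ∀ b → varsᵛ (outputs (A b)) ⊆ varsꟴ (body C)
    output-vars b = body-vars b ∘ varsᵛ-pick output (mode (pred (A b))) (args (A b))

-- The resolution step: the mgu compared with moded unification.

module Resolution (𝒮 : Signature) where
  open Signature 𝒮
  open TypeConstructors typeConstructors
  open Language 𝒮
  open TypeProperties typeConstructors
  open Typing 𝒮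
  open Systems 𝒮
  open Principality 𝒮
  open Transfer 𝒮
  open NicelyTyped 𝒮

  varsꟴ-rename⁺ : ∀ ρ B {x} → x ∈ varsꟴ B → ρ x ∈ varsꟴ (B ⟦ var ∘ ρ ⟧ꟴ)
  varsꟴ-rename⁺ ρ (A ∷ B) x∈ with ∈-++⁻ (varsᵃ A) x∈
  ... | inj₁ x∈A = ∈-++⁺ˡ (varsᵛ-⟦⟧⁺ (args A) x∈A (here refl))
  ... | inj₂ x∈B = ∈-++⁺ʳ (varsᵃ (A ⟦ var ∘ ρ ⟧ᵃ)) (varsꟴ-rename⁺ ρ B x∈B)

  unvar : Term → Var
  unvar (var x)   = x
  unvar (app _ _) = 0

  var-image : ∀ t {δ x} → t ⟦ δ ⟧ ≡ var x → t ≡ var (unvar t)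
  var-image (var y) e = refl

  module Step
    {p : Pred} {hs as : Vec Term (predArity p)} {B Q : Query}
    (NC : NicelyTypedClause (atom p hs ⟵ B)) (NQ : NicelyTypedQuery Q)
    (ρ : Var → Var) (ρ-injective : Injective _≡_ _≡_ ρ)
    (renamed-apart : Disjoint (varsᶜ (renameᶜ ρ (atom p hs ⟵ B))) (varsꟴ Q))
    (k : Fin (length Q)) (selected : List.lookup Q k ≡ atom p as)
    (θˢ : Subst) (mgu : IsMGU (atom p hs ⟦ var ∘ ρ ⟧ᵃ) (atom p as) θˢ)
    (moded : ModedUnification p as (hs ⟦ var ∘ ρ ⟧ᵛ))
    where

    module IQ = Interface NQ
    module IC = Interface NC

    K = toℕ k
    n = length B
    θ = sub θˢ
    C = atom p hs ⟵ B
    hs′ = hs ⟦ var ∘ ρ ⟧ᵛ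
    ws  = pick input  (mode p) hs
    vs  = pick output (mode p) hs
    ws′ = pick input  (mode p) hs′
    vs′ = pick output (mode p) hs′
    ss  = pick input  (mode p) as
    ts  = pick output (mode p) as

    inputs-k : varsᵛ (inputs (IQ.A k)) ≡ varsᵛ ss
    inputs-k = cong (λ A → varsᵛ (inputs A)) selected

    outputs-k : varsᵛ (outputs (IQ.A k)) ≡ varsᵛ ts
    outputs-k = cong (λ A → varsᵛ (outputs A)) selected

    newsₖ : List Param
    newsₖ = introduced IQ.ν (suc K) ts

    news-k : IQ.news k ≡ newsₖ
    news-k = cong (λ A → introduced IQ.ν (suc K) (outputs A)) selected

    instsₖ : Vec Ty (predArity p)
    instsₖ = predArgs p ⟪ IQ.ρ k ⟫ᵛ

    insts-k : parsᵛ (IQ.insts k) ≡ parsᵛ instsₖ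
    insts-k = cong (λ A → parsᵛ (predArgs (pred A) ⟪ IQ.ρ k ⟫ᵛ)) selected

    typedₖ : Hasᵛ IQ.u as instsₖ
    typedₖ = subst (λ A → Hasᵛ IQ.u (args A) (predArgs (pred A) ⟪ IQ.ρ k ⟫ᵛ)) selected (IQ.body-typed k)

    principalₖ : PrincipalFor IQ.ν (suc K) ts (pick output (mode p) instsₖ) IQ.U
    principalₖ = subst (λ A → PrincipalFor IQ.ν (suc K) (outputs A)
      (pick output (mode (pred A)) (predArgs (pred A) ⟪ IQ.ρ k ⟫ᵛ)) IQ.U) selected (IQ.body-principal k)

    linearₖ : Linear ts
    linearₖ = subst Unique outputs-k (IQ.outputs-unique k)

    ss⊆inputs : ∀ {x} → x ∈ varsᵛ ss → x ∈ varsᵛ (inputs (IQ.A k))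
    ss⊆inputs = subst (_ ∈_) (sym inputs-k)

    ts⊆outputs : ∀ {x} → x ∈ varsᵛ ts → x ∈ varsᵛ (outputs (IQ.A k))
    ts⊆outputs = subst (_ ∈_) (sym outputs-k)

    ss⊆Q : ∀ {x} → x ∈ varsᵛ ss → x ∈ varsꟴ Q
    ss⊆Q = IQ.input-vars k ∘ ss⊆inputs

    ts⊆Q : ∀ {x} → x ∈ varsᵛ ts → x ∈ varsꟴ Q
    ts⊆Q = IQ.output-vars k ∘ ts⊆outputs

    ss∌ts : ∀ {x} → x ∈ varsᵛ ss → x ∉ varsᵛ ts
    ss∌ts x∈ss x∈ts = IQ.producer-first k k ≤-refl (ss⊆inputs x∈ss , ts⊆outputs x∈ts)

    ws⊆C : ∀ {x} → x ∈ varsᵛ ws → x ∈ varsᶜ C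
    ws⊆C x∈ = ∈-++⁺ˡ (varsᵛ-pick input (mode p) hs x∈)

    vs⊆C : ∀ {x} → x ∈ varsᵛ vs → x ∈ varsᶜ C
    vs⊆C x∈ = ∈-++⁺ˡ (varsᵛ-pick output (mode p) hs x∈)

    B⊆C : ∀ {x} → x ∈ varsꟴ B → x ∈ varsᶜ C
    B⊆C = ∈-++⁺ʳ (varsᵛ hs)

    ρ∉Q : ∀ {x} → x ∈ varsᶜ C → ρ x ∉ varsꟴ Q
    ρ∉Q {x} x∈ ρx∈Q with ∈-++⁻ (varsᵛ hs) x∈
    ... | inj₁ x∈hs = renamed-apart (∈-++⁺ˡ (varsᵛ-⟦⟧⁺ hs x∈hs (here refl)) , ρx∈Q)
    ... | inj₂ x∈B  = renamed-apart (∈-++⁺ʳ (varsᵛ hs′) (varsꟴ-rename⁺ ρ B x∈B) , ρx∈Q)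

    ws′-form : ∀ {y} → y ∈ varsᵛ ws′ → ∃[ x ] x ∈ varsᵛ ws × y ≡ ρ x
    ws′-form y∈ = ∈-map⁻ ρ (subst (_ ∈_)
      (trans (cong varsᵛ (pick-⟦⟧ input (mode p) hs (var ∘ ρ))) (varsᵛ-rename ws ρ)) y∈)

    vs′-form : ∀ {y} → y ∈ varsᵛ vs′ → ∃[ x ] x ∈ varsᵛ vs × y ≡ ρ x
    vs′-form y∈ = ∈-map⁻ ρ (subst (_ ∈_)
      (trans (cong varsᵛ (pick-⟦⟧ output (mode p) hs (var ∘ ρ))) (varsᵛ-rename vs ρ)) y∈)

    Q∌ws′ : ∀ {x} → x ∈ varsꟴ Q → x ∉ varsᵛ ws′
    Q∌ws′ x∈Q x∈ws′ with x , x∈ , refl ← ws′-form x∈ws′ = ρ∉Q (ws⊆C x∈) x∈Q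

    -- Moded unification binds only `ts` and `ws′`; the remaining variables survive in the resolvent
    -- up to renaming.
    Relevant : Var → Set
    Relevant x = x ∉ varsᵛ ts × x ∉ varsᵛ ws′

    module Unifier where
      open ModedUnification moded using (θ₁; θ₂; dom-θ₁; match₁; match₂)

      θ₁-id : ∀ {x} → x ∉ varsᵛ ws′ → sub θ₁ x ≡ var x
      θ₁-id {x} x∉ = decidable-stable (isVar? (sub θ₁ x) x) λ θ₁x≢ → x∉ (dom-θ₁ θ₁x≢)

      -- `θ₂` may act on any variable, so it is restricted to `ts`. Thus the unifier fixes every
      -- relevant variable.
      σ : Var → Term
      σ = override (varsᵛ ts) (sub θ₂) (sub θ₁)

      σˢ : Subst
      σˢ = record
        { sub    = σ
        ; finite = strictBound (varsᵛ ts) ⊔ proj₁ (Subst.finite θ₁) , λ x ≤x →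
            trans (override-∉ (varsᵛ ts) (sub θ₂) (sub θ₁)
                    (strictBound≤⇒∉ (≤-trans (m≤m⊔n (strictBound (varsᵛ ts)) _) ≤x)))
                  (proj₂ (Subst.finite θ₁) x
                    (≤-trans (m≤n⊔m (strictBound (varsᵛ ts)) _) ≤x))
        }

      σ-ts : ∀ {x} → x ∈ varsᵛ ts → σ x ≡ sub θ₂ x
      σ-ts = override-∈ (varsᵛ ts) (sub θ₂) (sub θ₁)

      σ-∉ts : ∀ {x} → x ∉ varsᵛ ts → σ x ≡ sub θ₁ x
      σ-∉ts = override-∉ (varsᵛ ts) (sub θ₂) (sub θ₁)

      σ-relevant : ∀ {x} → Relevant x → σ x ≡ var x
      σ-relevant (x∉ts , x∉ws′) = trans (σ-∉ts x∉ts) (θ₁-id x∉ws′)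

      σ-clause : ∀ {n} (us : Vec Term n) → (∀ {y} → y ∈ varsᵛ us → ∃[ x ] x ∈ varsᶜ C × y ≡ ρ x) →
                 us ⟦ σ ⟧ᵛ ≡ us ⟦ sub θ₁ ⟧ᵛ
      σ-clause us us⊆C = ⟦⟧ᵛ-cong us λ y∈ → σ-∉ts λ y∈ts →
        let x , x∈ , y≡ = us⊆C y∈ in ρ∉Q x∈ (subst (_∈ varsꟴ Q) y≡ (ts⊆Q y∈ts))

      on-inputs : ws′ ⟦ σ ⟧ᵛ ≡ ss ⟦ σ ⟧ᵛ
      on-inputs = begin
        ws′ ⟦ σ ⟧ᵛ       ≡⟨ σ-clause ws′ (λ y∈ → let x , x∈ , e = ws′-form y∈ in x , ws⊆C x∈ , e) ⟩
        ws′ ⟦ sub θ₁ ⟧ᵛ  ≡⟨ match₁ ⟩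
        ss               ≡⟨ ⟦var⟧ᵛ ss ⟨
        -- Nice modedness keeps `ss` away from `ts`, renaming apart keeps it away from `ws′`.
        ss ⟦ var ⟧ᵛ      ≡⟨ ⟦⟧ᵛ-cong ss (λ x∈ → σ-relevant (ss∌ts x∈ , Q∌ws′ (ss⊆Q x∈))) ⟨
        ss ⟦ σ ⟧ᵛ        ∎
        where open ≡-Reasoning

      on-outputs : vs′ ⟦ σ ⟧ᵛ ≡ ts ⟦ σ ⟧ᵛ
      on-outputs = begin
        vs′ ⟦ σ ⟧ᵛ                  ≡⟨ σ-clause vs′ (λ y∈ → let x , x∈ , e = vs′-form y∈ in x , vs⊆C x∈ , e) ⟩
        vs′ ⟦ sub θ₁ ⟧ᵛ             ≡⟨ match₂ ⟨
        ts ⟦ sub θ₁ ⟧ᵛ ⟦ sub θ₂ ⟧ᵛ  ≡⟨ cong (_⟦ sub θ₂ ⟧ᵛ) (⟦⟧ᵛ-cong ts (λ x∈ → θ₁-id (Q∌ws′ (ts⊆Q x∈)))) ⟩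
        ts ⟦ var ⟧ᵛ ⟦ sub θ₂ ⟧ᵛ     ≡⟨ cong (_⟦ sub θ₂ ⟧ᵛ) (⟦var⟧ᵛ ts) ⟩
        ts ⟦ sub θ₂ ⟧ᵛ              ≡⟨ ⟦⟧ᵛ-cong ts σ-ts ⟨
        ts ⟦ σ ⟧ᵛ                   ∎
        where open ≡-Reasoning

      unifies : IsUnifier (atom p hs′) (atom p as) σˢ
      unifies = cong (atom p) (pick-injective (mode p)
        (trans (pick-⟦⟧ input (mode p) hs′ σ) (trans on-inputs (sym (pick-⟦⟧ input (mode p) as σ))))
        (trans (pick-⟦⟧ output (mode p) hs′ σ) (trans on-outputs (sym (pick-⟦⟧ output (mode p) as σ)))))

      private
        instance-of = IsMGU.mostGeneral mgu σˢ unifies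

      δ : Var → Term
      δ = sub (proj₁ instance-of)

      θδ : ∀ {x} → Relevant x → θ x ⟦ δ ⟧ ≡ var x
      θδ {x} rel = trans (sym (proj₂ instance-of x)) (σ-relevant rel)

    open Unifier using (δ; θδ)

    r : Var → Var
    r = unvar ∘ θ

    -- An instance of the mgu fixes the relevant variables, hence the mgu itself
    -- renames them.
    θ-relevant : ∀ {x} → Relevant x → θ x ≡ var (r x)
    θ-relevant {x} rel = var-image (θ x) (θδ rel)

    r-injective : ∀ {x y} → Relevant x → Relevant y → r x ≡ r y → x ≡ y
    r-injective {x} {y} rx ry e = var-injective (begin
      var x            ≡⟨ θδ rx ⟨
      θ x ⟦ δ ⟧        ≡⟨ cong (_⟦ δ ⟧) (θ-relevant rx) ⟩
      δ (r x)          ≡⟨ cong δ e ⟩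
      δ (r y)          ≡⟨ cong (_⟦ δ ⟧) (θ-relevant ry) ⟨
      θ y ⟦ δ ⟧        ≡⟨ θδ ry ⟩
      var y            ∎)
      where
      open ≡-Reasoning
      var-injective : ∀ {x y} → Term.var x ≡ var y → x ≡ y
      var-injective refl = refl

    relevantQ : ∀ {x} → x ∈ varsꟴ Q → x ∉ varsᵛ ts → Relevant x
    relevantQ x∈Q x∉ts = x∉ts , Q∌ws′ x∈Q

    relevantC : ∀ {x} → x ∈ varsᶜ C → x ∉ varsᵛ ws → Relevant (ρ x)
    relevantC x∈C x∉ws = (ρ∉Q x∈C ∘ ts⊆Q) , λ ρx∈ →
      let x′ , x′∈ , e = ws′-form ρx∈ in x∉ws (subst (_∈ varsᵛ ws) (sym (ρ-injective e)) x′∈)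

    unify-args : as ⟦ θ ⟧ᵛ ≡ hs ⟦ θ ∘ ρ ⟧ᵛ
    unify-args = trans (sym (args-injective (IsMGU.unifies mgu))) (⟦⟧ᵛ-∘ hs)
      where
      args-injective : ∀ {us us′ : Vec Term (predArity p)} → atom p us ≡ atom p us′ → us ≡ us′
      args-injective refl = refl

    unify-pick : ∀ m → pick m (mode p) as ⟦ θ ⟧ᵛ ≡ pick m (mode p) hs ⟦ θ ∘ ρ ⟧ᵛ
    unify-pick m = trans (sym (pick-⟦⟧ m (mode p) as θ))
      (trans (cong (pick m (mode p)) unify-args) (pick-⟦⟧ m (mode p) hs (θ ∘ ρ)))

    θ-ss : ∀ {x} → x ∈ varsᵛ ss → θ x ≡ var (r x)
    θ-ss x∈ = θ-relevant (relevantQ (ss⊆Q x∈) (ss∌ts x∈))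

    -- Unification equates the instances of `ws` and `ss`, and on `ss` the mgu is the renaming `r`.
    head-input-form : ∀ {x y} → x ∈ varsᵛ ws → y ∈ vars (θ (ρ x)) → ∃[ z ] z ∈ varsᵛ ss × y ≡ r z
    head-input-form x∈ y∈
      with z , z∈ , y∈z ← varsᵛ-⟦⟧⁻ ss (subst (λ us → _ ∈ varsᵛ us) (sym (unify-pick input)) (varsᵛ-⟦⟧⁺ ws x∈ y∈))
      with here e ← subst (λ t → _ ∈ vars t) (θ-ss z∈) y∈z = z , z∈ , e

    output-form : ∀ {x y} → x ∈ varsᵛ ts → y ∈ vars (θ x) →
                  (∃[ z ] z ∈ varsᵛ ss × y ≡ r z) ⊎
                  (∃[ z ] z ∈ varsᶜ C × z ∉ varsᵛ ws × y ≡ r (ρ z))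
    output-form x∈ y∈
      with z , z∈ , y∈z ← varsᵛ-⟦⟧⁻ vs (subst (λ us → _ ∈ varsᵛ us) (unify-pick output) (varsᵛ-⟦⟧⁺ ts x∈ y∈))
      with z ∈? varsᵛ ws
    ... | yes z∈ws = inj₁ (head-input-form z∈ws y∈z)
    ... | no z∉ws with here e ← subst (λ t → _ ∈ vars t) (θ-relevant (relevantC (vs⊆C z∈) z∉ws)) y∈z =
      inj₂ (z , vs⊆C z∈ , z∉ws , e)

    -- Origins and names in the resolvent.

    eQ eC : Param → Param
    eQ = encode fromQuery
    eC = encode fromClause

    -- The variables of each parent that the mgu merely renames; on them `r`, respectively `r ∘ ρ`,
    -- can be inverted.
    LQ LC : List Var
    LQ = filter (λ x → ¬? (x ∈? varsᵛ ts)) (varsꟴ Q)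
    LC = filter (λ x → ¬? (x ∈? varsᵛ ws)) (varsᶜ C)

    LQ-relevant : ∀ {x} → x ∈ LQ → Relevant x
    LQ-relevant x∈ with x∈Q , x∉ts ← ∈-filter⁻ (λ x → ¬? (x ∈? varsᵛ ts)) {xs = varsꟴ Q} x∈ =
      relevantQ x∈Q x∉ts

    LC-relevant : ∀ {x} → x ∈ LC → Relevant (ρ x)
    LC-relevant x∈ with x∈C , x∉ws ← ∈-filter⁻ (λ x → ¬? (x ∈? varsᵛ ws)) {xs = varsᶜ C} x∈ =
      relevantC x∈C x∉ws

    firstOrigin : Maybe Var → Maybe Var → Var → Origin × Var
    firstOrigin (just x) _        _ = fromQuery , x
    firstOrigin nothing  (just x) _ = fromClause , x
    firstOrigin nothing  nothing  y = unused , y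

    varOrigin : Var → Origin × Var
    varOrigin y = firstOrigin (find r LQ y) (find (r ∘ ρ) LC y) y

    varOrigin-query : ∀ {x} → x ∈ varsꟴ Q → x ∉ varsᵛ ts → varOrigin (r x) ≡ (fromQuery , x)
    varOrigin-query {x} x∈Q x∉ts = cong (λ m → firstOrigin m (find (r ∘ ρ) LC (r x)) (r x))
      (find-complete r (∈-filter⁺ (λ x → ¬? (x ∈? varsᵛ ts)) x∈Q x∉ts)
        λ z∈ → r-injective (LQ-relevant z∈) (relevantQ x∈Q x∉ts))

    varOrigin-clause : ∀ {x} → x ∈ varsᶜ C → x ∉ varsᵛ ws → varOrigin (r (ρ x)) ≡ (fromClause , x)
    varOrigin-clause {x} x∈C x∉ws = cong₂ (λ m m′ → firstOrigin m m′ (r (ρ x)))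
      (find-nothing r LQ λ {z} z∈ e → ρ∉Q x∈C (subst (_∈ varsꟴ Q)
        (r-injective (LQ-relevant z∈) (relevantC x∈C x∉ws) e)
        (proj₁ (∈-filter⁻ (λ x → ¬? (x ∈? varsᵛ ts)) {xs = varsꟴ Q} z∈))))
      (find-complete (r ∘ ρ) (∈-filter⁺ (λ x → ¬? (x ∈? varsᵛ ws)) x∈C x∉ws)
        λ z∈ e → ρ-injective (r-injective (LC-relevant z∈) (relevantC x∈C x∉ws) e))

    -- The atom with index j of the resolvent is the atom of the query or of the
    -- clause body with the given index.
    atomOrigin : ℕ → Origin × ℕ
    atomOrigin j with j <? K
    ... | yes _ = fromQuery , j
    ... | no _ with j <? K + n
    ...   | yes _ = fromClause , j ∸ K
    ...   | no _  = fromQuery , suc (j ∸ n)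

    -- Atoms behind the selected one move by `n` less one, as the `n` body atoms replace a single
    -- atom.
    atomPosition : Origin → ℕ → ℕ
    atomPosition fromClause j = K + j
    atomPosition _          j with j <? K
    ... | yes _ = j
    ... | no _  = (j ∸ 1) + n

    atomPosition-origin : ∀ j → atomPosition (proj₁ (atomOrigin j)) (proj₂ (atomOrigin j)) ≡ j
    atomPosition-origin j with j <? K in j<K?
    ... | yes _ rewrite j<K? = refl
    ... | no j≮K with j <? K + n
    ...   | yes _ = m+[n∸m]≡n (≮⇒≥ j≮K)
    ...   | no j≮K+n with suc (j ∸ n) <? K
    ...     | yes s<K = ⊥-elim (<-irrefl refl (<-≤-trans s<K (m≤n⇒m≤1+n
      (subst (_≤ j ∸ n) (m+n∸n≡m K n) (∸-monoˡ-≤ n (≮⇒≥ j≮K+n))))))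
    ...     | no _ = m∸n+n≡m (≤-trans (m≤n+m n K) (≮⇒≥ j≮K+n))

    origin-before : ∀ {j} → j < K → atomOrigin j ≡ (fromQuery , j)
    origin-before {j} j<K with j <? K
    ... | yes _  = refl
    ... | no j≮K = ⊥-elim (j≮K j<K)

    origin-within : ∀ {b} → b < n → atomOrigin (K + b) ≡ (fromClause , b)
    origin-within {b} b<n with K + b <? K
    ... | yes lt = ⊥-elim (<-irrefl refl (<-≤-trans lt (m≤m+n K b)))
    ... | no _ with K + b <? K + n
    ...   | yes _ = cong (fromClause ,_) (m+n∸m≡n K b)
    ...   | no ≮  = ⊥-elim (≮ (+-monoʳ-< K b<n))

    origin-after : ∀ {j i} → K < j → suc i ≡ n + j → atomOrigin i ≡ (fromQuery , j)
    origin-after {suc j} {i} (s≤s K≤j) e with refl ← suc-injective (trans e (+-suc n j)) with n + j <? K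
    ... | yes lt = ⊥-elim (<-irrefl refl (<-≤-trans lt (≤-trans K≤j (m≤n+m j n))))
    ... | no _ with n + j <? K + n
    ...   | yes lt = ⊥-elim (<-irrefl refl (<-≤-trans lt
      (subst (K + n ≤_) (+-comm j n) (+-monoˡ-≤ n K≤j))))
    ...   | no _ = cong (λ m → fromQuery , suc m) (m+n∸m≡n n j)

    source : Fresh → Origin × Fresh
    source (at [] q)          = unused , at [] q
    source (at (zero ∷ ζ) q)  = unused , at (zero ∷ ζ) q
    source (at (suc j ∷ ζ) q) = proj₁ (atomOrigin j) , at (suc (proj₂ (atomOrigin j)) ∷ ζ) q
    source (of y)             = proj₁ (varOrigin y) , of (proj₂ (varOrigin y))

    unsource : Origin × Fresh → Fresh
    unsource (o          , at (suc j ∷ ζ) q) = at (suc (atomPosition o j) ∷ ζ) q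
    unsource (fromQuery  , of x)             = of (r x)
    unsource (fromClause , of x)             = of (r (ρ x))
    unsource (_          , m)                = m

    unsource-source : ∀ m → unsource (source m) ≡ m
    unsource-source (at [] q)          = refl
    unsource-source (at (zero ∷ ζ) q)  = refl
    unsource-source (at (suc j ∷ ζ) q) = cong (λ m → at (suc m ∷ ζ) q) (atomPosition-origin j)
    unsource-source (of y) with find r LQ y in e | find (r ∘ ρ) LC y in e′
    ... | just x  | _       = cong of (find-sound r LQ e)
    ... | nothing | just x  = cong of (find-sound (r ∘ ρ) LC e′)
    ... | nothing | nothing = refl

    naming : Origin → Naming
    naming fromClause = IC.ν
    naming _          = IQ.ν

    nameOf : Origin × Fresh → Param
    nameOf (o , m) = encode o (Naming.name (naming o) m)

    nameOf-injective : ∀ {s s′} → nameOf s ≡ nameOf s′ → s ≡ s′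
    nameOf-injective {o , m} {o′ , m′} e
      with refl , e′ ← encode-injective {o} {o′} {Naming.name (naming o) m} {Naming.name (naming o′) m′} e =
      cong (o ,_) (Naming.name-injective (naming o) e′)

    ν′ : Naming
    ν′ = record
      { name           = nameOf ∘ source
      ; name-injective = λ {m} {m′} e → trans (sym (unsource-source m))
          (trans (cong unsource (nameOf-injective {source m} {source m′} e)) (unsource-source m′))
      }

    -- The typing of the resolvent, relative to two type substitutions.

    typeFrom : (Param → Ty) → (Param → Ty) → Origin × Var → Ty
    typeFrom ΨQ ΨC (fromQuery  , x) = IQ.u x ⟪ ΨQ ⟫
    typeFrom ΨQ ΨC (fromClause , x) = IC.u x ⟪ ΨC ⟫
    typeFrom ΨQ ΨC (unused     , _) = par 0

    -- The substitutions remain arguments because they are found one after the other, each from a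
    -- typing under provisional ones.
    typing : (Param → Ty) → (Param → Ty) → Var → Ty
    typing ΨQ ΨC y = typeFrom ΨQ ΨC (varOrigin y)

    typing-query : ∀ ΨQ ΨC {x} → x ∈ varsꟴ Q → x ∉ varsᵛ ts → typing ΨQ ΨC (r x) ≡ IQ.u x ⟪ ΨQ ⟫
    typing-query ΨQ ΨC x∈Q x∉ts = cong (typeFrom ΨQ ΨC) (varOrigin-query x∈Q x∉ts)

    typing-clause : ∀ ΨQ ΨC {x} → x ∈ varsᶜ C → x ∉ varsᵛ ws → typing ΨQ ΨC (r (ρ x)) ≡ IC.u x ⟪ ΨC ⟫
    typing-clause ΨQ ΨC x∈C x∉ws = cong (typeFrom ΨQ ΨC) (varOrigin-clause x∈C x∉ws)

    typing-ss : ∀ ΨQ ΨC {x} → x ∈ varsᵛ ss → typing ΨQ ΨC (r x) ≡ IQ.u x ⟪ ΨQ ⟫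
    typing-ss ΨQ ΨC x∈ = typing-query ΨQ ΨC (ss⊆Q x∈) (ss∌ts x∈)

    has-query : ∀ ΨQ ΨC {x} → x ∈ varsꟴ Q → x ∉ varsᵛ ts → Has (typing ΨQ ΨC) (θ x) (IQ.u x ⟪ ΨQ ⟫)
    has-query ΨQ ΨC x∈Q x∉ts = subst (λ t → Has (typing ΨQ ΨC) t _)
      (sym (θ-relevant (relevantQ x∈Q x∉ts))) (≼-reflexive (typing-query ΨQ ΨC x∈Q x∉ts))

    has-clause : ∀ ΨQ ΨC {x} → x ∈ varsᶜ C → x ∉ varsᵛ ws →
                 Has (typing ΨQ ΨC) (θ (ρ x)) (IC.u x ⟪ ΨC ⟫)
    has-clause ΨQ ΨC x∈C x∉ws = subst (λ t → Has (typing ΨQ ΨC) t _)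
      (sym (θ-relevant (relevantC x∈C x∉ws))) (≼-reflexive (typing-clause ΨQ ΨC x∈C x∉ws))

    -- The substitutions obtained from principality may by accident involve
    -- parameters that have to be fresh in the resolvent.
    module Clean {P : Param → Set} (P? : ∀ q → Dec (P q)) (P-used : ¬ P (encode unused 0)) where

      clean : Param → Ty
      clean q with P? q
      ... | yes _ = par (encode unused 0)
      ... | no _  = par q

      clean-id : ∀ {q} → ¬ P q → clean q ≡ par q
      clean-id {q} ¬Pq with P? q
      ... | yes Pq = ⊥-elim (¬Pq Pq)
      ... | no _   = refl

      clean-avoids : ∀ τ {q} → q ∈ pars (τ ⟪ clean ⟫) → ¬ P q
      clean-avoids τ q∈ with s , s∈ , q∈s ← pars-⟪⟫⁻ τ q∈ with P? s
      ... | yes _ with here refl ← q∈s = P-used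
      ... | no ¬Ps with here refl ← q∈s = ¬Ps

    -- Parameters introduced behind the selected atom, which no type visible before may mention.
    Later : Param → Set
    Later q = ∃[ i ] K < toℕ i × q ∈ List.map eQ (IQ.news i)

    InClause : Param → Set
    InClause q = ∃[ b ] q ∈ List.map eC (IC.news b)

    Later? : ∀ q → Dec (Later q)
    Later? q = any? λ i → (K <? toℕ i) ×-dec (q ∈? List.map eQ (IQ.news i))

    InClause? : ∀ q → Dec (InClause q)
    InClause? q = any? λ b → q ∈? List.map eC (IC.news b)

    ¬Later-encode : ∀ o q → o ≢ fromQuery → ¬ Later (encode o q)
    ¬Later-encode o q o≢ (i , _ , q∈) = o≢ (proj₁ (∈-map-encode⁻ {o} {p = q} q∈))

    ¬InClause-encode : ∀ o q → o ≢ fromClause → ¬ InClause (encode o q)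
    ¬InClause-encode o q o≢ (b , q∈) = o≢ (proj₁ (∈-map-encode⁻ {o} {p = q} q∈))

    ¬Later-eQ : ∀ {q} → (∀ i → K ≤ toℕ i → q ∉ IQ.news i) → ¬ Later (eQ q)
    ¬Later-eQ {q} q∉ (i , K<i , q∈) = q∉ i (<⇒≤ K<i) (proj₂ (∈-map-encode⁻ {fromQuery} {fromQuery} {q} q∈))

    insts∌news : ∀ {q} → q ∈ parsᵛ instsₖ → ∀ i → K ≤ toℕ i → q ∉ IQ.news i
    insts∌news q∈ i K≤i q∈i = IQ.news-insts i k K≤i (q∈i , subst (_ ∈_) (sym insts-k) q∈)

    ss∌news : ∀ {x} → x ∈ varsᵛ ss → ∀ {q} → q ∈ pars (IQ.u x) → ∀ i → K ≤ toℕ i → q ∉ IQ.news i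
    ss∌news x∈ q∈ i K≤i q∈i = IQ.news-inputs i k K≤i (ss⊆inputs x∈) (q∈i , q∈)

    insts∌newsₖ : ∀ {q} → q ∈ parsᵛ instsₖ → q ∉ newsₖ
    insts∌newsₖ q∈ q∈k = insts∌news q∈ k ≤-refl (subst (_ ∈_) (sym news-k) q∈k)

    ss∌newsₖ : ∀ {x} → x ∈ varsᵛ ss → ∀ {q} → q ∈ pars (IQ.u x) → q ∉ newsₖ
    ss∌newsₖ x∈ q∈ q∈k = ss∌news x∈ q∈ k ≤-refl (subst (_ ∈_) (sym news-k) q∈k)

    ⟪eQ⟫-id : ∀ τ {a} → (∀ {q} → q ∈ pars τ → a (eQ q) ≡ par (eQ q)) →
              τ ⟪ par ∘ eQ ⟫ ⟪ a ⟫ ≡ τ ⟪ par ∘ eQ ⟫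
    ⟪eQ⟫-id τ a≡ = trans (⟪⟫-∘ τ) (⟪⟫-cong τ a≡)

    -- All that the typing of the head inputs requires of the final `ΨQ`, which is defined only
    -- after it.
    AgreesOnInputs : (Param → Ty) → Set
    AgreesOnInputs ΨQ = ∀ {x} → x ∈ varsᵛ ss → IQ.u x ⟪ ΨQ ⟫ ≡ IQ.u x ⟪ par ∘ eQ ⟫

    -- What the declared parameters of the clause head become: the instance used for the selected
    -- atom, in query copies.
    Ψ₀ : Param → Ty
    Ψ₀ q = IQ.ρ k q ⟪ par ∘ eQ ⟫

    Ψ₀-pars : ∀ {q} → q ∈ parsᵛ (predArgs p) → ∀ {s} → s ∈ pars (IQ.ρ k q) → s ∈ parsᵛ instsₖ
    Ψ₀-pars q∈ s∈ = parsᵛ-⟪⟫⁺ (predArgs p) q∈ s∈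

    insts-pick : ∀ m → pick m (mode p) instsₖ ⟪ par ∘ eQ ⟫ᵛ ≡ pick m (mode p) (predArgs p) ⟪ Ψ₀ ⟫ᵛ
    insts-pick m = trans (cong (_⟪ par ∘ eQ ⟫ᵛ) (pick-⟪⟫ m (mode p) (predArgs p) (IQ.ρ k)))
                         (⟪⟫ᵛ-∘ (pick m (mode p) (predArgs p)))

    -- Instantiating the typing of the clause.

    module HeadInputs where
      -- The head inputs come before the clause body and before the rest of the query, so the new
      -- parameters of both are removed.
      open Clean (λ q → Later? q ⊎-dec InClause? q)
        [ ¬Later-encode unused 0 (λ ()) , ¬InClause-encode unused 0 (λ ()) ]′

      τs : Vec Ty (countMode input (mode p))
      τs = pick input (mode p) (predArgs p)

      opaque
        matched : ∃[ Φ ] (∀ {q} → q ∈ parsᵛ τs → Φ q ≡ Ψ₀ q) ×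
          (∀ {x} → x ∈ varsᵛ ws → Has (typing (par ∘ eQ) par) (θ (ρ x)) (IC.u x ⟪ Φ ⟫))
        -- `par` stands in for `ΨC`, which does not exist yet. Only variables of `ss` occur here,
        -- and their types come from the query.
        matched = principal-match IC.ν 0 ws τs IC.principal₀ IC.input-linear
          (subst₂ (Hasᵛ (typing (par ∘ eQ) par)) (unify-pick input) (insts-pick input)
            (Hasᵛ-subst ss (Hasᵛ-pick input (mode p) typedₖ)
              λ x∈ → has-query (par ∘ eQ) par (ss⊆Q x∈) (ss∌ts x∈)))

      Φ′ : Param → Ty
      Φ′ = proj₁ matched

      Φ : Param → Ty
      Φ q = Φ′ q ⟪ clean ⟫

      eQ-clean : ∀ {q} → (∀ i → K ≤ toℕ i → q ∉ IQ.news i) → clean (eQ q) ≡ par (eQ q)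
      eQ-clean {q} q∉ = clean-id [ ¬Later-eQ q∉ , ¬InClause-encode fromQuery q (λ ()) ]′

      Φ-rigid : ∀ {q} → q ∈ parsᵛ τs → Φ q ≡ Ψ₀ q
      Φ-rigid {q} q∈ = trans (cong (_⟪ clean ⟫) (proj₁ (proj₂ matched) q∈))
        (⟪eQ⟫-id (IQ.ρ k q) λ s∈ → eQ-clean
          (insts∌news (Ψ₀-pars (parsᵛ-pick input (mode p) (predArgs p) q∈) s∈)))

      Φ-avoids : ∀ q {s} → s ∈ pars (Φ q) → ¬ (Later s ⊎ InClause s)
      Φ-avoids q = clean-avoids (Φ′ q)

      has-head : ∀ ΨQ ΨC → AgreesOnInputs ΨQ → ∀ {x} → x ∈ varsᵛ ws →
                 Has (typing ΨQ ΨC) (θ (ρ x)) (IC.u x ⟪ Φ ⟫)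
      has-head ΨQ ΨC agrees {x} x∈ = subst (Has (typing ΨQ ΨC) (θ (ρ x))) (⟪⟫-∘ (IC.u x))
        (Has-⟪⟫ clean (θ (ρ x)) (proj₂ (proj₂ matched) x∈) cleaned)
        where
        cleaned : ∀ {y} → y ∈ vars (θ (ρ x)) → typing ΨQ ΨC y ≡ typing (par ∘ eQ) par y ⟪ clean ⟫
        cleaned y∈ with z , z∈ , refl ← head-input-form x∈ y∈ = begin
          typing ΨQ ΨC (r z)                  ≡⟨ typing-ss ΨQ ΨC z∈ ⟩
          IQ.u z ⟪ ΨQ ⟫                       ≡⟨ agrees z∈ ⟩
          IQ.u z ⟪ par ∘ eQ ⟫                 ≡⟨ ⟪eQ⟫-id (IQ.u z) (eQ-clean ∘ ss∌news z∈) ⟨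
          IQ.u z ⟪ par ∘ eQ ⟫ ⟪ clean ⟫       ≡⟨ cong (_⟪ clean ⟫) (typing-ss (par ∘ eQ) par z∈) ⟨
          typing (par ∘ eQ) par (r z) ⟪ clean ⟫ ∎
          where open ≡-Reasoning

    open HeadInputs using () renaming (Φ to Φ₁; has-head to has-head₁)

    Ψ₁ : Param → Ty
    Ψ₁ = override IC.news₀ Φ₁ (par ∘ eC)

    -- Declared parameters of the head take the instance of the selected atom, those introduced for
    -- the head inputs are moved by `Φ₁`, all others are copied. `fresh-head₀` separates the first
    -- two groups.
    ΨC : Param → Ty
    ΨC = override (parsᵛ (predArgs p)) Ψ₀ Ψ₁

    ΨC-args : ∀ {q} → q ∈ parsᵛ (predArgs p) → ΨC q ≡ Ψ₀ q
    ΨC-args = override-∈ (parsᵛ (predArgs p)) Ψ₀ Ψ₁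

    ΨC-news₀ : ∀ {q} → q ∈ IC.news₀ → ΨC q ≡ Φ₁ q
    ΨC-news₀ q∈ = trans (override-∉ (parsᵛ (predArgs p)) Ψ₀ Ψ₁ λ q∈args → IC.fresh-head₀ (q∈ , q∈args))
      (override-∈ IC.news₀ Φ₁ (par ∘ eC) q∈)

    ΨC-else : ∀ {q} → q ∉ parsᵛ (predArgs p) → q ∉ IC.news₀ → ΨC q ≡ par (eC q)
    ΨC-else q∉args q∉news₀ = trans (override-∉ (parsᵛ (predArgs p)) Ψ₀ Ψ₁ q∉args)
      (override-∉ IC.news₀ Φ₁ (par ∘ eC) q∉news₀)

    ΨC-news : ∀ b {q} → q ∈ IC.news b → ΨC q ≡ par (eC q)
    ΨC-news b q∈ = ΨC-else (λ q∈args → IC.fresh-head b (q∈ , q∈args))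
                           (λ q∈news₀ → IC.news₀-disjoint b (q∈news₀ , q∈))

    data ΨC-Form (q s : Param) : Set where
      instance-par : ∀ t → t ∈ parsᵛ instsₖ → s ≡ eQ t → ΨC-Form q s
      head-par     : ¬ (Later s ⊎ InClause s) → ΨC-Form q s
      clause-par   : s ≡ eC q → ΨC-Form q s

    ΨC-form : ∀ {q s} → s ∈ pars (ΨC q) → ΨC-Form q s
    ΨC-form {q} {s} = override-elim (parsᵛ (predArgs p)) Ψ₀ Ψ₁ (λ τ → s ∈ pars τ → ΨC-Form q s)
      (λ q∈args s∈ → let t , t∈ , s∈t = pars-⟪⟫⁻ (IQ.ρ k q) s∈ in
        instance-par t (Ψ₀-pars q∈args t∈) (∈-par s∈t))
      (λ _ → override-elim IC.news₀ Φ₁ (par ∘ eC) (λ τ → s ∈ pars τ → ΨC-Form q s)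
        (λ _ s∈ → head-par (HeadInputs.Φ-avoids q s∈))
        (λ _ s∈ → clause-par (∈-par s∈)))
      where
      ∈-par : ∀ {s t} → s ∈ pars (par t) → s ≡ t
      ∈-par (here e) = e

    ΨC-not-Later : ∀ {q s} → s ∈ pars (ΨC q) → ¬ Later s
    ΨC-not-Later {q} s∈ later with ΨC-form s∈
    ... | instance-par t t∈ refl = ¬Later-eQ (insts∌news t∈) later
    ... | head-par avoids        = avoids (inj₁ later)
    ... | clause-par refl        = ¬Later-encode fromClause q (λ ()) later

    -- For a head input variable, `typ-pars` confines the type to parameters on which `ΨC` agrees
    -- with `Φ₁`.
    has-clause-var : ∀ ΨQ → AgreesOnInputs ΨQ → ∀ {x} → x ∈ varsᶜ C →
                     Has (typing ΨQ ΨC) (θ (ρ x)) (IC.u x ⟪ ΨC ⟫)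
    has-clause-var ΨQ agrees {x} x∈C with x ∈? varsᵛ ws
    ... | no x∉ws  = has-clause ΨQ ΨC x∈C x∉ws
    ... | yes x∈ws = subst (Has (typing ΨQ ΨC) (θ (ρ x))) (⟪⟫-cong (IC.u x) same)
                       (has-head₁ ΨQ ΨC agrees x∈ws)
      where
      same : ∀ {q} → q ∈ pars (IC.u x) → Φ₁ q ≡ ΨC q
      same q∈ with typ-pars IC.ν 0 ws HeadInputs.τs IC.principal₀ x∈ws q∈
      ... | inj₁ q∈news = sym (ΨC-news₀ q∈news)
      ... | inj₂ q∈τs   = trans (HeadInputs.Φ-rigid q∈τs)
                                (sym (ΨC-args (parsᵛ-pick input (mode p) (predArgs p) q∈τs)))

    -- Instantiating the typing of the query.

    module SelectedOutputs where
      -- The types of the selected outputs are visible only behind the clause body and may involve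
      -- its parameters, so only `Later` is removed.
      open Clean Later? (¬Later-encode unused 0 λ ())

      τs : Vec Ty (countMode output (mode p))
      τs = pick output (mode p) instsₖ

      τs⊆ : ∀ {q} → q ∈ parsᵛ τs → q ∈ parsᵛ instsₖ
      τs⊆ = parsᵛ-pick output (mode p) instsₖ

      private
        out-types : pick output (mode p) (predArgs p) ⟪ ΨC ⟫ᵛ ≡ τs ⟪ par ∘ eQ ⟫ᵛ
        out-types = trans
          (⟪⟫ᵛ-cong (pick output (mode p) (predArgs p)) (ΨC-args ∘ parsᵛ-pick output (mode p) (predArgs p)))
          (sym (insts-pick output))

      opaque
        matched : ∃[ Φ ] (∀ {q} → q ∈ parsᵛ τs → Φ q ≡ par (eQ q)) ×
          (∀ {x} → x ∈ varsᵛ ts → Has (typing (par ∘ eQ) ΨC) (θ x) (IQ.u x ⟪ Φ ⟫))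
        matched = principal-match IQ.ν (suc K) ts τs principalₖ linearₖ
          (subst₂ (Hasᵛ (typing (par ∘ eQ) ΨC)) (sym (unify-pick output)) out-types
            (Hasᵛ-subst vs (Hasᵛ-pick output (mode p) IC.head-typed)
              λ x∈ → has-clause-var (par ∘ eQ) (λ _ → refl) (vs⊆C x∈)))

      Φ′ : Param → Ty
      Φ′ = proj₁ matched

      Φ : Param → Ty
      Φ q = Φ′ q ⟪ clean ⟫

      eQ-clean : ∀ {q} → (∀ i → K ≤ toℕ i → q ∉ IQ.news i) → clean (eQ q) ≡ par (eQ q)
      eQ-clean q∉ = clean-id (¬Later-eQ q∉)

      Φ-rigid : ∀ {q} → q ∈ parsᵛ τs → Φ q ≡ par (eQ q)
      Φ-rigid {q} q∈ = trans (cong (_⟪ clean ⟫) (proj₁ (proj₂ matched) q∈)) (eQ-clean (insts∌news (τs⊆ q∈)))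

      Φ-avoids : ∀ q {s} → s ∈ pars (Φ q) → ¬ Later s
      Φ-avoids q = clean-avoids (Φ′ q)

      has-selected : ∀ ΨQ → AgreesOnInputs ΨQ → ∀ {x} → x ∈ varsᵛ ts →
                     Has (typing ΨQ ΨC) (θ x) (IQ.u x ⟪ Φ ⟫)
      has-selected ΨQ agrees {x} x∈ = subst (Has (typing ΨQ ΨC) (θ x)) (⟪⟫-∘ (IQ.u x))
        (Has-⟪⟫ clean (θ x) (proj₂ (proj₂ matched) x∈) cleaned)
        where
        open ≡-Reasoning
        cleaned : ∀ {y} → y ∈ vars (θ x) → typing ΨQ ΨC y ≡ typing (par ∘ eQ) ΨC y ⟪ clean ⟫
        cleaned y∈ with output-form x∈ y∈
        ... | inj₁ (z , z∈ , refl) = begin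
          typing ΨQ ΨC (r z)                   ≡⟨ typing-ss ΨQ ΨC z∈ ⟩
          IQ.u z ⟪ ΨQ ⟫                        ≡⟨ agrees z∈ ⟩
          IQ.u z ⟪ par ∘ eQ ⟫                  ≡⟨ ⟪eQ⟫-id (IQ.u z) (eQ-clean ∘ ss∌news z∈) ⟨
          IQ.u z ⟪ par ∘ eQ ⟫ ⟪ clean ⟫        ≡⟨ cong (_⟪ clean ⟫) (typing-ss (par ∘ eQ) ΨC z∈) ⟨
          typing (par ∘ eQ) ΨC (r z) ⟪ clean ⟫ ∎
        ... | inj₂ (z , z∈C , z∉ws , refl) = begin
          typing ΨQ ΨC (r (ρ z))                   ≡⟨ typing-clause ΨQ ΨC z∈C z∉ws ⟩
          IC.u z ⟪ ΨC ⟫                            ≡⟨ ⟪⟫-id (IC.u z ⟪ ΨC ⟫) kept ⟨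
          IC.u z ⟪ ΨC ⟫ ⟪ clean ⟫                  ≡⟨ cong (_⟪ clean ⟫) (typing-clause (par ∘ eQ) ΨC z∈C z∉ws) ⟨
          typing (par ∘ eQ) ΨC (r (ρ z)) ⟪ clean ⟫ ∎
          where
          kept : ∀ {s} → s ∈ pars (IC.u z ⟪ ΨC ⟫) → clean s ≡ par s
          kept s∈ with q , _ , s∈q ← pars-⟪⟫⁻ (IC.u z) s∈ = clean-id (ΨC-not-Later s∈q)

    open SelectedOutputs using () renaming (Φ to Φ₂)

    ΨQ : Param → Ty
    ΨQ = override newsₖ Φ₂ (par ∘ eQ)

    ΨQ-newsₖ : ∀ {q} → q ∈ newsₖ → ΨQ q ≡ Φ₂ q
    ΨQ-newsₖ = override-∈ newsₖ Φ₂ (par ∘ eQ)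

    ΨQ-else : ∀ {q} → q ∉ newsₖ → ΨQ q ≡ par (eQ q)
    ΨQ-else = override-∉ newsₖ Φ₂ (par ∘ eQ)

    -- By freshness the types of the selected inputs avoid the parameters introduced for the
    -- selected outputs. This discharges the assumption under which `Φ₁` and `Φ₂` were used.
    ΨQ-agrees : AgreesOnInputs ΨQ
    ΨQ-agrees {x} x∈ = ⟪⟫-cong (IQ.u x) (ΨQ-else ∘ ss∌newsₖ x∈)

    has-query-var : ∀ {x} → x ∈ varsꟴ Q → Has (typing ΨQ ΨC) (θ x) (IQ.u x ⟪ ΨQ ⟫)
    has-query-var {x} x∈Q with x ∈? varsᵛ ts
    ... | no x∉ts  = has-query ΨQ ΨC x∈Q x∉ts
    ... | yes x∈ts = subst (Has (typing ΨQ ΨC) (θ x)) (⟪⟫-cong (IQ.u x) same)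
                       (SelectedOutputs.has-selected ΨQ ΨQ-agrees x∈ts)
      where
      same : ∀ {q} → q ∈ pars (IQ.u x) → Φ₂ q ≡ ΨQ q
      same q∈ with typ-pars IQ.ν (suc K) ts SelectedOutputs.τs principalₖ x∈ts q∈
      ... | inj₁ q∈news = sym (ΨQ-newsₖ q∈news)
      ... | inj₂ q∈τs   = trans (SelectedOutputs.Φ-rigid q∈τs)
                                (sym (ΨQ-else (insts∌newsₖ (SelectedOutputs.τs⊆ q∈τs))))

    -- The atoms of the resolvent, their parents and their order.

    -- An atom of the resolvent is addressed by its parent atom, so that query and body atoms share
    -- the same lemmas; `Unselected` excludes index `K`.
    Source : Set
    Source = Fin (length Q) ⊎ Fin n

    originOf : Source → Origin
    originOf (inj₁ j) = fromQuery
    originOf (inj₂ b) = fromClause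

    indexOf : Source → ℕ
    indexOf = [ toℕ , toℕ ]′

    oldAtom : Source → Atom
    oldAtom (inj₁ j) = IQ.A j
    oldAtom (inj₂ b) = IC.A b

    θOf : Source → Var → Term
    θOf (inj₁ j) = θ
    θOf (inj₂ b) = θ ∘ ρ

    rOf : Source → Var → Var
    rOf (inj₁ j) = r
    rOf (inj₂ b) = r ∘ ρ

    ΨOf : Source → Param → Ty
    ΨOf (inj₁ j) = ΨQ
    ΨOf (inj₂ b) = ΨC

    ρOf : Source → Param → Ty
    ρOf (inj₁ j) = IQ.ρ j
    ρOf (inj₂ b) = IC.ρ b

    UOf : Source → VarTyping
    UOf (inj₁ j) = IQ.U
    UOf (inj₂ b) = IC.U

    newAtom : Source → Atom
    newAtom s = oldAtom s ⟦ θOf s ⟧ᵃ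

    oldInsts newInsts : ∀ s → Vec Ty (predArity (pred (oldAtom s)))
    oldInsts s = predArgs (pred (oldAtom s)) ⟪ ρOf s ⟫ᵛ
    newInsts s = oldInsts s ⟪ ΨOf s ⟫ᵛ

    oldNews newNews : Source → List Param
    oldNews s = introduced (naming (originOf s)) (suc (indexOf s)) (outputs (oldAtom s))
    newNews s = List.map (encode (originOf s)) (oldNews s)

    Unselected : Source → Set
    Unselected (inj₁ j) = toℕ j ≢ K
    Unselected (inj₂ b) = ⊤

    data Position (i : ℕ) : Source → Set where
      before : ∀ {j} → toℕ j < K → i ≡ toℕ j → Position i (inj₁ j)
      within : ∀ {b} → i ≡ K + toℕ b → Position i (inj₂ b)
      after  : ∀ {j} → K < toℕ j → suc i ≡ n + toℕ j → Position i (inj₁ j)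

    Precedes : Source → Source → Set
    Precedes (inj₁ j) (inj₁ j′) = toℕ j ≤ toℕ j′
    Precedes (inj₁ j) (inj₂ _)  = toℕ j < K
    Precedes (inj₂ _) (inj₁ j′) = K < toℕ j′
    Precedes (inj₂ b) (inj₂ b′) = toℕ b ≤ toℕ b′

    unselected : ∀ {i s} → Position i s → Unselected s
    unselected (before j<K _) e = <-irrefl e j<K
    unselected (within _)          = tt
    unselected (after K<j _)  e = <-irrefl (sym e) K<j

    position-origin : ∀ {i s} → Position i s → atomOrigin i ≡ (originOf s , indexOf s)
    position-origin (before j<K refl)     = origin-before j<K
    position-origin (within {b} refl)     = origin-within (toℕ<n b)
    position-origin (after {j} K<j i≡n+j) = origin-after K<j i≡n+j

    after-last : ∀ {i m j} → K < j → suc i ≡ n + j → m < K + n → m < i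
    after-last {i} {m} {suc j} (s≤s K≤j) e m< with refl ← suc-injective (trans e (+-suc n j)) =
      <-≤-trans m< (subst (K + n ≤_) (+-comm j n) (+-monoˡ-≤ n K≤j))

    precedes : ∀ {i i′ s s′} → Position i s → Position i′ s′ → i ≤ i′ → Precedes s s′
    precedes (before _ refl)   (before _ refl)  i≤i′ = i≤i′
    precedes (before j<K _)    (within _)       i≤i′ = j<K
    precedes (before j<K _)    (after K<j′ _)   i≤i′ = <⇒≤ (<-trans j<K K<j′)
    precedes (within refl)     (before j<K refl) i≤i′ =
      ⊥-elim (<-irrefl refl (<-≤-trans j<K (≤-trans (m≤m+n K _) i≤i′)))
    precedes (within refl)     (within refl)    i≤i′ = +-cancelˡ-≤ K _ _ i≤i′
    precedes (within _)        (after K<j′ _)   i≤i′ = K<j′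
    precedes (after K<j e)     (before j<K refl) i≤i′ =
      ⊥-elim (<-irrefl refl (<-≤-trans (after-last K<j e (<-≤-trans j<K (m≤m+n K n))) i≤i′))
    precedes (after K<j e)     (within {b} refl) i≤i′ =
      ⊥-elim (<-irrefl refl (<-≤-trans (after-last K<j e (+-monoʳ-< K (toℕ<n b))) i≤i′))
    precedes (after _ e)       (after _ e′)     i≤i′ =
      +-cancelˡ-≤ n _ _ (subst₂ _≤_ e e′ (s≤s i≤i′))

    position-injective : ∀ {i i′ s s′} → Position i s → Position i′ s′ →
                         originOf s ≡ originOf s′ → indexOf s ≡ indexOf s′ → i ≡ i′
    position-injective {i} {i′} pos pos′ o≡ m≡ = begin
      i                                                          ≡⟨ atomPosition-origin i ⟨
      atomPosition (proj₁ (atomOrigin i)) (proj₂ (atomOrigin i)) ≡⟨ cong position same ⟩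
      atomPosition (proj₁ (atomOrigin i′)) (proj₂ (atomOrigin i′)) ≡⟨ atomPosition-origin i′ ⟩
      i′                                                         ∎
      where
      open ≡-Reasoning
      position : Origin × ℕ → ℕ
      position (o , m) = atomPosition o m
      same : atomOrigin i ≡ atomOrigin i′
      same = trans (position-origin pos) (trans (cong₂ _,_ o≡ m≡) (sym (position-origin pos′)))

    resolvent : Query
    resolvent = replace Q k (B ⟦ var ∘ ρ ⟧ꟴ) ⟦ θ ⟧ꟴ

    view : ∀ i → ∃[ s ] Position (toℕ i) s × List.lookup resolvent i ≡ newAtom s
    view i with i₁ , i≡ , e ← lookup-map⁻ (_⟦ θ ⟧ᵃ) (replace Q k (B ⟦ var ∘ ρ ⟧ꟴ)) i
      with lookup-replace⁻ Q k (B ⟦ var ∘ ρ ⟧ꟴ) i₁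
    ... | inj₁ (j , j<K , i₁≡ , e₁) =
      inj₁ j , before j<K (trans i≡ i₁≡) , trans e (cong (_⟦ θ ⟧ᵃ) e₁)
    ... | inj₂ (inj₂ (j , K<j , i₁≡ , e₁)) =
      inj₁ j , after K<j (trans (cong suc i≡) (trans i₁≡ (cong (_+ toℕ j) (length-map _ B)))) ,
      trans e (cong (_⟦ θ ⟧ᵃ) e₁)
    ... | inj₂ (inj₁ (b₁ , i₁≡ , e₁)) with b , b₁≡ , e₂ ← lookup-map⁻ (_⟦ var ∘ ρ ⟧ᵃ) B b₁ =
      inj₂ b , within (trans i≡ (trans i₁≡ (cong (K +_) b₁≡))) ,
      trans e (trans (cong (_⟦ θ ⟧ᵃ) (trans e₁ e₂)) (cong (atom _) (⟦⟧ᵛ-∘ (args (IC.A b)))))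

    output-unselected : ∀ j {x} → toℕ j ≢ K → x ∈ varsᵛ (outputs (IQ.A j)) → x ∉ varsᵛ ts
    output-unselected j j≢K x∈j x∈ts = IQ.outputs-disjoint j k j≢K (x∈j , ts⊆outputs x∈ts)

    output-body : ∀ b {x} → x ∈ varsᵛ (outputs (IC.A b)) → x ∉ varsᵛ ws
    output-body b x∈b x∈ws = IC.head-disjoint (x∈ws , ∈-concatMap-lookup (λ A → varsᵛ (outputs A)) B b x∈b)

    θOf-output : ∀ s → Unselected s → ∀ {x} → x ∈ varsᵛ (outputs (oldAtom s)) → θOf s x ≡ var (rOf s x)
    θOf-output (inj₁ j) j≢K x∈ = θ-relevant (relevantQ (IQ.output-vars j x∈) (output-unselected j j≢K x∈))
    θOf-output (inj₂ b) _   x∈ = θ-relevant (relevantC (B⊆C (IC.output-vars b x∈)) (output-body b x∈))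

    varOrigin-output : ∀ s → Unselected s → ∀ {x} → x ∈ varsᵛ (outputs (oldAtom s)) →
                       varOrigin (rOf s x) ≡ (originOf s , x)
    varOrigin-output (inj₁ j) j≢K x∈ = varOrigin-query (IQ.output-vars j x∈) (output-unselected j j≢K x∈)
    varOrigin-output (inj₂ b) _   x∈ = varOrigin-clause (B⊆C (IC.output-vars b x∈)) (output-body b x∈)

    typing-output : ∀ s → Unselected s → ∀ {x} → x ∈ varsᵛ (outputs (oldAtom s)) →
                    typing ΨQ ΨC (rOf s x) ≡ typ (UOf s) x ⟪ ΨOf s ⟫
    typing-output s@(inj₁ _) un x∈ = cong (typeFrom ΨQ ΨC) (varOrigin-output s un x∈)
    typing-output s@(inj₂ _) un x∈ = cong (typeFrom ΨQ ΨC) (varOrigin-output s un x∈)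

    outputs-new : ∀ s → Unselected s → outputs (newAtom s) ≡ outputs (oldAtom s) ⟦ var ∘ rOf s ⟧ᵛ
    outputs-new s un = trans (pick-⟦⟧ output (mode (pred (oldAtom s))) (args (oldAtom s)) (θOf s))
      (⟦⟧ᵛ-cong (outputs (oldAtom s)) (θOf-output s un))

    outputs-form : ∀ s → Unselected s → ∀ {y} → y ∈ varsᵛ (outputs (newAtom s)) →
                   ∃[ x ] x ∈ varsᵛ (outputs (oldAtom s)) × varOrigin y ≡ (originOf s , x)
    outputs-form s un y∈
      with x , x∈ , refl ← ∈-map⁻ (rOf s) (subst (_ ∈_)
             (trans (cong varsᵛ (outputs-new s un)) (varsᵛ-rename (outputs (oldAtom s)) (rOf s))) y∈) =
      x , x∈ , varOrigin-output s un x∈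

    outputs-new-unique : ∀ s → Unselected s → Unique (varsᵛ (outputs (newAtom s)))
    outputs-new-unique s un = subst Unique
      (sym (trans (cong varsᵛ (outputs-new s un)) (varsᵛ-rename (outputs (oldAtom s)) (rOf s))))
      (unique-map (rOf s)
        (λ x∈ y∈ e → cong proj₂ (trans (sym (varOrigin-output s un x∈))
          (trans (cong varOrigin e) (varOrigin-output s un y∈))))
        (old-unique s))
      where
      old-unique : ∀ s → Linear (outputs (oldAtom s))
      old-unique (inj₁ j) = IQ.outputs-unique j
      old-unique (inj₂ b) = IC.outputs-unique b

    outputs-new-disjoint : ∀ {i i′ s s′} → Position i s → Position i′ s′ → i ≢ i′ →
                           Disjoint (varsᵛ (outputs (newAtom s))) (varsᵛ (outputs (newAtom s′)))
    outputs-new-disjoint {s = s} {s′} pos pos′ i≢i′ (y∈ , y∈′)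
      with outputs-form s (unselected pos) y∈ | outputs-form s′ (unselected pos′) y∈′
    ... | x , x∈ , e | x′ , x′∈ , e′ = apart s s′ pos pos′ x∈ x′∈ (trans (sym e) e′)
      where
      apart : ∀ s s′ → Position _ s → Position _ s′ → ∀ {x x′} →
              x ∈ varsᵛ (outputs (oldAtom s)) → x′ ∈ varsᵛ (outputs (oldAtom s′)) →
              (originOf s , x) ≢ (originOf s′ , x′)
      apart (inj₁ j) (inj₁ j′) pos pos′ x∈ x∈′ refl =
        IQ.outputs-disjoint j j′ (i≢i′ ∘ position-injective pos pos′ refl) (x∈ , x∈′)
      apart (inj₂ b) (inj₂ b′) pos pos′ x∈ x∈′ refl =
        IC.outputs-disjoint b b′ (i≢i′ ∘ position-injective pos pos′ refl) (x∈ , x∈′)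

    -- How far back in the query the inputs seen up to `s` may reach. A body atom can inherit inputs
    -- of the selected atom itself, hence `K` is included.
    QueryBound : Source → Fin (length Q) → Set
    QueryBound (inj₁ j′) j = toℕ j ≤ toℕ j′
    QueryBound (inj₂ _)  j = toℕ j ≤ K

    ClauseBound : Source → Var → Set
    ClauseBound (inj₁ j′) x = K < toℕ j′
    ClauseBound (inj₂ b′) x = ∃[ b ] toℕ b ≤ toℕ b′ × x ∈ varsᵛ (inputs (IC.A b))

    -- Where a variable y of the inputs up to the new atom s comes from.
    data Consumed (s : Source) (y : Var) : Set where
      of-query  : ∀ j {x} → QueryBound s j → x ∈ varsᵛ (inputs (IQ.A j)) → x ∉ varsᵛ ts →
                  y ≡ r x → Consumed s y
      of-clause : ∀ {x} → ClauseBound s x → x ∈ varsᶜ C → x ∉ varsᵛ ws → y ≡ r (ρ x) → Consumed s y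

    precedes-selected : ∀ {j} s → Precedes (inj₁ j) s → QueryBound s j
    precedes-selected (inj₁ _) j≤ = j≤
    precedes-selected (inj₂ _) j< = <⇒≤ j<

    selected-bound : ∀ {j} s → K < toℕ j → Precedes (inj₁ j) s → QueryBound s k × ∀ {x} → ClauseBound s x
    selected-bound (inj₁ _) K<j j≤ = <⇒≤ (<-≤-trans K<j j≤) , <-≤-trans K<j j≤
    selected-bound (inj₂ _) K<j j< = ⊥-elim (<-asym K<j j<)

    -- The mgu expands a head input into input variables of the selected atom, and a selected output
    -- into such variables or surviving clause variables. All other variables are renamed.
    consumed : ∀ s s′ → Precedes s s′ → ∀ {y} → y ∈ varsᵛ (inputs (newAtom s)) → Consumed s′ y
    consumed s s′ pre y∈
      with x , x∈ , y∈x ← varsᵛ-⟦⟧⁻ (inputs (oldAtom s)) (subst (λ us → _ ∈ varsᵛ us)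
             (pick-⟦⟧ input (mode (pred (oldAtom s))) (args (oldAtom s)) (θOf s)) y∈) =
      from s pre x∈ y∈x
      where
      from : ∀ s → Precedes s s′ → ∀ {x y} → x ∈ varsᵛ (inputs (oldAtom s)) → y ∈ vars (θOf s x) →
             Consumed s′ y
      from (inj₁ j) pre {x} x∈ y∈ with x ∈? varsᵛ ts
      ... | no x∉ts with here e ← subst (λ t → _ ∈ vars t) (θ-relevant (relevantQ (IQ.input-vars j x∈) x∉ts)) y∈ =
        of-query j (precedes-selected s′ pre) x∈ x∉ts e
      -- `producer-first` puts a consumer of a selected output strictly behind the selected atom, so
      -- what it receives in exchange respects the bounds.
      ... | yes x∈ts with bounds ← selected-bound s′ (≰⇒> λ j≤K →
                            IQ.producer-first j k j≤K (x∈ , ts⊆outputs x∈ts)) pre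
        with output-form x∈ts y∈
      ...   | inj₁ (z , z∈ , e) = of-query k (proj₁ bounds) (ss⊆inputs z∈) (ss∌ts z∈) e
      ...   | inj₂ (z , z∈C , z∉ws , e) = of-clause (proj₂ bounds) z∈C z∉ws e
      from (inj₂ b) pre {x} x∈ y∈ with x ∈? varsᵛ ws
      ... | yes x∈ws with z , z∈ , e ← head-input-form x∈ws y∈ =
        of-query k (bound s′ pre) (ss⊆inputs z∈) (ss∌ts z∈) e
        where
        bound : ∀ s′ → Precedes (inj₂ b) s′ → QueryBound s′ k
        bound (inj₁ _) K<j′ = <⇒≤ K<j′
        bound (inj₂ _) _    = ≤-refl
      ... | no x∉ws with x∈C ← B⊆C (IC.input-vars b x∈)
        with here e ← subst (λ t → _ ∈ vars t) (θ-relevant (relevantC x∈C x∉ws)) y∈ =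
        of-clause (bound s′ pre) x∈C x∉ws e
        where
        bound : ∀ s′ → Precedes (inj₂ b) s′ → ClauseBound s′ x
        bound (inj₁ _) K<j′ = K<j′
        bound (inj₂ _) b≤b′ = b , b≤b′ , x∈

    -- `varOrigin` separates query variables from clause variables; for equal origins this is
    -- `producer-first` of the parent.
    consumed-not-produced : ∀ s → Unselected s → ∀ {y} → Consumed s y → y ∉ varsᵛ (outputs (newAtom s))
    consumed-not-produced s un (of-query j bound x∈ x∉ts refl) y∈
      with x′ , x′∈ , e ← outputs-form s un y∈ =
      apart s bound x′∈ (trans (sym (varOrigin-query (IQ.input-vars j x∈) x∉ts)) e)
      where
      apart : ∀ s → QueryBound s j → ∀ {x′} → x′ ∈ varsᵛ (outputs (oldAtom s)) →
              (fromQuery , _) ≢ (originOf s , x′)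
      apart (inj₁ j′) j≤j′ x′∈ refl = IQ.producer-first j j′ j≤j′ (x∈ , x′∈)
    consumed-not-produced s un (of-clause bound x∈C x∉ws refl) y∈
      with x′ , x′∈ , e ← outputs-form s un y∈ =
      apart s bound x′∈ (trans (sym (varOrigin-clause x∈C x∉ws)) e)
      where
      apart : ∀ s → ClauseBound s _ → ∀ {x′} → x′ ∈ varsᵛ (outputs (oldAtom s)) →
              (fromClause , _) ≢ (originOf s , x′)
      apart (inj₂ b′) (b , b≤b′ , x∈) x′∈ refl = IC.producer-first b b′ b≤b′ (x∈ , x′∈)

    -- Freshness in the resolvent.

    newsₖ-insts : ∀ j → toℕ j ≤ K → ∀ {q} → q ∈ parsᵛ (IQ.insts j) → q ∉ newsₖ
    newsₖ-insts j j≤K q∈ q∈k = IQ.news-insts k j j≤K (subst (_ ∈_) (sym news-k) q∈k , q∈)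

    newsₖ-inputs : ∀ j → toℕ j ≤ K → ∀ {x} → x ∈ varsᵛ (inputs (IQ.A j)) →
                   ∀ {q} → q ∈ pars (IQ.u x) → q ∉ newsₖ
    newsₖ-inputs j j≤K x∈ q∈ q∈k = IQ.news-inputs k j j≤K x∈ (subst (_ ∈_) (sym news-k) q∈k , q∈)

    -- If `Φ₂` moves `q`, the hypotheses put `j` behind the selected atom, and `Φ₂` was cleaned of
    -- the parameters introduced there. Otherwise `q` is merely copied.
    ΨQ-avoids-query : ∀ j → toℕ j ≢ K → ∀ {q s} → q ∉ IQ.news j → (toℕ j < K → q ∉ newsₖ) →
                      s ∈ pars (ΨQ q) → s ∉ newNews (inj₁ j)
    ΨQ-avoids-query j j≢K {q} {s} q∉j q∉k =
      override-elim newsₖ Φ₂ (par ∘ eQ) (λ τ → s ∈ pars τ → s ∉ newNews (inj₁ j))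
        (λ q∈k s∈ s∈j → SelectedOutputs.Φ-avoids q s∈
          (j , ≤∧≢⇒< (≮⇒≥ λ j<K → q∉k j<K q∈k) (j≢K ∘ sym) , s∈j))
        (λ { _ (here refl) s∈j → q∉j (proj₂ (∈-map-encode⁻ {fromQuery} {fromQuery} {q} s∈j)) })

    ΨQ-avoids-clause : ∀ b {q s} → q ∉ newsₖ → s ∈ pars (ΨQ q) → s ∉ newNews (inj₂ b)
    ΨQ-avoids-clause b {q} {s} q∉k s∈ s∈b
      with here refl ← subst (λ τ → s ∈ pars τ) (ΨQ-else q∉k) s∈
      with () ← proj₁ (∈-map-encode⁻ {fromQuery} {fromClause} {q} s∈b)

    ΨC-avoids-clause : ∀ b {q s} → q ∉ IC.news b → s ∈ pars (ΨC q) → s ∉ newNews (inj₂ b)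
    ΨC-avoids-clause b {q} q∉b s∈ s∈b with ΨC-form s∈
    ... | head-par avoids = avoids (inj₂ (b , s∈b))
    ... | clause-par refl = q∉b (proj₂ (∈-map-encode⁻ {fromClause} {fromClause} {q} s∈b))
    ... | instance-par t _ refl with () ← proj₁ (∈-map-encode⁻ {fromQuery} {fromClause} {t} s∈b)

    ΨC-avoids-query : ∀ j → K < toℕ j → ∀ {q s} → s ∈ pars (ΨC q) → s ∉ newNews (inj₁ j)
    ΨC-avoids-query j K<j s∈ s∈j = ΨC-not-Later s∈ (j , K<j , s∈j)

    -- Freshness in a parent passes to copied parameters, copies of different origins are disjoint,
    -- and the values of `Φ₁` and `Φ₂` were cleaned of what is introduced later.
    fresh-insts : ∀ s s′ → Unselected s′ → Precedes s s′ → Disjoint (newNews s′) (parsᵛ (newInsts s))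
    fresh-insts (inj₁ j) (inj₁ j′) j′≢K j≤j′ (q∈ , q∈′)
      with t , t∈ , q∈t ← parsᵛ-⟪⟫⁻ (IQ.insts j) q∈′ =
      ΨQ-avoids-query j′ j′≢K (λ t∈news → IQ.news-insts j′ j j≤j′ (t∈news , t∈))
        (λ j′<K → newsₖ-insts j (≤-trans j≤j′ (<⇒≤ j′<K)) t∈) q∈t q∈
    fresh-insts (inj₁ j) (inj₂ b′) _ j<K (q∈ , q∈′)
      with t , t∈ , q∈t ← parsᵛ-⟪⟫⁻ (IQ.insts j) q∈′ =
      ΨQ-avoids-clause b′ (newsₖ-insts j (<⇒≤ j<K) t∈) q∈t q∈
    fresh-insts (inj₂ b) (inj₁ j′) _ K<j′ (q∈ , q∈′)
      with t , t∈ , q∈t ← parsᵛ-⟪⟫⁻ (IC.insts b) q∈′ = ΨC-avoids-query j′ K<j′ q∈t q∈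
    fresh-insts (inj₂ b) (inj₂ b′) _ b≤b′ (q∈ , q∈′)
      with t , t∈ , q∈t ← parsᵛ-⟪⟫⁻ (IC.insts b) q∈′ =
      ΨC-avoids-clause b′ (λ t∈news → IC.news-insts b′ b b≤b′ (t∈news , t∈)) q∈t q∈

    fresh-typing : ∀ s → Unselected s → ∀ {y} → Consumed s y →
                   Disjoint (newNews s) (pars (typing ΨQ ΨC y))
    fresh-typing s un (of-query j {x} bound x∈ x∉ts refl) (q∈ , q∈′)
      with t , t∈ , q∈t ← pars-⟪⟫⁻ (IQ.u x) (subst (λ τ → _ ∈ pars τ)
             (typing-query ΨQ ΨC (IQ.input-vars j x∈) x∉ts) q∈′) = avoid s un bound q∈
      where
      avoid : ∀ s → Unselected s → QueryBound s j → _ ∉ newNews s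
      avoid (inj₁ j′) j′≢K j≤j′ = ΨQ-avoids-query j′ j′≢K
        (λ t∈news → IQ.news-inputs j′ j j≤j′ x∈ (t∈news , t∈))
        (λ j′<K → newsₖ-inputs j (≤-trans j≤j′ (<⇒≤ j′<K)) x∈ t∈) q∈t
      avoid (inj₂ b′) _ j≤K = ΨQ-avoids-clause b′ (newsₖ-inputs j j≤K x∈ t∈) q∈t
    fresh-typing s un (of-clause {x} bound x∈C x∉ws refl) (q∈ , q∈′)
      with t , t∈ , q∈t ← pars-⟪⟫⁻ (IC.u x) (subst (λ τ → _ ∈ pars τ)
             (typing-clause ΨQ ΨC x∈C x∉ws) q∈′) = avoid s bound q∈
      where
      avoid : ∀ s → ClauseBound s x → _ ∉ newNews s
      avoid (inj₁ j′) K<j′ = ΨC-avoids-query j′ K<j′ q∈t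
      avoid (inj₂ b′) (b , b≤b′ , x∈) = ΨC-avoids-clause b′
        (λ t∈news → IC.news-inputs b′ b b≤b′ x∈ (t∈news , t∈)) q∈t

    -- Assembling the nicely typed resolvent.

    resolventVars : List Var
    resolventVars = varsꟴ resolvent

    u′ : Var → Ty
    u′ = typing ΨQ ΨC

    U′ : VarTyping
    U′ = record
      { typeOf = override resolventVars (just ∘ u′) (λ _ → nothing)
      ; finite = strictBound resolventVars , λ x b≤x →
          override-∉ resolventVars (just ∘ u′) (λ _ → nothing) (strictBound≤⇒∉ b≤x)
      }

    U′-just : ∀ {x} → x ∈ resolventVars → typeOf U′ x ≡ just (u′ x)
    U′-just = override-∈ resolventVars (just ∘ u′) (λ _ → nothing)

    U′-typing : ∀ {x τ} → typeOf U′ x ≡ just τ → τ ≡ u′ x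
    U′-typing {x} {τ} = override-elim resolventVars (just ∘ u′) (λ _ → nothing)
      (λ m → m ≡ just τ → τ ≡ u′ x) (λ { _ refl → refl }) (λ _ ())

    -- These facts depend on the same derivation and are bundled so that they are transported
    -- together along the equation between an atom of the resolvent and its `newAtom`.
    record TypedAtom (i : ℕ) (A : Atom) (news insts : List Param) : Set where
      field
        atomTyping : U′ ⊢ A :Atom
        news≡      : introduced ν′ (suc i) (outputs A) ≡ news
        insts≡     : parsᵛ (instArgs atomTyping) ≡ insts
        isPrincipal : PrincipalFor ν′ (suc i) (outputs A)
                        (pick output (mode (pred A)) (instArgs atomTyping)) U′

    module _ (i : ℕ) (s : Source) (un : Unselected s) (from : atomOrigin i ≡ (originOf s , indexOf s))
             (vars⊆ : varsᵃ (newAtom s) ⊆ resolventVars) where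
      private
        A = oldAtom s
        e = encode (originOf s)
        old = naming (originOf s)

        ρ′ : Param → Ty
        ρ′ q = ρOf s q ⟪ ΨOf s ⟫

        newInsts≡ : newInsts s ≡ predArgs (pred A) ⟪ ρ′ ⟫ᵛ
        newInsts≡ = ⟪⟫ᵛ-∘ (predArgs (pred A))

        old-principal : ∀ s → PrincipalFor (naming (originOf s)) (suc (indexOf s)) (outputs (oldAtom s))
                                (pick output (mode (pred (oldAtom s))) (oldInsts s)) (UOf s)
        old-principal (inj₁ j) = IQ.body-principal j
        old-principal (inj₂ b) = IC.body-principal b

        old-linear : ∀ s → Linear (outputs (oldAtom s))
        old-linear (inj₁ j) = IQ.outputs-unique j
        old-linear (inj₂ b) = IC.outputs-unique b

        typed : ∀ s → Hasᵛ u′ (args (newAtom s)) (newInsts s)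
        typed (inj₁ j) = Hasᵛ-subst (args (IQ.A j)) (IQ.body-typed j) (has-query-var ∘ IQ.body-vars j)
        typed (inj₂ b) = Hasᵛ-subst (args (IC.A b)) (IC.body-typed b)
          (has-clause-var ΨQ ΨQ-agrees ∘ B⊆C ∘ IC.body-vars b)

        Ψ-news : ∀ s → Unselected s → ∀ {q} → q ∈ oldNews s → ΨOf s q ≡ par (encode (originOf s) q)
        Ψ-news (inj₁ j) j≢K q∈ = ΨQ-else λ q∈k → IQ.news-disjoint j k j≢K (q∈ , subst (_ ∈_) (sym news-k) q∈k)
        Ψ-news (inj₂ b) _   q∈ = ΨC-news b q∈

        name-at : ∀ ζ q → nameOf (source (at (suc i ∷ ζ) q)) ≡
                          e (Naming.name old (at (suc (indexOf s) ∷ ζ) q))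
        name-at ζ q = cong (λ (o , m) → nameOf (o , at (suc m ∷ ζ) q)) from

        name-of : ∀ {x} → x ∈ varsᵛ (outputs A) →
                  nameOf (source (of (rOf s x))) ≡ e (Naming.name old (of x))
        name-of x∈ = cong (λ (o , x) → nameOf (o , of x)) (varOrigin-output s un x∈)

        derived = atom-derivation {U′} (newAtom s) ρ′ (U′-just ∘ vars⊆)
                    (subst (Hasᵛ u′ (args (newAtom s))) newInsts≡ (typed s))

        instArgs≡ : instArgs (proj₁ derived) ≡ newInsts s
        instArgs≡ = trans (proj₂ derived) (sym newInsts≡)

        new-principal : PrincipalFor ν′ (suc i) (outputs A ⟦ var ∘ rOf s ⟧ᵛ)
                          (pick output (mode (pred A)) (oldInsts s) ⟪ ΨOf s ⟫ᵛ) U′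
        new-principal = principal-transfer old ν′ (suc (indexOf s)) (suc i)
          {d = decode} (decode-encode (originOf s)) (outputs A) (pick output (mode (pred A)) (oldInsts s))
          (old-principal s) (old-linear s) name-at name-of (Ψ-news s un)
          -- Freshness of a system for its own bounds is the case of two equal sources.
          (λ (q∈ , q∈′) → fresh-insts s s un (reflexive s) (q∈ , parsᵛ-pick output (mode (pred A)) (newInsts s)
            (subst (λ τs → _ ∈ parsᵛ τs) (sym (pick-⟪⟫ output (mode (pred A)) (oldInsts s) (ΨOf s))) q∈′)))
          (λ {x} x∈ → trans (U′-just (vars⊆ (varsᵛ-pick output (mode (pred A)) (args (newAtom s))
            (subst (rOf s x ∈_) (sym (trans (cong varsᵛ (outputs-new s un)) (varsᵛ-rename (outputs A) (rOf s))))
              (∈-map⁺ (rOf s) x∈)))))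
            (cong just (typing-output s un x∈)))
          where
          reflexive : ∀ s → Precedes s s
          reflexive (inj₁ _) = ≤-refl
          reflexive (inj₂ _) = ≤-refl

      typedAtom : TypedAtom i (newAtom s) (newNews s) (parsᵛ (newInsts s))
      typedAtom = record
        { atomTyping  = proj₁ derived
        ; news≡       = trans (cong (introduced ν′ (suc i)) (outputs-new s un))
            (Renaming.newᵛ-rename old ν′ (suc (indexOf s)) (suc i) e (rOf s) name-at [] 0 (outputs A) name-of)
        ; insts≡      = cong parsᵛ instArgs≡
        ; isPrincipal = subst₂ (λ us τs → PrincipalFor ν′ (suc i) us τs U′)
            (sym (outputs-new s un))
            (sym (trans (cong (pick output (mode (pred A))) instArgs≡)
                        (pick-⟪⟫ output (mode (pred A)) (oldInsts s) (ΨOf s))))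
            new-principal
        }

    module At (i : Fin (length resolvent)) where
      from : Source
      from = proj₁ (view i)

      position : Position (toℕ i) from
      position = proj₁ (proj₂ (view i))

      atom≡ : List.lookup resolvent i ≡ newAtom from
      atom≡ = proj₂ (proj₂ (view i))

      un : Unselected from
      un = unselected position

      opaque
        typedHere : TypedAtom (toℕ i) (List.lookup resolvent i) (newNews from) (parsᵛ (newInsts from))
        typedHere = subst (λ A → TypedAtom (toℕ i) A (newNews from) (parsᵛ (newInsts from))) (sym atom≡)
          (typedAtom (toℕ i) from un (position-origin position)
            (λ {x} x∈ → ∈-concatMap-lookup varsᵃ resolvent i (subst (λ A → x ∈ varsᵃ A) (sym atom≡) x∈)))

      open TypedAtom typedHere public

      inputs⊆ : ∀ {x} → x ∈ varsᵛ (inputs (List.lookup resolvent i)) → x ∈ varsᵛ (inputs (newAtom from))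
      inputs⊆ {x} = subst (λ A → x ∈ varsᵛ (inputs A)) atom≡

      outputs⊆ : ∀ {x} → x ∈ varsᵛ (outputs (List.lookup resolvent i)) → x ∈ varsᵛ (outputs (newAtom from))
      outputs⊆ {x} = subst (λ A → x ∈ varsᵛ (outputs A)) atom≡

    nicelyModed′ : NicelyModedQuery resolvent
    nicelyModed′ = record
      { outputs-linear = unique-concatMap (λ A → varsᵛ (outputs A)) resolvent
          (λ i → subst (λ A → Unique (varsᵛ (outputs A))) (sym (At.atom≡ i))
            (outputs-new-unique (At.from i) (At.un i)))
          (λ i j i≢j (y∈ , y∈′) → outputs-new-disjoint (At.position i) (At.position j)
            (i≢j ∘ toℕ-injective) (At.outputs⊆ i y∈ , At.outputs⊆ j y∈′))
      ; producer-first = λ i j i≤j (y∈ , y∈′) → consumed-not-produced (At.from j) (At.un j)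
          (consumed (At.from i) (At.from j) (precedes (At.position i) (At.position j) i≤j) (At.inputs⊆ i y∈))
          (At.outputs⊆ j y∈′)
      }

    nicelyTyped′ : NicelyTypedQuery resolvent
    nicelyTyped′ = record
      { nicelyModed  = record
          { body-nicelyModed = nicelyModed′
          ; head-disjoint    = λ (x∈ , _) → no-inputs (mode go) x∈
          }
      ; input-linear = subst Unique (sym (no-vars (mode go))) []
      ; U            = U′
      ; derivation   = record
          { query    = At.atomTyping
          ; headatom = record { σs = [] ; typed = λ () ; below = λ () }
          }
      ; ν            = ν′
      ; fresh-head₀  = λ { (_ , ()) }
      ; fresh-head   = λ { _ (_ , ()) }
      ; fresh-inst   = λ i j j≤i → subst₂ Disjoint (sym (At.news≡ i)) (sym (At.insts≡ j))
          (fresh-insts (At.from j) (At.from i) (At.un i) (precedes (At.position j) (At.position i) j≤i))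
      ; fresh-vars   = λ i j j≤i x∈ x:τ → subst₂ (λ L τ → Disjoint L (pars τ))
          (sym (At.news≡ i)) (sym (U′-typing x:τ))
          (fresh-typing (At.from i) (At.un i) (consumed (At.from j) (At.from i)
            (precedes (At.position j) (At.position i) j≤i) (At.inputs⊆ j x∈)))
      ; principal₀   = principal-[] (mode go)
      ; principal    = At.isPrincipal
      }
      where
      -- `mode go` is given by the signature, so `pick` computes only after a match on the empty
      -- vector of modes.
      no-vars : ∀ (ms : Vec Mode 0) → varsᵛ (pick input ms []) ≡ []
      no-vars [] = refl
      no-inputs : ∀ (ms : Vec Mode 0) {x} → x ∉ varsᵛ (pick input ms [])
      no-inputs [] ()
      principal-[] : ∀ (ms : Vec Mode 0) → PrincipalFor ν′ 0 (pick input ms []) (pick input ms []) U′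
      principal-[] [] = record
        { fresh     = λ { (() , _) }
        ; Θ         = restrict [] par (λ ())
        ; principal = record
            { isSolution  = record { rigid = λ () ; solve = [] }
            ; mostGeneral = λ Θ̃ _ → Θ̃ , []
            }
        ; relevant  = λ ()
        ; typing    = λ ()
        }

theorem15 : (𝒮 : Signature) → let open Language 𝒮 in
    (C : Clause) (Q : Query) →
    NicelyTypedClause C → NicelyTypedQuery Q →
    (C′ : Clause) → RenamedApart C C′ Q →
    (k : Fin (length Q)) (Q′ : Query) → IsResolventAt Q k C′ Q′ →
    SolvableByModedUnification (lookup Q k) (head C′) →
    NicelyTypedQuery Q′
theorem15 𝒮 C Q NC NQ _ record { variant = ρ , ρ-injective , refl ; apart = apart } k _
          (θ , mgu , refl) moded =
  resolve moded refl refl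
  where
  open Language 𝒮
  -- Matching on `solvable` needs variables in place of the two atoms; the equations retain what
  -- they stand for.
  resolve : ∀ {A A′} → SolvableByModedUnification A A′ → lookup Q k ≡ A → A′ ≡ head C ⟦ var ∘ ρ ⟧ᵃ →
            NicelyTypedQuery (replace Q k (body C ⟦ var ∘ ρ ⟧ꟴ) ⟦ sub θ ⟧ꟴ)
  resolve (solvable moded) selected refl = Resolution.Step.nicelyTyped′ 𝒮 NC NQ ρ ρ-injective apart k
    selected θ (subst (λ A → IsMGU (head C ⟦ var ∘ ρ ⟧ᵃ) A θ) selected mgu) moded
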